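{- We have $$\lim_{n\to \infty}\frac{\#\{1\le k\le n\mid\mathrm{cp}_{5,1,6}(k) \text{ is even}\}}{n} = 1.$$ In particular, for a nonnegative integer $n$, $\mathrm{cp}_{5,1,6}(n)$ is even if some prime $p\equiv 2\pmod 3$ divides $6n+1$ to an odd power.
   Context: For integers $a,b,m\ge1$, an $(a,b,m)$-copartition is a triple of integer partitions $(\gamma,\rho,\sigma)$ such that every part of $\gamma$ is $\ge a$ and $\equiv a \pmod m$, every part of $\sigma$ is $\ge b$ and $\equiv b\pmod m$, and $\rho$ has exactly as many parts as $\sigma$, each part of $\rho$ being equal to $m$ times the number of parts of $\gamma$. Its size is the sum of all parts of $\gamma,\rho,\sigma$, and $\mathrm{cp}_{a,b,m}(n)$ denotes the number of $(a,b,m)$-copartitions of size $n$. -}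

module Defs where

open import Data.Nat using (ℕ; zero; suc; _+_; _*_; _∸_; _≤ᵇ_; _≡ᵇ_; _⊓_; NonZero)
open import Data.Nat.DivMod using (_%_)
open import Data.Bool using (Bool; true; false; _∧_; if_then_else_)
open import Data.List using (List; []; _∷_; [_]; map; concatMap; upTo; length; replicate)
open import Data.Nat.ListAction using (sum)

-- Integer partitions are represented canonically as non-increasing lists of
-- positive integers.  partsLE f n k lists all partitions of n whose parts
-- are all ≤ k (f is fuel; f = n suffices since every part is ≥ 1).
partsLE : ℕ → ℕ → ℕ → List (List ℕ)
partsLE f       zero    k = [ [] ]
partsLE zero    (suc n) k = []
partsLE (suc f) (suc n) k =
  concatMap (λ i → map (λ rest → suc i ∷ rest) (partsLE f (suc n ∸ suc i) (suc i)))
            (upTo (suc n ⊓ k))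

partitions : ℕ → List (List ℕ)
partitions n = partsLE n n n

record Triple : Set where
  constructor triple
  field
    γ ρ σ : List ℕ

-- Candidate triples for size n.  For a copartition, ρ is completely
-- determined by (γ , σ): it has length σ parts, each equal to m * length γ.
-- (When γ is empty these parts are 0; this is the paper's convention, matching
-- the generating function  Σ_{k,l≥0} q^{ak+bl+mkl}/((q^m;q^m)_k (q^m;q^m)_l).)
-- So we enumerate all pairs of partitions γ, σ of sizes ≤ n, attach this ρ,
-- and keep the triples whose total size is n.
sizeOf : Triple → ℕ
sizeOf (triple γ ρ σ) = sum γ + sum ρ + sum σ

candidates : (m : ℕ) → ℕ → List Triple
candidates m n =
  concatMap (λ i →
    concatMap (λ j →
      concatMap (λ γ →
        map (λ σ → triple γ (replicate (length σ) (m * length γ)) σ) (partitions j))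
      (partitions i))
    (upTo (suc n)))
  (upTo (suc n))

allᵇ : {A : Set} → (A → Bool) → List A → Bool
allᵇ p []       = true
allᵇ p (x ∷ xs) = p x ∧ allᵇ p xs

isCopartition : (a b m : ℕ) → .{{NonZero m}} → Triple → Bool
isCopartition a b m (triple γ ρ σ) =
  allᵇ (λ x → (a ≤ᵇ x) ∧ (x % m ≡ᵇ a % m)) γ ∧
  allᵇ (λ x → (b ≤ᵇ x) ∧ (x % m ≡ᵇ b % m)) σ ∧
  (length ρ ≡ᵇ length σ) ∧
  allᵇ (λ x → x ≡ᵇ m * length γ) ρ

count : {A : Set} → (A → Bool) → List A → ℕ
count p []       = zero
count p (x ∷ xs) = if p x then suc (count p xs) else count p xs

cp : (a b m : ℕ) → .{{NonZero m}} → ℕ → ℕ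
cp a b m n = count (λ t → isCopartition a b m t ∧ (sizeOf t ≡ᵇ n)) (candidates m n)

isEvenᵇ : ℕ → Bool
isEvenᵇ k = k % 2 ≡ᵇ 0

evenCount : ℕ → ℕ
evenCount n = count (λ k → isEvenᵇ (cp 5 1 6 k)) (map suc (upTo n))

{-# OPTIONS --safe #-}
-- Write f_k = (q^k ; q^k)_∞.  Removing a smallest part of σ or of γ gives two linear relations between the
-- generating functions of (a,b,m)-copartitions, which combine to (1 - q^b) CP_{a,b} = (1 - q^(a+b)) CP_{a,b+m};
-- iterating this for (5,1,6) gives CP f_1 = f_2 f_3, and modulo 2, where f_2 = f_1², CP ≡ f_1 f_3.  By the
-- pentagonal number theorem an odd cp(n) yields x² + 3y² = 4(6n+1), so that every prime p ≡ 2 (mod 3) divides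
-- 6n+1 to an even power.
--
-- For the density, let χ be the non-trivial character modulo 3 and r(m) = Σ_{d∣m} χ(d).  Then r ≥ 0,
-- Σ_{m≤x} r(m) = Σ_d χ(d) ⌊x/d⌋ ≤ x, and r(m) ≥ 1 for the m above.  If r(m) ≥ 1, then r(m) ≥ 2^j, where j counts the
-- primes of a finite set T (not containing 3) that divide m exactly once.  So either r(m) ≥ K, which happens for at most
-- x/K of the m ≤ x, or ∏_{p∈T} (1 - [p ∥ m]/2) ≥ 1/K.  The mean of this product over m is ∏_{p∈T} (1 - (p-1)/2p²),
-- which tends to 0 as T grows because Σ 1/p diverges.
module Submission where

-- Sieving by the primes p ≡ 2 (mod 3) alone would call for the divergence of Σ 1/p over that
-- progression, a case of Dirichlet's theorem. The function r lets every prime except 3 take part,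
-- so that Euler's divergence of Σ 1/p suffices. Indeed, where r(m) ≥ 1, a prime p ≠ 3 that divides
-- m exactly once must have χ(p) = 1 and contributes the factor 1 + χ(p) = 2. Hence many such primes
-- make r(m) large, which is rare because r has bounded mean, and few such primes are rare by Euler.
--
-- Only parity matters, so the series have coefficients in the field with two elements from the
-- start and signs disappear. Infinite sums and products are replaced by finite ones, with
-- identities asserted modulo q^(N+1). The density estimates are multiplied out into inequalities
-- between natural numbers; rational numbers enter only with the final ε.

-- The ring of formal power series over the field with two elements.

module PowerSeries where

  open import Data.Nat using (ℕ; zero; suc; _≤_; z≤n; s≤s)
  open import Data.Bool using (Bool; true; false; _∧_; _xor_)
  open import Data.Bool.Properties as BP using (xor-assoc; xor-comm; xor-identityʳ; xor-same; ∧-distribˡ-xor; ∧-distribʳ-xor; ∧-assoc; ∧-comm)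
  import Data.Nat.Properties as ℕP
  open import Data.Product using (_,_)
  open import Data.Maybe using (Maybe; just; nothing)
  open import Relation.Nullary using (yes; no)
  open import Relation.Binary using (IsEquivalence; Setoid)
  open import Relation.Binary.PropositionalEquality as ≡ using (_≡_; cong; cong₂; module ≡-Reasoning)
  open import Algebra.Bundles using (CommutativeRing)
  open import Algebra.Solver.Ring.AlmostCommutativeRing using (fromCommutativeRing; AlmostCommutativeRing; _-Raw-AlmostCommutative⟶_)
  open import Level using (0ℓ)

  -- Formal power series over the field with two elements.
  Series : Set
  Series = ℕ → Bool

  infix 4 _≈_ _≈[_]_
  infixl 6 _⊕_
  infixl 7 _⊛_

  -- Equality is a record, and addition is defined by cases on the index, so that the series involved can be
  -- inferred from an equation between them.
  record _≈_ (f g : Series) : Set where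
    constructor pointwise
    field at : ∀ n → f n ≡ g n

  -- Congruence modulo q^(N+1), the form in which truncated sums and products are compared.
  record _≈[_]_ (f : Series) (N : ℕ) (g : Series) : Set where
    constructor pointwise
    field at : ∀ n → n ≤ N → f n ≡ g n

  open _≈_ public
  open _≈[_]_ public renaming (at to at[])

  const : Bool → Series
  const b zero    = b
  const b (suc _) = false

  0ₛ 1ₛ : Series
  0ₛ = const false
  1ₛ = const true

  _⊕_ : Series → Series → Series
  (f ⊕ g) zero    = f zero xor g zero
  (f ⊕ g) (suc n) = f (suc n) xor g (suc n)

  ⊕-at : ∀ f g n → (f ⊕ g) n ≡ f n xor g n
  ⊕-at f g zero    = ≡.refl
  ⊕-at f g (suc n) = ≡.refl

  ∂ : Series → Series
  ∂ f n = f (suc n)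

  -- f g = f(0) g + q (∂f) g, which makes every ring law an induction on the index of the coefficient.
  _⊛_ : Series → Series → Series
  (f ⊛ g) zero    = f zero ∧ g zero
  (f ⊛ g) (suc n) = (f zero ∧ g (suc n)) xor (∂ f ⊛ g) n

  private
    xor-interchange : ∀ a b c d → (a xor b) xor (c xor d) ≡ (a xor c) xor (b xor d)
    xor-interchange a b c d = begin
      (a xor b) xor (c xor d) ≡⟨ xor-assoc a b _ ⟩
      a xor (b xor (c xor d)) ≡⟨ cong (a xor_) (≡.sym (xor-assoc b c d)) ⟩
      a xor ((b xor c) xor d) ≡⟨ cong (λ t → a xor (t xor d)) (xor-comm b c) ⟩
      a xor ((c xor b) xor d) ≡⟨ cong (a xor_) (xor-assoc c b d) ⟩
      a xor (c xor (b xor d)) ≡⟨ ≡.sym (xor-assoc a c _) ⟩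
      (a xor c) xor (b xor d) ∎
      where open ≡-Reasoning

  ⊛-cong[] : ∀ {N f f′ g g′} → f ≈[ N ] f′ → g ≈[ N ] g′ → f ⊛ g ≈[ N ] f′ ⊛ g′
  ⊛-cong[] {f = f} {f′} {g} {g′} (pointwise p) (pointwise q) = pointwise (coefficient _ f f′ g g′ p q)
    where
    coefficient : ∀ N f f′ g g′ → (∀ n → n ≤ N → f n ≡ f′ n) → (∀ n → n ≤ N → g n ≡ g′ n) →
      ∀ n → n ≤ N → (f ⊛ g) n ≡ (f′ ⊛ g′) n
    coefficient N f f′ g g′ p q zero l = cong₂ _∧_ (p 0 l) (q 0 l)
    coefficient (suc N) f f′ g g′ p q (suc n) (s≤s l) =
      cong₂ _xor_ (cong₂ _∧_ (p 0 z≤n) (q (suc n) (s≤s l)))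
        (coefficient N (∂ f) (∂ f′) g g′ (λ i l′ → p (suc i) (s≤s l′)) (λ i l′ → q i (ℕP.m≤n⇒m≤1+n l′)) n l)

  ⊕-cong[] : ∀ {N f f′ g g′} → f ≈[ N ] f′ → g ≈[ N ] g′ → f ⊕ g ≈[ N ] f′ ⊕ g′
  ⊕-cong[] (pointwise p) (pointwise q) = pointwise λ
    { zero l → cong₂ _xor_ (p 0 l) (q 0 l) ; (suc n) l → cong₂ _xor_ (p (suc n) l) (q (suc n) l) }

  ≈⇒≈[] : ∀ {N f g} → f ≈ g → f ≈[ N ] g
  ≈⇒≈[] (pointwise p) = pointwise λ n _ → p n

  []-setoid : ℕ → Setoid 0ℓ 0ℓ
  []-setoid N = record
    { Carrier = Series ; _≈_ = λ f g → f ≈[ N ] g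
    ; isEquivalence = record
      { refl = pointwise λ _ _ → ≡.refl
      ; sym = λ { (pointwise p) → pointwise λ n l → ≡.sym (p n l) }
      ; trans = λ { (pointwise p) (pointwise q) → pointwise λ n l → ≡.trans (p n l) (q n l) } } }

  ⊛-cong : ∀ {f f′ g g′} → f ≈ f′ → g ≈ g′ → f ⊛ g ≈ f′ ⊛ g′
  ⊛-cong p q = pointwise λ n → at[] (⊛-cong[] {n} (≈⇒≈[] p) (≈⇒≈[] q)) n ℕP.≤-refl

  ⊛-zeroˡ-at : ∀ f → (∀ n → f n ≡ false) → ∀ g n → (f ⊛ g) n ≡ false
  ⊛-zeroˡ-at f h g zero    = cong (_∧ g 0) (h 0)
  ⊛-zeroˡ-at f h g (suc n) = cong₂ _xor_ (cong (_∧ g (suc n)) (h 0)) (⊛-zeroˡ-at (∂ f) (λ i → h (suc i)) g n)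

  -- The sum is an arbitrary series `e` with a pointwise hypothesis, so that associativity can apply
  -- this to `∂ (f ⊛ g)`, which is f(0) ∂g + (∂f) g by definition without being a `⊕`.
  ⊛-distribʳ-at : ∀ h e f g → (∀ n → e n ≡ f n xor g n) → ∀ n → (e ⊛ h) n ≡ (f ⊛ h) n xor (g ⊛ h) n
  ⊛-distribʳ-at h e f g p zero    = ≡.trans (cong (_∧ h 0) (p 0)) (∧-distribʳ-xor (h 0) (f 0) (g 0))
  ⊛-distribʳ-at h e f g p (suc n) = ≡.trans
    (cong₂ _xor_ (≡.trans (cong (_∧ h (suc n)) (p 0)) (∧-distribʳ-xor (h (suc n)) (f 0) (g 0)))
                 (⊛-distribʳ-at h (∂ e) (∂ f) (∂ g) (λ i → p (suc i)) n))
    (xor-interchange (f 0 ∧ h (suc n)) (g 0 ∧ h (suc n)) _ _)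

  -- The mirror image of the recursion that defines `⊛`: the other end of the convolution is split
  -- off. Commutativity then is an induction.
  ⊛-sucʳ : ∀ f g n → (f ⊛ g) (suc n) ≡ (f (suc n) ∧ g 0) xor (f ⊛ ∂ g) n
  ⊛-sucʳ f g zero    = xor-comm (f 0 ∧ g 1) (f 1 ∧ g 0)
  ⊛-sucʳ f g (suc n) = begin
    a xor (∂ f ⊛ g) (suc n)                                    ≡⟨ cong (a xor_) (⊛-sucʳ (∂ f) g n) ⟩
    a xor (b xor (∂ f ⊛ ∂ g) n)                                ≡⟨ ≡.sym (xor-assoc a b _) ⟩
    (a xor b) xor (∂ f ⊛ ∂ g) n                                ≡⟨ cong (_xor (∂ f ⊛ ∂ g) n) (xor-comm a b) ⟩
    (b xor a) xor (∂ f ⊛ ∂ g) n                                ≡⟨ xor-assoc b a _ ⟩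
    b xor (a xor (∂ f ⊛ ∂ g) n)                                ∎
    where
    open ≡-Reasoning
    a = f 0 ∧ g (suc (suc n))
    b = f (suc (suc n)) ∧ g 0

  ⊛-comm-at : ∀ f g n → (f ⊛ g) n ≡ (g ⊛ f) n
  ⊛-comm-at f g zero    = ∧-comm (f 0) (g 0)
  ⊛-comm-at f g (suc n) = ≡.trans
    (cong₂ _xor_ (∧-comm (f 0) (g (suc n))) (⊛-comm-at (∂ f) g n)) (≡.sym (⊛-sucʳ g f n))

  const-⊛ : ∀ b g n → (const b ⊛ g) n ≡ b ∧ g n
  const-⊛ b g zero    = ≡.refl
  const-⊛ b g (suc n) = ≡.trans (cong ((b ∧ g (suc n)) xor_) (⊛-zeroˡ-at (∂ (const b)) (λ _ → ≡.refl) g n)) (xor-identityʳ _)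

  ⊛-scale : ∀ b g h n → ((λ i → b ∧ g i) ⊛ h) n ≡ b ∧ (g ⊛ h) n
  ⊛-scale b g h zero    = ∧-assoc b (g 0) (h 0)
  ⊛-scale b g h (suc n) = ≡.trans (cong₂ _xor_ (∧-assoc b (g 0) (h (suc n))) (⊛-scale b (∂ g) h n))
    (≡.sym (∧-distribˡ-xor b _ _))

  ⊛-assoc-at : ∀ f g h n → ((f ⊛ g) ⊛ h) n ≡ (f ⊛ (g ⊛ h)) n
  ⊛-assoc-at f g h zero    = ∧-assoc (f 0) (g 0) (h 0)
  ⊛-assoc-at f g h (suc n) = begin
    ((f 0 ∧ g 0) ∧ h (suc n)) xor (∂ (f ⊛ g) ⊛ h) n
      ≡⟨ cong₂ _xor_ (∧-assoc (f 0) (g 0) (h (suc n))) (⊛-distribʳ-at h (∂ (f ⊛ g)) (λ i → f 0 ∧ g (suc i)) (∂ f ⊛ g) (λ _ → ≡.refl) n) ⟩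
    (f 0 ∧ (g 0 ∧ h (suc n))) xor (((λ i → f 0 ∧ g (suc i)) ⊛ h) n xor ((∂ f ⊛ g) ⊛ h) n)
      ≡⟨ cong₂ (λ u v → (f 0 ∧ (g 0 ∧ h (suc n))) xor (u xor v)) (⊛-scale (f 0) (∂ g) h n) (⊛-assoc-at (∂ f) g h n) ⟩
    (f 0 ∧ (g 0 ∧ h (suc n))) xor ((f 0 ∧ (∂ g ⊛ h) n) xor (∂ f ⊛ (g ⊛ h)) n)
      ≡⟨ ≡.sym (xor-assoc (f 0 ∧ (g 0 ∧ h (suc n))) _ _) ⟩
    ((f 0 ∧ (g 0 ∧ h (suc n))) xor (f 0 ∧ (∂ g ⊛ h) n)) xor (∂ f ⊛ (g ⊛ h)) n
      ≡⟨ cong (_xor (∂ f ⊛ (g ⊛ h)) n) (≡.sym (∧-distribˡ-xor (f 0) _ _)) ⟩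
    (f 0 ∧ (g ⊛ h) (suc n)) xor (∂ f ⊛ (g ⊛ h)) n ∎
    where open ≡-Reasoning

  ⊛-identityˡ-at : ∀ f n → (1ₛ ⊛ f) n ≡ (f) n
  ⊛-identityˡ-at f n = const-⊛ true f n

  ⊛-distribʳ : ∀ h f g → (f ⊕ g) ⊛ h ≈ f ⊛ h ⊕ g ⊛ h
  ⊛-distribʳ h f g = pointwise λ n →
    ≡.trans (⊛-distribʳ-at h (f ⊕ g) f g (⊕-at f g) n) (≡.sym (⊕-at (f ⊛ h) (g ⊛ h) n))

  ⊛-identityˡ : ∀ f → 1ₛ ⊛ f ≈ f
  ⊛-identityˡ f = pointwise (⊛-identityˡ-at f)

  ≈-isEquivalence : IsEquivalence _≈_
  ≈-isEquivalence = record
    { refl = pointwise λ _ → ≡.refl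
    ; sym = λ { (pointwise p) → pointwise λ n → ≡.sym (p n) }
    ; trans = λ { (pointwise p) (pointwise q) → pointwise λ n → ≡.trans (p n) (q n) } }

  open IsEquivalence ≈-isEquivalence using () renaming (refl to ≈-refl; sym to ≈-sym; trans to ≈-trans) public

  0ₛ-at : ∀ n → 0ₛ n ≡ false
  0ₛ-at zero    = ≡.refl
  0ₛ-at (suc n) = ≡.refl

  ⊕-ext : ∀ {e f g} → (∀ n → e n ≡ f n xor g n) → e ≈ f ⊕ g
  ⊕-ext {f = f} {g} h = pointwise λ n → ≡.trans (h n) (≡.sym (⊕-at f g n))

  ⊕-cong : ∀ {f f′ g g′} → f ≈ f′ → g ≈ g′ → f ⊕ g ≈ f′ ⊕ g′
  ⊕-cong {f} {f′} {g} {g′} (pointwise p) (pointwise q) = ⊕-ext λ n → ≡.trans (⊕-at f g n) (cong₂ _xor_ (p n) (q n))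

  ⊕-comm : ∀ f g → f ⊕ g ≈ g ⊕ f
  ⊕-comm f g = ⊕-ext λ n → ≡.trans (⊕-at f g n) (xor-comm (f n) (g n))

  ⊕-assoc : ∀ f g h → (f ⊕ g) ⊕ h ≈ f ⊕ (g ⊕ h)
  ⊕-assoc f g h = pointwise λ { zero → xor-assoc (f 0) (g 0) (h 0) ; (suc n) → xor-assoc (f (suc n)) (g (suc n)) (h (suc n)) }

  ⊕-self : ∀ f → f ⊕ f ≈ 0ₛ
  ⊕-self f = pointwise λ n → ≡.trans (⊕-at f f n) (≡.trans (xor-same (f n)) (≡.sym (0ₛ-at n)))

  ⊕-identityˡ : ∀ f → 0ₛ ⊕ f ≈ f
  ⊕-identityˡ f = pointwise λ n → ≡.trans (⊕-at 0ₛ f n) (cong (_xor f n) (0ₛ-at n))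

  ⊛-comm : ∀ f g → f ⊛ g ≈ g ⊛ f
  ⊛-comm f g = pointwise (⊛-comm-at f g)

  ⊛-distribˡ : ∀ h f g → h ⊛ (f ⊕ g) ≈ h ⊛ f ⊕ h ⊛ g
  ⊛-distribˡ h f g = ≈-trans (⊛-comm h (f ⊕ g)) (≈-trans (⊛-distribʳ h f g) (⊕-cong (⊛-comm f h) (⊛-comm g h)))

  seriesRing : CommutativeRing 0ℓ 0ℓ
  seriesRing = record
    { Carrier = Series ; _≈_ = _≈_ ; _+_ = _⊕_ ; _*_ = _⊛_ ; -_ = λ f → f ; 0# = 0ₛ ; 1# = 1ₛ
    ; isCommutativeRing = record
      { isRing = record
        { +-isAbelianGroup = record
          { isGroup = record
            { isMonoid = record
              { isSemigroup = record
                { isMagma = record { isEquivalence = ≈-isEquivalence ; ∙-cong = ⊕-cong }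
                ; assoc = ⊕-assoc }
              ; identity = ⊕-identityˡ , (λ f → ≈-trans (⊕-comm f 0ₛ) (⊕-identityˡ f)) }
            ; inverse = ⊕-self , ⊕-self
            ; ⁻¹-cong = λ p → p }
          ; comm = ⊕-comm }
        ; *-cong = ⊛-cong
        ; *-assoc = λ f g h → pointwise (⊛-assoc-at f g h)
        ; *-identity = ⊛-identityˡ , (λ f → ≈-trans (⊛-comm f 1ₛ) (⊛-identityˡ f))
        ; distrib = ⊛-distribˡ , ⊛-distribʳ }
      ; *-comm = ⊛-comm } }

  open CommutativeRing seriesRing public using (setoid; zeroʳ)

  𝔽₂ : CommutativeRing 0ℓ 0ℓ
  𝔽₂ = BP.xor-∧-commutativeRing

  seriesACR : AlmostCommutativeRing 0ℓ 0ℓ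
  seriesACR = fromCommutativeRing seriesRing

  const-morphism : CommutativeRing.rawRing 𝔽₂ -Raw-AlmostCommutative⟶ seriesACR
  const-morphism = record
    { ⟦_⟧ = const
    ; +-homo = λ x y → pointwise λ { zero → ≡.refl ; (suc n) → ≡.refl }
    ; *-homo = λ x y → pointwise λ { zero → ≡.refl ; (suc n) → ≡.sym (≡.trans (const-⊛ x (const y) (suc n)) (BP.∧-zeroʳ x)) }
    ; -‿homo = λ x → ≈-refl
    ; 0-homo = ≈-refl
    ; 1-homo = ≈-refl }

  const≟ : ∀ x y → Maybe (const x ≈ const y)
  const≟ x y with x BP.≟ y
  ... | yes p = just (pointwise λ n → cong (λ b → const b n) p)
  ... | no  _ = nothing

  -- With coefficients in the two-element field, the solver knows that the characteristic is 2.
  open import Algebra.Solver.Ring (CommutativeRing.rawRing 𝔽₂) seriesACR const-morphism const≟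
    using (solve; _:=_; _:+_; _:*_; con) public

-- Generating functions of partitions into k parts from a residue class.

module PartitionSeries where

  open PowerSeries
  open import Data.Nat as ℕ using (ℕ; zero; suc; _≤_; _<_; s≤s; _≤ᵇ_; _≡ᵇ_; NonZero; _+_; _*_)
  open import Data.Nat.DivMod using (_%_; _/_; [m+n]%n≡m%n; m≡m%n+[m/n]*n)
  open import Data.Bool using (Bool; true; false; _∧_; _xor_)
  open import Data.Bool.Properties as BP using (T-≡; xor-identityʳ)
  import Data.Nat.Properties as ℕP
  open import Data.Empty using (⊥-elim)
  open import Function using (_∘_)
  open import Function.Bundles using (Equivalence)
  open import Relation.Nullary using (yes; no; ¬_)
  open import Relation.Binary.PropositionalEquality as ≡ using (_≡_; cong; cong₂; subst)
  import Relation.Binary.Reasoning.Setoid as SetoidReasoning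

  shift : Series → Series
  shift f zero    = false
  shift f (suc n) = f n

  q^_ : ℕ → Series
  q^ zero  = 1ₛ
  q^ suc k = shift (q^ k)

  infix 8 q^_

  shift-⊛ : ∀ f g → shift f ⊛ g ≈ shift (f ⊛ g)
  shift-⊛ f g = pointwise λ { zero → ≡.refl ; (suc n) → ≡.refl }

  shift-cong : ∀ {f g} → f ≈ g → shift f ≈ shift g
  shift-cong (pointwise p) = pointwise λ { zero → ≡.refl ; (suc n) → p n }

  q^-suc-⊛ : ∀ k f → q^ suc k ⊛ f ≈ shift (q^ k ⊛ f)
  q^-suc-⊛ k f = shift-⊛ (q^ k) f

  q^-+ : ∀ i j → q^ (i + j) ≈ q^ i ⊛ q^ j
  q^-+ zero    j = ≈-sym (⊛-identityˡ (q^ j))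
  q^-+ (suc i) j = ≈-trans (shift-cong (q^-+ i j)) (≈-sym (q^-suc-⊛ i (q^ j)))

  q^-cong : ∀ {i j} → i ≡ j → q^ i ≈ q^ j
  q^-cong ≡.refl = ≈-refl

  q^-⊛-low : ∀ k f n → n < k → (q^ k ⊛ f) n ≡ false
  q^-⊛-low (suc k) f zero    _       = ≡.refl
  q^-⊛-low (suc k) f (suc n) (s≤s l) = q^-⊛-low k f n l

  q^-⊛-+ : ∀ k f n → (q^ k ⊛ f) (k + n) ≡ f n
  q^-⊛-+ zero    f n = at (⊛-identityˡ f) n
  q^-⊛-+ (suc k) f n = q^-⊛-+ k f n

  q^-at : ∀ k n → (q^ k) n ≡ true → k ≡ n
  q^-at zero    zero    _ = ≡.refl
  q^-at (suc k) (suc n) e = cong suc (q^-at k n e)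

  const-cong : ∀ {a b} → a ≡ b → const a ≈ const b
  const-cong ≡.refl = ≈-refl

  const-false-⊛ : ∀ {b} f → b ≡ false → const b ⊛ f ≈ 0ₛ
  const-false-⊛ f ≡.refl = solve 1 (λ f → con false :* f := con false) ≈-refl f

  const-true-⊛ : ∀ {b} f → b ≡ true → const b ⊛ f ≈ f
  const-true-⊛ f ≡.refl = ⊛-identityˡ f

  ≤ᵇ-true : ∀ {i j} → i ≤ j → (i ≤ᵇ j) ≡ true
  ≤ᵇ-true l = Equivalence.to T-≡ (ℕP.≤⇒≤ᵇ l)

  ≤ᵇ-false : ∀ {i j} → ¬ (i ≤ j) → (i ≤ᵇ j) ≡ false
  ≤ᵇ-false {i} {j} h with i ≤ᵇ j in e
  ... | false = ≡.refl
  ... | true  = ⊥-elim (h (ℕP.≤ᵇ⇒≤ i j (Equivalence.from T-≡ e)))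

  ≤ᵇ-cong : ∀ {i j k l} → (i ≤ j → k ≤ l) → (k ≤ l → i ≤ j) → (i ≤ᵇ j) ≡ (k ≤ᵇ l)
  ≤ᵇ-cong {i} {j} f g with i ℕ.≤? j
  ... | yes p = ≡.trans (≤ᵇ-true p) (≡.sym (≤ᵇ-true (f p)))
  ... | no  p = ≡.trans (≤ᵇ-false p) (≡.sym (≤ᵇ-false (p ∘ g)))

  module _ (m : ℕ) .{{_ : NonZero m}} where

    -- The test that `isCopartition` applies to each part of γ and of σ.
    admissible : ℕ → ℕ → Bool
    admissible a x = (a ≤ᵇ x) ∧ (x % m ≡ᵇ a % m)

    admissible-self : ∀ a → admissible a a ≡ true
    admissible-self a = cong₂ _∧_ (≤ᵇ-true (ℕP.≤-refl {a})) (Equivalence.to T-≡ (ℕP.≡⇒≡ᵇ (a % m) (a % m) ≡.refl))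

    admissible-small : ∀ {a x} → x < a → admissible a x ≡ false
    admissible-small {a} {x} l = cong (_∧ (x % m ≡ᵇ a % m)) (≤ᵇ-false (ℕP.<⇒≱ l))

    admissible-translate : ∀ a x → admissible (a + m) (x + m) ≡ admissible a x
    admissible-translate a x = cong₂ _∧_
      (≤ᵇ-cong (ℕP.+-cancelʳ-≤ m a x) (ℕP.+-monoˡ-≤ m))
      (cong₂ _≡ᵇ_ ([m+n]%n≡m%n x m) ([m+n]%n≡m%n a m))

    next-in-class : ∀ {a x} → a < x → x % m ≡ a % m → a + m ≤ x
    next-in-class {a} {x} l e = subst (λ t → t + m ≤ x) (≡.sym (m≡m%n+[m/n]*n a m))
      (subst (λ t → a % m + a / m * m + m ≤ t) (≡.sym (m≡m%n+[m/n]*n x m))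
      (subst (λ t → a % m + a / m * m + m ≤ t + x / m * m) (≡.sym e)
      (subst (_≤ a % m + x / m * m) (≡.trans (cong (a % m +_) (ℕP.+-comm m _)) (≡.sym (ℕP.+-assoc (a % m) _ m)))
      (ℕP.+-monoʳ-≤ (a % m) (ℕP.*-monoˡ-≤ m quot<)))))
      where
      quot< : a / m < x / m
      quot< = ℕP.≰⇒> λ ge → ℕP.<⇒≱ l
        (subst (_≤ a) (≡.sym (m≡m%n+[m/n]*n x m))
        (subst (x % m + x / m * m ≤_) (≡.sym (m≡m%n+[m/n]*n a m))
        (ℕP.+-mono-≤ (ℕP.≤-reflexive e) (ℕP.*-monoˡ-≤ m ge))))

    -- The class of a has no element strictly between a and a + m, so raising the threshold by m
    -- excludes nothing above a.
    admissible-next : ∀ {a x} → a < x → admissible (a + m) x ≡ admissible a x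
    admissible-next {a} {x} l = ≡.trans (cong (λ t → (a + m ≤ᵇ x) ∧ (x % m ≡ᵇ t)) ([m+n]%n≡m%n a m)) same-residue
      where
      same-residue : (a + m ≤ᵇ x) ∧ (x % m ≡ᵇ a % m) ≡ (a ≤ᵇ x) ∧ (x % m ≡ᵇ a % m)
      same-residue with x % m ≡ᵇ a % m in e
      ... | false = ≡.trans (BP.∧-zeroʳ _) (≡.sym (BP.∧-zeroʳ _))
      ... | true  = cong (_∧ true) (≡.trans
        (≤ᵇ-true (next-in-class l (ℕP.≡ᵇ⇒≡ (x % m) (a % m) (Equivalence.from T-≡ e))))
        (≡.sym (≤ᵇ-true (ℕP.<⇒≤ l))))

    -- Partitions into exactly k admissible parts, all at most K.
    Z : ℕ → ℕ → ℕ → Series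
    Z a K       zero    = 1ₛ
    Z a zero    (suc k) = 0ₛ
    Z a (suc K) (suc k) = Z a K (suc k) ⊕ const (admissible a (suc K)) ⊛ (q^ suc K ⊛ Z a (suc K) k)

    Z-small : ∀ {a} K k → K < a → Z a K (suc k) ≈ 0ₛ
    Z-small zero    k l = ≈-refl
    Z-small {a} (suc K) k l = begin
      Z a K (suc k) ⊕ const (admissible a (suc K)) ⊛ _
        ≈⟨ ⊕-cong (Z-small K k (ℕP.<⇒≤ l)) (const-false-⊛ _ (admissible-small l)) ⟩
      0ₛ ⊕ 0ₛ ≈⟨ ⊕-self 0ₛ ⟩
      0ₛ ∎
      where open SetoidReasoning setoid

    -- Adding m to each of the k parts is a bijection that raises the size by mk. Positivity of a
    -- makes both sides vanish when K = 0 and there are parts.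
    Z-translate : ∀ {a} → 0 < a → ∀ K k → Z (a + m) (K + m) k ≈ q^ (m * k) ⊛ Z a K k
    Z-translate pos K zero = ≈-sym (≈-trans (⊛-cong (q^-cong (ℕP.*-zeroʳ m)) ≈-refl) (⊛-identityˡ 1ₛ))
    Z-translate {a} pos zero (suc k) = ≈-trans (Z-small m k (ℕP.+-monoˡ-< m pos)) (≈-sym (zeroʳ (q^ (m * suc k))))
    Z-translate {a} pos (suc K) (suc k) = begin
      Z (a + m) (K + m) (suc k) ⊕ const (admissible (a + m) (suc K + m)) ⊛ (q^ (suc K + m) ⊛ Z (a + m) (suc K + m) k)
        ≈⟨ ⊕-cong (Z-translate pos K (suc k)) (⊛-cong (const-cong (admissible-translate a (suc K)))
             (⊛-cong (q^-+ (suc K) m) (Z-translate pos (suc K) k))) ⟩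
      q^ (m * suc k) ⊛ Z a K (suc k) ⊕ const (admissible a (suc K)) ⊛ ((q^ suc K ⊛ q^ m) ⊛ (q^ (m * k) ⊛ Z a (suc K) k))
        ≈⟨ ⊕-cong ≈-refl (solve 5 (λ c x y z w → c :* ((x :* y) :* (z :* w)) := (y :* z) :* (c :* (x :* w)))
             ≈-refl (const (admissible a (suc K))) (q^ suc K) (q^ m) (q^ (m * k)) (Z a (suc K) k)) ⟩
      q^ (m * suc k) ⊛ Z a K (suc k) ⊕ (q^ m ⊛ q^ (m * k)) ⊛ (const (admissible a (suc K)) ⊛ (q^ suc K ⊛ Z a (suc K) k))
        ≈⟨ ⊕-cong ≈-refl (⊛-cong (≈-trans (≈-sym (q^-+ m (m * k))) (q^-cong (≡.sym (ℕP.*-suc m k)))) ≈-refl) ⟩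
      q^ (m * suc k) ⊛ Z a K (suc k) ⊕ q^ (m * suc k) ⊛ (const (admissible a (suc K)) ⊛ (q^ suc K ⊛ Z a (suc K) k))
        ≈⟨ ≈-sym (⊛-distribˡ (q^ (m * suc k)) _ _) ⟩
      q^ (m * suc k) ⊛ Z a (suc K) (suc k) ∎
      where open SetoidReasoning setoid

    -- Either the threshold does not occur as a part, and then all parts exceed it by at least m, or
    -- one copy of it can be removed. The bound K is at least the threshold, so that this copy is
    -- allowed.
    Z-smallest-part : ∀ a d k → let K = d + suc a in
      Z (suc a) K (suc k) ≈ Z (suc a + m) K (suc k) ⊕ q^ suc a ⊛ Z (suc a) K k
    Z-smallest-part a zero k = begin
      Z (suc a) a (suc k) ⊕ const (admissible (suc a) (suc a)) ⊛ (q^ suc a ⊛ Z (suc a) (suc a) k)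
        ≈⟨ ⊕-cong (Z-small a k ℕP.≤-refl) (const-true-⊛ _ (admissible-self (suc a))) ⟩
      0ₛ ⊕ q^ suc a ⊛ Z (suc a) (suc a) k
        ≈⟨ ⊕-cong (≈-sym (Z-small (suc a) k (ℕP.m<m+n (suc a) (ℕ.>-nonZero⁻¹ m)))) ≈-refl ⟩
      Z (suc a + m) (suc a) (suc k) ⊕ q^ suc a ⊛ Z (suc a) (suc a) k ∎
      where open SetoidReasoning setoid
    Z-smallest-part a (suc d) zero = begin
      Z (suc a) K 1 ⊕ c ⊛ (x ⊛ 1ₛ)                        ≈⟨ ⊕-cong (Z-smallest-part a d 0) ≈-refl ⟩
      (Z (suc a + m) K 1 ⊕ y ⊛ 1ₛ) ⊕ c ⊛ (x ⊛ 1ₛ)        ≈⟨ solve 4 (λ s t u v → (s :+ t) :+ u :* v := (s :+ u :* v) :+ t) ≈-refl (Z (suc a + m) K 1) (y ⊛ 1ₛ) c (x ⊛ 1ₛ) ⟩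
      (Z (suc a + m) K 1 ⊕ c ⊛ (x ⊛ 1ₛ)) ⊕ y ⊛ 1ₛ        ≈⟨ ⊕-cong (⊕-cong ≈-refl (⊛-cong c≈c′ ≈-refl)) ≈-refl ⟩
      (Z (suc a + m) K 1 ⊕ c′ ⊛ (x ⊛ 1ₛ)) ⊕ y ⊛ 1ₛ       ∎
      where
      open SetoidReasoning setoid
      K = d + suc a
      c = const (admissible (suc a) (suc K))
      c′ = const (admissible (suc a + m) (suc K))
      x = q^ suc K
      y = q^ suc a
      c≈c′ : c ≈ c′
      c≈c′ = const-cong (≡.sym (admissible-next (s≤s (ℕP.m≤n+m (suc a) d))))
    Z-smallest-part a (suc d) (suc k) = begin
      Z (suc a) K (2 + k) ⊕ c ⊛ (x ⊛ Z (suc a) (suc K) (suc k))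
        ≈⟨ ⊕-cong (Z-smallest-part a d (suc k)) (⊛-cong c≈c′ (⊛-cong ≈-refl (Z-smallest-part a (suc d) k))) ⟩
      (Z (suc a + m) K (2 + k) ⊕ y ⊛ Z (suc a) K (suc k)) ⊕ c′ ⊛ (x ⊛ (Z (suc a + m) (suc K) (suc k) ⊕ y ⊛ Z (suc a) (suc K) k))
        ≈⟨ solve 7 (λ A y B c x C D → (A :+ y :* B) :+ c :* (x :* (C :+ y :* D)) := (A :+ c :* (x :* C)) :+ y :* (B :+ c :* (x :* D))) ≈-refl
             (Z (suc a + m) K (2 + k)) y (Z (suc a) K (suc k)) c′ x (Z (suc a + m) (suc K) (suc k)) (Z (suc a) (suc K) k) ⟩
      Z (suc a + m) (suc K) (2 + k) ⊕ y ⊛ (Z (suc a) K (suc k) ⊕ c′ ⊛ (x ⊛ Z (suc a) (suc K) k))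
        ≈⟨ ⊕-cong ≈-refl (⊛-cong ≈-refl (⊕-cong ≈-refl (⊛-cong (≈-sym c≈c′) ≈-refl))) ⟩
      Z (suc a + m) (suc K) (2 + k) ⊕ y ⊛ Z (suc a) (suc K) (suc k) ∎
      where
      open SetoidReasoning setoid
      K = d + suc a
      c = const (admissible (suc a) (suc K))
      c′ = const (admissible (suc a + m) (suc K))
      x = q^ suc K
      y = q^ suc a
      c≈c′ : c ≈ c′
      c≈c′ = const-cong (≡.sym (admissible-next (s≤s (ℕP.m≤n+m (suc a) d))))

    -- A part larger than K cannot occur in a partition of a number up to K.
    Z-stable : ∀ a K d k → Z a (d + K) k ≈[ K ] Z a K k
    Z-stable a K zero    k       = pointwise λ n l → ≡.refl
    Z-stable a K (suc d) zero    = pointwise λ n l → ≡.refl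
    Z-stable a K (suc d) (suc k) = pointwise λ n l → ≡.trans (≡.trans (⊕-at (Z a (d + K) (suc k)) _ n)
      (cong₂ _xor_ (at[] (Z-stable a K d (suc k)) n l)
        (≡.trans (const-⊛ _ _ n) (≡.trans
          (cong (admissible a (suc d + K) ∧_) (q^-⊛-low (suc d + K) (Z a (suc d + K) k) n (s≤s (ℕP.≤-trans l (ℕP.m≤n+m K d)))))
          (BP.∧-zeroʳ _)))))
      (xor-identityʳ _)

    Z-low : ∀ a K k n → n < k → Z a K k n ≡ false
    Z-low a zero    (suc k) n l = 0ₛ-at n
    Z-low a (suc K) (suc k) n l = ≡.trans (⊕-at (Z a K (suc k)) _ n) (cong₂ _xor_ (Z-low a K (suc k) n l)
      (≡.trans (const-⊛ (admissible a (suc K)) _ n) (≡.trans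
        (cong (admissible a (suc K) ∧_) (≡.trans (at (q^-suc-⊛ K (Z a (suc K) k)) n) (shifted n l)))
        (BP.∧-zeroʳ _))))
      where
      q^-⊛-vanish : ∀ j f n → (∀ i → i ≤ n → f i ≡ false) → (q^ j ⊛ f) n ≡ false
      q^-⊛-vanish zero    f n       h = ≡.trans (at (⊛-identityˡ f) n) (h n ℕP.≤-refl)
      q^-⊛-vanish (suc j) f zero    h = ≡.refl
      q^-⊛-vanish (suc j) f (suc n) h = q^-⊛-vanish j f n (λ i i≤n → h i (ℕP.m≤n⇒m≤1+n i≤n))
      shifted : ∀ n → n < suc k → shift (q^ K ⊛ Z a (suc K) k) n ≡ false
      shifted zero    _       = ≡.refl
      shifted (suc n) (s≤s l) = q^-⊛-vanish K (Z a (suc K) k) n (λ i i≤n → Z-low a (suc K) k i (ℕP.≤-<-trans i≤n l))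

    -- The coefficient at q^n of Z a K k does not depend on K ≥ n.
    P : ℕ → ℕ → Series
    P a k n = Z a n k n

    P-Z : ∀ a K k → P a k ≈[ K ] Z a K k
    P-Z a K k = pointwise λ n l → ≡.trans (≡.sym (at[] (Z-stable a n (K ℕ.∸ n) k) n ℕP.≤-refl))
      (cong (λ t → Z a t k n) (ℕP.m∸n+n≡m l))

    P-low : ∀ a k n → n < k → P a k n ≡ false
    P-low a k n l = Z-low a n k n l

    P-small : ∀ a k n → n < a → P a (suc k) n ≡ false
    P-small a k n l = ≡.trans (at (Z-small n k l) n) (0ₛ-at n)

    ≈[]-limit : ∀ {f g} → (∀ n → f ≈[ n ] g) → f ≈ g
    ≈[]-limit h = pointwise λ n → at[] (h n) n ℕP.≤-refl

    ≈[]-mono : ∀ {M N f g} → M ≤ N → f ≈[ N ] g → f ≈[ M ] g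
    ≈[]-mono M≤N (pointwise p) = pointwise λ n l → p n (ℕP.≤-trans l M≤N)

    P-translate : ∀ {a} → 0 < a → ∀ k → P (a + m) k ≈ q^ (m * k) ⊛ P a k
    P-translate {a} pos k = ≈[]-limit λ N → let open SetoidReasoning ([]-setoid N) in begin
      P (a + m) k           ≈⟨ ≈[]-mono (ℕP.m≤m+n N m) (P-Z (a + m) (N + m) k) ⟩
      Z (a + m) (N + m) k   ≈⟨ ≈⇒≈[] (Z-translate pos N k) ⟩
      q^ (m * k) ⊛ Z a N k  ≈⟨ ⊛-cong[] (≈⇒≈[] (≈-refl {q^ (m * k)})) (P-Z a N k) ⟨
      q^ (m * k) ⊛ P a k    ∎

    P-smallest-part : ∀ {a} → 0 < a → ∀ k → P a (suc k) ≈ P (a + m) (suc k) ⊕ q^ a ⊛ P a k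
    P-smallest-part {suc a} pos k = ≈[]-limit λ N →
      let open SetoidReasoning ([]-setoid N)
          K = N + suc a
          P-Z′ : ∀ b k → P b k ≈[ N ] Z b K k
          P-Z′ b k = ≈[]-mono (ℕP.m≤m+n N (suc a)) (P-Z b K k)
      in begin
      P (suc a) (suc k)                                       ≈⟨ P-Z′ (suc a) (suc k) ⟩
      Z (suc a) K (suc k)                                     ≈⟨ ≈⇒≈[] (Z-smallest-part a N k) ⟩
      Z (suc a + m) K (suc k) ⊕ q^ suc a ⊛ Z (suc a) K k      ≈⟨ ⊕-cong[] (P-Z′ (suc a + m) (suc k)) (⊛-cong[] (≈⇒≈[] (≈-refl {q^ suc a})) (P-Z′ (suc a) k)) ⟨
      P (suc a + m) (suc k) ⊕ q^ suc a ⊛ P (suc a) k          ∎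

-- Linear relations between the generating functions of copartitions.

module CopartitionSeries where

  open PowerSeries
  open PartitionSeries
  open import Data.Nat as ℕ using (ℕ; zero; suc; _≤_; _<_; z≤n; s≤s; NonZero; _+_; _*_)
  open import Data.Bool using (true; false; _∧_; _xor_)
  open import Data.Bool.Properties as BP using (xor-identityʳ)
  import Data.Nat.Properties as ℕP
  open import Data.Nat.Tactic.RingSolver using (solve-∀)
  open import Relation.Binary.PropositionalEquality as ≡ using (_≡_; cong; cong₂; subst)
  open import Relation.Binary using (Setoid)
  import Relation.Binary.Reasoning.Setoid as SetoidReasoning

  ≈[]-refl : ∀ {N f} → f ≈[ N ] f
  ≈[]-refl {N} = Setoid.refl ([]-setoid N)

  ≈[]-trans : ∀ {N f g h} → f ≈[ N ] g → g ≈[ N ] h → f ≈[ N ] h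
  ≈[]-trans {N} = Setoid.trans ([]-setoid N)

  ≈[]-sym : ∀ {N f g} → f ≈[ N ] g → g ≈[ N ] f
  ≈[]-sym {N} = Setoid.sym ([]-setoid N)

  ⊛-congʳ[] : ∀ {N} f {g h} → g ≈[ N ] h → f ⊛ g ≈[ N ] f ⊛ h
  ⊛-congʳ[] f = ⊛-cong[] (≈[]-refl {f = f})

  -- A series with constant term 1 is a unit. Instead of constructing its inverse, the coefficients
  -- of the difference are shown to vanish one after another.
  ⊛-cancelˡ[] : ∀ {N} f {g h} → f 0 ≡ true → f ⊛ g ≈[ N ] f ⊛ h → g ≈[ N ] h
  ⊛-cancelˡ[] {N} f {g} {h} f0 p = pointwise λ n n≤N → xor-≡ (g n) (h n)
    (≡.trans (≡.sym (⊕-at g h n)) (divide N (g ⊕ h) difference n n≤N))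
    where
    xor-≡ : ∀ a b → a xor b ≡ false → a ≡ b
    xor-≡ false false _ = ≡.refl
    xor-≡ true  true  _ = ≡.refl
    divide : ∀ N d → (∀ n → n ≤ N → (d ⊛ f) n ≡ false) → ∀ n → n ≤ N → d n ≡ false
    divide N d z zero l = ≡.trans (≡.sym (BP.∧-identityʳ (d 0))) (≡.trans (cong (d 0 ∧_) (≡.sym f0)) (z 0 z≤n))
    divide (suc N) d z (suc n) (s≤s l) = divide N (∂ d) (λ i i≤N → ≡.trans
      (cong (λ b → (b ∧ f (suc i)) xor (∂ d ⊛ f) i) (≡.sym (divide (suc N) d z 0 z≤n))) (z (suc i) (s≤s i≤N))) n l
    difference : ∀ n → n ≤ N → ((g ⊕ h) ⊛ f) n ≡ false
    difference n n≤N = ≡.trans (at (≈-trans (⊛-comm (g ⊕ h) f) (⊛-distribˡ f g h)) n)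
      (≡.trans (⊕-at (f ⊛ g) (f ⊛ h) n) (≡.trans (cong (_xor (f ⊛ h) n) (at[] p n n≤N)) (BP.xor-same ((f ⊛ h) n))))

  -- A positive power of q gains one order. This pays for the last term that a truncated sum loses
  -- when its index is shifted by one.
  q^-⊛-cong[] : ∀ {N b f g} → 0 < b → (∀ n → n < N → f n ≡ g n) → q^ b ⊛ f ≈[ N ] q^ b ⊛ g
  q^-⊛-cong[] {N} {suc b} {f} {g} _ p = pointwise λ
    { zero    l → ≡.refl
    ; (suc n) l → at[] {N = n} (⊛-congʳ[] (q^ b) (pointwise λ i i≤n → p i (ℕP.≤-<-trans i≤n l))) n ℕP.≤-refl }

  Σₛ : (ℕ → Series) → ℕ → Series
  Σₛ f zero    = 0ₛ
  Σₛ f (suc n) = Σₛ f n ⊕ f n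

  Σₛ-cong[] : ∀ {N f g} n → (∀ i → f i ≈[ N ] g i) → Σₛ f n ≈[ N ] Σₛ g n
  Σₛ-cong[] zero    h = ≈[]-refl
  Σₛ-cong[] (suc n) h = ⊕-cong[] (Σₛ-cong[] n h) (h n)

  Σₛ-cong : ∀ {f g} n → (∀ i → f i ≈ g i) → Σₛ f n ≈ Σₛ g n
  Σₛ-cong zero    h = ≈-refl
  Σₛ-cong (suc n) h = ⊕-cong (Σₛ-cong n h) (h n)

  Σₛ-⊕ : ∀ f g n → Σₛ (λ i → f i ⊕ g i) n ≈ Σₛ f n ⊕ Σₛ g n
  Σₛ-⊕ f g zero    = ≈-sym (⊕-identityˡ 0ₛ)
  Σₛ-⊕ f g (suc n) = ≈-trans (⊕-cong (Σₛ-⊕ f g n) ≈-refl)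
    (solve 4 (λ a b c d → (a :+ b) :+ (c :+ d) := (a :+ c) :+ (b :+ d)) ≈-refl (Σₛ f n) (Σₛ g n) (f n) (g n))

  Σₛ-⊛ : ∀ x f n → x ⊛ Σₛ f n ≈ Σₛ (λ i → x ⊛ f i) n
  Σₛ-⊛ x f zero    = zeroʳ x
  Σₛ-⊛ x f (suc n) = ≈-trans (⊛-distribˡ x (Σₛ f n) (f n)) (⊕-cong (Σₛ-⊛ x f n) ≈-refl)

  Σₛ-swap : ∀ (f : ℕ → ℕ → Series) n k → Σₛ (λ i → Σₛ (f i) k) n ≈ Σₛ (λ j → Σₛ (λ i → f i j) n) k
  Σₛ-swap f zero    zero    = ≈-refl
  Σₛ-swap f zero    (suc k) = ≈-trans (≈-sym (⊕-identityˡ 0ₛ)) (⊕-cong (Σₛ-swap f zero k) ≈-refl)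
  Σₛ-swap f (suc n) k       = ≈-trans (⊕-cong (Σₛ-swap f n k) ≈-refl) (≈-sym (Σₛ-⊕ (λ j → Σₛ (λ i → f i j) n) (f n) k))

  Σₛ-head[] : ∀ {N} f n → (∀ i → f (suc i) ≈[ N ] 0ₛ) → Σₛ f (suc n) ≈[ N ] f 0
  Σₛ-head[] f zero    h = ≈⇒≈[] (⊕-identityˡ (f 0))
  Σₛ-head[] f (suc n) h = ≈[]-trans (⊕-cong[] (Σₛ-head[] f n h) (h n))
    (≈⇒≈[] (≈-trans (⊕-comm (f 0) 0ₛ) (⊕-identityˡ (f 0))))

  module _ (m : ℕ) .{{_ : NonZero m}} where

    -- The copartitions whose γ has exactly k parts contribute P a k times a sum over the number l of parts of σ.
    Cσ : ℕ → ℕ → ℕ → Series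
    Cσ b k L = Σₛ (λ l → P m b l ⊛ q^ (m * k * l)) L

    -- The numbers of parts of γ and of σ are restricted to at most N, which is harmless up to q^N
    -- because k positive parts have size at least k.
    C : ℕ → ℕ → ℕ → Series
    C N a b = Σₛ (λ k → P m a k ⊛ Cσ b k (suc N)) (suc N)

    -- Removing a part b from σ also removes a part mk from ρ, whence the factor q^(mk), and
    -- shortens the range of l by one.
    Cσ-smallest-part : ∀ {b} → 0 < b → ∀ k L →
      Cσ b k (suc L) ≈ Cσ (b + m) k (suc L) ⊕ q^ b ⊛ (q^ (m * k) ⊛ Cσ b k L)
    Cσ-smallest-part {b} pos k zero = ≈-sym (≈-trans
      (⊕-cong ≈-refl (⊛-cong (≈-refl {q^ b}) (zeroʳ (q^ (m * k)))))
      (solve 2 (λ x y → x :+ y :* con false := x) ≈-refl (Cσ (b + m) k 1) (q^ b)))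
    Cσ-smallest-part {b} pos k (suc L) = begin
      Cσ b k (suc L) ⊕ P m b (suc L) ⊛ q^ (m * k * suc L)
        ≈⟨ ⊕-cong (Cσ-smallest-part pos k L) (⊛-cong (P-smallest-part m pos L) ≈-refl) ⟩
      (Cσ (b + m) k (suc L) ⊕ q^ b ⊛ (q^ (m * k) ⊛ Cσ b k L)) ⊕ (P m (b + m) (suc L) ⊕ q^ b ⊛ P m b L) ⊛ q^ (m * k * suc L)
        ≈⟨ ⊕-cong ≈-refl (≈-trans (⊛-distribʳ (q^ (m * k * suc L)) (P m (b + m) (suc L)) (q^ b ⊛ P m b L)) (⊕-cong ≈-refl (⊛-cong ≈-refl weight))) ⟩
      (Cσ (b + m) k (suc L) ⊕ q^ b ⊛ (q^ (m * k) ⊛ Cσ b k L)) ⊕ (P m (b + m) (suc L) ⊛ q^ (m * k * suc L) ⊕ (q^ b ⊛ P m b L) ⊛ (q^ (m * k) ⊛ q^ (m * k * L)))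
        ≈⟨ solve 7 (λ A y w B E F G → (A :+ y :* (w :* B)) :+ (E :+ (y :* F) :* (w :* G)) := (A :+ E) :+ y :* (w :* (B :+ F :* G))) ≈-refl
             (Cσ (b + m) k (suc L)) (q^ b) (q^ (m * k)) (Cσ b k L) (P m (b + m) (suc L) ⊛ q^ (m * k * suc L)) (P m b L) (q^ (m * k * L)) ⟩
      Cσ (b + m) k (2 + L) ⊕ q^ b ⊛ (q^ (m * k) ⊛ Cσ b k (suc L)) ∎
      where
      open SetoidReasoning setoid
      weight : q^ (m * k * suc L) ≈ q^ (m * k) ⊛ q^ (m * k * L)
      weight = ≈-trans (q^-cong (ℕP.*-suc (m * k) L)) (q^-+ (m * k) (m * k * L))

    Cσ-smallest-part[] : ∀ {b} → 0 < b → ∀ k N →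
      Cσ b k (suc N) ≈[ N ] Cσ (b + m) k (suc N) ⊕ q^ b ⊛ (q^ (m * k) ⊛ Cσ b k (suc N))
    Cσ-smallest-part[] {b} pos k N = ≈[]-trans (≈⇒≈[] (Cσ-smallest-part pos k N))
      (⊕-cong[] ≈[]-refl (q^-⊛-cong[] pos λ n n<N → at[] {N = n} (⊛-congʳ[] (q^ (m * k)) (last-term n n<N)) n ℕP.≤-refl))
      where
      last-term : ∀ n → n < N → Cσ b k N ≈[ n ] Cσ b k (suc N)
      last-term n n<N = let open SetoidReasoning ([]-setoid n) in begin
        Cσ b k N                                ≈⟨ ≈⇒≈[] (solve 2 (λ x y → x := x :+ con false :* y) ≈-refl (Cσ b k N) (q^ (m * k * N))) ⟩
        Cσ b k N ⊕ 0ₛ ⊛ q^ (m * k * N)          ≈⟨ ⊕-cong[] ≈[]-refl (⊛-cong[] (pointwise λ i i≤n → ≡.trans (0ₛ-at i) (≡.sym (P-low m b N i (ℕP.≤-<-trans i≤n n<N)))) ≈[]-refl) ⟩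
        Cσ b k N ⊕ P m b N ⊛ q^ (m * k * N)     ∎

    -- The total size mkl of ρ is symmetric in the numbers k and l of parts of γ and σ.
    C-swap : ∀ N a b → C N a b ≈ C N b a
    C-swap N a b = begin
      Σₛ (λ k → P m a k ⊛ Cσ b k (suc N)) (suc N)
        ≈⟨ Σₛ-cong (suc N) (λ k → Σₛ-⊛ (P m a k) (λ l → P m b l ⊛ q^ (m * k * l)) (suc N)) ⟩
      Σₛ (λ k → Σₛ (λ l → P m a k ⊛ (P m b l ⊛ q^ (m * k * l))) (suc N)) (suc N)
        ≈⟨ Σₛ-swap (λ k l → P m a k ⊛ (P m b l ⊛ q^ (m * k * l))) (suc N) (suc N) ⟩
      Σₛ (λ l → Σₛ (λ k → P m a k ⊛ (P m b l ⊛ q^ (m * k * l))) (suc N)) (suc N)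
        ≈⟨ Σₛ-cong (suc N) (λ l → Σₛ-cong (suc N) (λ k → ≈-trans
             (solve 3 (λ x y z → x :* (y :* z) := y :* (x :* z)) ≈-refl (P m a k) (P m b l) (q^ (m * k * l)))
             (⊛-cong (≈-refl {P m b l}) (⊛-cong (≈-refl {P m a k}) (q^-cong (exponent m k l)))))) ⟩
      Σₛ (λ l → Σₛ (λ k → P m b l ⊛ (P m a k ⊛ q^ (m * l * k))) (suc N)) (suc N)
        ≈⟨ Σₛ-cong (suc N) (λ l → Σₛ-⊛ (P m b l) (λ k → P m a k ⊛ q^ (m * l * k)) (suc N)) ⟨
      Σₛ (λ l → P m b l ⊛ Cσ a l (suc N)) (suc N) ∎
      where
      open SetoidReasoning setoid
      exponent : ∀ m k l → m * k * l ≡ m * l * k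
      exponent = solve-∀

    -- The factor q^(mk), left by the removed part of ρ, is absorbed into γ by `P-translate`: each
    -- of its k parts grows by m, which turns a into a + m.
    C-smallest-σ : ∀ N {a b} → 0 < a → 0 < b → C N a b ≈[ N ] C N a (b + m) ⊕ q^ b ⊛ C N (a + m) b
    C-smallest-σ N {a} {b} a>0 b>0 = begin
      Σₛ (λ k → P m a k ⊛ S b k) (suc N)
        ≈⟨ Σₛ-cong[] (suc N) (λ k → ⊛-congʳ[] (P m a k) (Cσ-smallest-part[] b>0 k N)) ⟩
      Σₛ (λ k → P m a k ⊛ (S (b + m) k ⊕ q^ b ⊛ (q^ (m * k) ⊛ S b k))) (suc N)
        ≈⟨ ≈⇒≈[] (Σₛ-cong (suc N) (λ k → ≈-trans
             (solve 5 (λ p s y w t → p :* (s :+ y :* (w :* t)) := p :* s :+ y :* ((w :* p) :* t)) ≈-refl (P m a k) (S (b + m) k) (q^ b) (q^ (m * k)) (S b k))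
             (⊕-cong ≈-refl (⊛-cong (≈-refl {q^ b}) (⊛-cong (≈-sym (P-translate m a>0 k)) ≈-refl))))) ⟩
      Σₛ (λ k → P m a k ⊛ S (b + m) k ⊕ q^ b ⊛ (P m (a + m) k ⊛ S b k)) (suc N)
        ≈⟨ ≈⇒≈[] (Σₛ-⊕ (λ k → P m a k ⊛ S (b + m) k) (λ k → q^ b ⊛ (P m (a + m) k ⊛ S b k)) (suc N)) ⟩
      C N a (b + m) ⊕ Σₛ (λ k → q^ b ⊛ (P m (a + m) k ⊛ S b k)) (suc N)
        ≈⟨ ≈⇒≈[] (⊕-cong ≈-refl (Σₛ-⊛ (q^ b) (λ k → P m (a + m) k ⊛ S b k) (suc N))) ⟨
      C N a (b + m) ⊕ q^ b ⊛ C N (a + m) b ∎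
      where
      open SetoidReasoning ([]-setoid N)
      S : ℕ → ℕ → Series
      S b k = Cσ b k (suc N)

    C-smallest-γ : ∀ N {a b} → 0 < a → 0 < b → C N a b ≈[ N ] C N (a + m) b ⊕ q^ a ⊛ C N a (b + m)
    C-smallest-γ N {a} {b} a>0 b>0 = ≈[]-trans (≈⇒≈[] (C-swap N a b)) (≈[]-trans (C-smallest-σ N b>0 a>0)
      (≈⇒≈[] (⊕-cong (C-swap N b (a + m)) (⊛-cong (≈-refl {q^ a}) (C-swap N (b + m) a)))))

    -- Eliminating C N (a + m) b from the two relations above.
    C-ratio : ∀ N {a b} → 0 < a → 0 < b →
      (1ₛ ⊕ q^ b) ⊛ C N a b ≈[ N ] (1ₛ ⊕ q^ (a + b)) ⊛ C N a (b + m)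
    C-ratio N {a} {b} a>0 b>0 = begin
      (1ₛ ⊕ y) ⊛ c                 ≈⟨ ≈⇒≈[] (solve 2 (λ y c → (con true :+ y) :* c := c :+ y :* c) ≈-refl y c) ⟩
      c ⊕ y ⊛ c                    ≈⟨ ⊕-cong[] (C-smallest-σ N a>0 b>0) (⊛-congʳ[] y (C-smallest-γ N a>0 b>0)) ⟩
      (d ⊕ y ⊛ e) ⊕ y ⊛ (e ⊕ x ⊛ d) ≈⟨ ≈⇒≈[] (solve 4 (λ x y d e → (d :+ y :* e) :+ y :* (e :+ x :* d) := (con true :+ x :* y) :* d) ≈-refl x y d e) ⟩
      (1ₛ ⊕ x ⊛ y) ⊛ d             ≈⟨ ≈⇒≈[] (⊛-cong (⊕-cong ≈-refl (q^-+ a b)) ≈-refl) ⟨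
      (1ₛ ⊕ q^ (a + b)) ⊛ d        ∎
      where
      open SetoidReasoning ([]-setoid N)
      x = q^ a
      y = q^ b
      c = C N a b
      d = C N a (b + m)
      e = C N (a + m) b

    -- When both thresholds exceed N, only the copartition with γ and σ empty has size at most N.
    -- This ends the telescoping.
    C-unit : ∀ N {a b} → N < a → N < b → C N a b ≈[ N ] 1ₛ
    C-unit N {a} {b} N<a N<b = begin
      C N a b                        ≈⟨ Σₛ-head[] (λ k → P m a k ⊛ Cσ b k (suc N)) N (λ k → vanish N<a k (Cσ b (suc k) (suc N))) ⟩
      P m a 0 ⊛ Cσ b 0 (suc N)       ≈⟨ ⊛-congʳ[] (P m a 0) (Σₛ-head[] (λ l → P m b l ⊛ q^ (m * 0 * l)) N (λ l → vanish N<b l (q^ (m * 0 * suc l)))) ⟩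
      1ₛ ⊛ (1ₛ ⊛ q^ (m * 0 * 0))     ≈⟨ ≈⇒≈[] (⊛-cong (≈-refl {1ₛ}) (⊛-cong (≈-refl {1ₛ}) (q^-cong (ℕP.*-zeroʳ (m * 0))))) ⟩
      1ₛ ⊛ (1ₛ ⊛ 1ₛ)                 ≈⟨ ≈⇒≈[] (solve 0 (con true :* (con true :* con true) := con true) ≈-refl) ⟩
      1ₛ                             ∎
      where
      open SetoidReasoning ([]-setoid N)
      vanish : ∀ {a} → N < a → ∀ k y → P m a (suc k) ⊛ y ≈[ N ] 0ₛ
      vanish {a} N<a k y = ≈[]-trans
        (⊛-cong[] {g = y} (pointwise λ n n≤N → ≡.trans (P-small m a k n (ℕP.≤-<-trans n≤N N<a)) (≡.sym (0ₛ-at n))) ≈[]-refl)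
        (≈⇒≈[] (solve 1 (λ y → con false :* y := con false) ≈-refl y))

  -- Truncated Euler products and the product formula for the (5,1,6)-copartitions.

  e : ℕ → Series
  e k = 1ₛ ⊕ q^ k

  e-cong : ∀ {i j} → i ≡ j → e i ≈ e j
  e-cong ≡.refl = ≈-refl

  -- The truncation of the Euler product (q^r ; q^r)_∞ at its n-th factor.
  E : ℕ → ℕ → Series
  E r zero    = 1ₛ
  E r (suc n) = E r n ⊛ e (r * suc n)

  e-trivial : ∀ {N k} → N < k → e k ≈[ N ] 1ₛ
  e-trivial {N} {k} N<k = pointwise λ n n≤N → ≡.trans (⊕-at 1ₛ (q^ k) n) (≡.trans
    (cong (1ₛ n xor_) (≡.trans (≡.sym (at (≈-trans (⊛-comm (q^ k) 1ₛ) (⊛-identityˡ (q^ k))) n)) (q^-⊛-low k 1ₛ n (ℕP.≤-<-trans n≤N N<k)))) (xor-identityʳ (1ₛ n)))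

  E-stable : ∀ {N r} → 0 < r → ∀ {n n′} → N ≤ n → n ≤ n′ → E r n′ ≈[ N ] E r n
  E-stable {N} {r} r>0 {n} N≤n n≤n′ = subst (λ t → E r t ≈[ N ] E r n) (ℕP.m∸n+n≡m n≤n′) (go (_ ℕ.∸ n))
    where
    go : ∀ d → E r (d + n) ≈[ N ] E r n
    go zero    = ≈[]-refl
    go (suc d) = ≈[]-trans (⊛-cong[] (go d) (e-trivial N<)) (≈⇒≈[] (≈-trans (⊛-comm (E r n) 1ₛ) (⊛-identityˡ (E r n))))
      where
      N< : N < r * suc (d + n)
      N< = ℕP.<-≤-trans (s≤s (ℕP.≤-trans N≤n (ℕP.m≤n+m n d))) (ℕP.m≤n*m (suc (d + n)) r {{ℕ.>-nonZero r>0}})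

  -- Squaring is additive in characteristic 2.
  E-2 : ∀ n → E 2 n ≈ E 1 n ⊛ E 1 n
  E-2 zero    = ≈-sym (⊛-identityˡ 1ₛ)
  E-2 (suc n) = begin
    E 2 n ⊛ (1ₛ ⊕ q^ (2 * suc n))                       ≈⟨ ⊛-cong (E-2 n) (⊕-cong ≈-refl (≈-trans (q^-cong double) (q^-+ (1 * suc n) (1 * suc n)))) ⟩
    (E 1 n ⊛ E 1 n) ⊛ (1ₛ ⊕ q^ (1 * suc n) ⊛ q^ (1 * suc n)) ≈⟨ solve 2 (λ E x → (E :* E) :* (con true :+ x :* x) := (E :* (con true :+ x)) :* (E :* (con true :+ x))) ≈-refl (E 1 n) (q^ (1 * suc n)) ⟩
    E 1 (suc n) ⊛ E 1 (suc n)                           ∎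
    where
    open SetoidReasoning setoid
    double : 2 * suc n ≡ 1 * suc n + 1 * suc n
    double = lemma n where
      lemma : ∀ n → 2 * suc n ≡ 1 * suc n + 1 * suc n
      lemma = solve-∀

  E-constant-term : ∀ r n → 0 < r → E r n 0 ≡ true
  E-constant-term r zero    r>0 = ≡.refl
  E-constant-term r (suc n) r>0 = cong₂ _∧_ (E-constant-term r n r>0)
    (at[] (e-trivial {0} {r * suc n} (ℕP.*-mono-≤ r>0 (s≤s (z≤n {n})))) 0 z≤n)

  -- Products of factors 1 - q^d: `A J` over the d ≤ 6J prime to 6, `M J` over the other d ≤ 6J, and
  -- `B J` over the multiples of 6 up to 12J.
  A B M : ℕ → Series
  A zero    = 1ₛ
  A (suc j) = A j ⊛ (e (1 + j * 6) ⊛ e (5 + j * 6))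
  B zero    = 1ₛ
  B (suc j) = B j ⊛ (e (6 + j * 12) ⊛ e (12 + j * 12))
  M zero    = 1ₛ
  M (suc j) = M j ⊛ ((e (2 + j * 6) ⊛ e (3 + j * 6)) ⊛ (e (4 + j * 6) ⊛ e (6 + j * 6)))

  -- One step raises b by 6 and then, after `C-swap`, a by 6. The numerators of the two ratios have
  -- the exponents a + b = 6 + 12j and a + (b + 6) = 12 + 12j.
  C-telescope : ∀ N J → A J ⊛ C 6 N 5 1 ≈[ N ] B J ⊛ C 6 N (5 + J * 6) (1 + J * 6)
  C-telescope N zero    = ≈[]-refl
  C-telescope N (suc j) = begin
    (A j ⊛ (e b ⊛ e a)) ⊛ C 6 N 5 1              ≈⟨ ≈⇒≈[] (solve 4 (λ A x y c → (A :* (x :* y)) :* c := (x :* y) :* (A :* c)) ≈-refl (A j) (e b) (e a) (C 6 N 5 1)) ⟩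
    (e b ⊛ e a) ⊛ (A j ⊛ C 6 N 5 1)              ≈⟨ ⊛-congʳ[] (e b ⊛ e a) (C-telescope N j) ⟩
    (e b ⊛ e a) ⊛ (B j ⊛ C 6 N a b)              ≈⟨ ≈⇒≈[] (solve 4 (λ B x y c → (x :* y) :* (B :* c) := (B :* y) :* (x :* c)) ≈-refl (B j) (e b) (e a) (C 6 N a b)) ⟩
    (B j ⊛ e a) ⊛ (e b ⊛ C 6 N a b)              ≈⟨ ⊛-congʳ[] (B j ⊛ e a) (C-ratio 6 N (s≤s z≤n) (s≤s z≤n)) ⟩
    (B j ⊛ e a) ⊛ (e (a + b) ⊛ C 6 N a (b + 6))  ≈⟨ ≈⇒≈[] (≈-trans (⊛-cong (≈-refl {B j ⊛ e a}) (⊛-cong (≈-refl {e (a + b)}) (C-swap 6 N a (b + 6))))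
                                                      (solve 4 (λ B y z c → (B :* y) :* (z :* c) := (B :* z) :* (y :* c)) ≈-refl (B j) (e a) (e (a + b)) (C 6 N (b + 6) a))) ⟩
    (B j ⊛ e (a + b)) ⊛ (e a ⊛ C 6 N (b + 6) a)  ≈⟨ ⊛-congʳ[] (B j ⊛ e (a + b)) (C-ratio 6 N (s≤s z≤n) (s≤s z≤n)) ⟩
    (B j ⊛ e (a + b)) ⊛ (e (b + 6 + a) ⊛ C 6 N (b + 6) (a + 6)) ≈⟨ ≈⇒≈[] (⊛-cong (≈-refl {B j ⊛ e (a + b)}) (⊛-cong (≈-refl {e (b + 6 + a)}) (C-swap 6 N (b + 6) (a + 6)))) ⟩
    (B j ⊛ e (a + b)) ⊛ (e (b + 6 + a) ⊛ C 6 N (a + 6) (b + 6)) ≈⟨ ≈⇒≈[] (⊛-cong (⊛-cong (≈-refl {B j}) (e-cong (i₁ j))) (⊛-cong (e-cong (i₂ j)) (C-cong (i₃ j) (i₄ j)))) ⟩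
    (B j ⊛ e (6 + j * 12)) ⊛ (e (12 + j * 12) ⊛ c′) ≈⟨ ≈⇒≈[] (solve 4 (λ B y z c → (B :* y) :* (z :* c) := (B :* (y :* z)) :* c) ≈-refl (B j) (e (6 + j * 12)) (e (12 + j * 12)) c′) ⟩
    B (suc j) ⊛ c′ ∎
    where
    open SetoidReasoning ([]-setoid N)
    a = 5 + j * 6
    b = 1 + j * 6
    c′ = C 6 N (5 + suc j * 6) (1 + suc j * 6)
    i₁ : ∀ j → (5 + j * 6) + (1 + j * 6) ≡ 6 + j * 12
    i₁ = solve-∀
    i₂ : ∀ j → (1 + j * 6) + 6 + (5 + j * 6) ≡ 12 + j * 12
    i₂ = solve-∀
    i₃ : ∀ j → (5 + j * 6) + 6 ≡ 5 + suc j * 6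
    i₃ = solve-∀
    i₄ : ∀ j → (1 + j * 6) + 6 ≡ 1 + suc j * 6
    i₄ = solve-∀
    C-cong : ∀ {a a′ b b′} → a ≡ a′ → b ≡ b′ → C 6 N a b ≈ C 6 N a′ b′
    C-cong ≡.refl ≡.refl = ≈-refl

  A-M : ∀ J → A J ⊛ M J ≈ E 1 (J * 6)
  A-M zero    = ⊛-identityˡ 1ₛ
  A-M (suc j) = begin
    (A j ⊛ (x 1 ⊛ x 5)) ⊛ (M j ⊛ ((x 2 ⊛ x 3) ⊛ (x 4 ⊛ x 6)))
      ≈⟨ solve 8 (λ A M x₁ x₂ x₃ x₄ x₅ x₆ → (A :* (x₁ :* x₅)) :* (M :* ((x₂ :* x₃) :* (x₄ :* x₆)))
           := ((((((A :* M) :* x₁) :* x₂) :* x₃) :* x₄) :* x₅) :* x₆) ≈-refl (A j) (M j) (x 1) (x 2) (x 3) (x 4) (x 5) (x 6) ⟩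
    ((((((A j ⊛ M j) ⊛ x 1) ⊛ x 2) ⊛ x 3) ⊛ x 4) ⊛ x 5) ⊛ x 6
      ≈⟨ ⊛-cong (⊛-cong (⊛-cong (⊛-cong (⊛-cong (⊛-cong (A-M j) (i 1)) (i 2)) (i 3)) (i 4)) (i 5)) (i 6) ⟩
    E 1 (suc j * 6) ∎
    where
    open SetoidReasoning setoid
    x : ℕ → Series
    x k = e (k + j * 6)
    i : ∀ k → x k ≈ e (1 * (k + j * 6))
    i k = e-cong (≡.sym (ℕP.*-identityˡ (k + j * 6)))

  -- The numbers up to 6J not prime to 6 are the multiples of 2 and those of 3; the multiples of 6
  -- belong to both, which the factor `E 6 J` compensates.
  M-E : ∀ J → M J ⊛ E 6 J ≈ E 2 (J * 3) ⊛ E 3 (J * 2)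
  M-E zero    = ≈-refl
  M-E (suc j) = begin
    (M j ⊛ ((x 2 ⊛ x 3) ⊛ (x 4 ⊛ x 6))) ⊛ (E 6 j ⊛ e (6 * suc j))
      ≈⟨ solve 7 (λ M E a b c d f → (M :* ((a :* b) :* (c :* d))) :* (E :* f) := (((M :* E) :* (a :* c :* d)) :* (b :* f))) ≈-refl
           (M j) (E 6 j) (x 2) (x 3) (x 4) (x 6) (e (6 * suc j)) ⟩
    ((M j ⊛ E 6 j) ⊛ (x 2 ⊛ x 4 ⊛ x 6)) ⊛ (x 3 ⊛ e (6 * suc j))
      ≈⟨ ⊛-cong (⊛-cong (M-E j) (⊛-cong (⊛-cong (e-cong (i₁ j)) (e-cong (i₂ j))) (e-cong (i₃ j)))) (⊛-cong (e-cong (i₄ j)) (e-cong (i₅ j))) ⟩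
    ((E 2 (j * 3) ⊛ E 3 (j * 2)) ⊛ (e (2 * (1 + j * 3)) ⊛ e (2 * (2 + j * 3)) ⊛ e (2 * (3 + j * 3)))) ⊛ (e (3 * (1 + j * 2)) ⊛ e (3 * (2 + j * 2)))
      ≈⟨ solve 7 (λ E F a b c d f → ((E :* F) :* (a :* b :* c)) :* (d :* f) := (((E :* a) :* b) :* c) :* ((F :* d) :* f)) ≈-refl
           (E 2 (j * 3)) (E 3 (j * 2)) (e (2 * (1 + j * 3))) (e (2 * (2 + j * 3))) (e (2 * (3 + j * 3))) (e (3 * (1 + j * 2))) (e (3 * (2 + j * 2))) ⟩
    E 2 (suc j * 3) ⊛ E 3 (suc j * 2) ∎
    where
    open SetoidReasoning setoid
    x : ℕ → Series
    x k = e (k + j * 6)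
    i₁ : ∀ j → 2 + j * 6 ≡ 2 * (1 + j * 3)
    i₁ = solve-∀
    i₂ : ∀ j → 4 + j * 6 ≡ 2 * (2 + j * 3)
    i₂ = solve-∀
    i₃ : ∀ j → 6 + j * 6 ≡ 2 * (3 + j * 3)
    i₃ = solve-∀
    i₄ : ∀ j → 3 + j * 6 ≡ 3 * (1 + j * 2)
    i₄ = solve-∀
    i₅ : ∀ j → 6 * suc j ≡ 3 * (2 + j * 2)
    i₅ = solve-∀

  B-E : ∀ J → B J ≈ E 6 (J * 2)
  B-E zero    = ≈-refl
  B-E (suc j) = ≈-trans (⊛-cong (B-E j) (⊛-cong (e-cong (i₁ j)) (e-cong (i₂ j))))
    (solve 3 (λ E x y → E :* (x :* y) := (E :* x) :* y) ≈-refl (E 6 (j * 2)) (e (6 * (1 + j * 2))) (e (6 * (2 + j * 2))))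
    where
    i₁ : ∀ j → 6 + j * 12 ≡ 6 * (1 + j * 2)
    i₁ = solve-∀
    i₂ : ∀ j → 12 + j * 12 ≡ 6 * (2 + j * 2)
    i₂ = solve-∀

  -- Up to order N, A M = f_1, M f_6 = f_2 f_3 and A C = f_6. Hence f_1 f_6 C = (M f_6)(A C) = f_2
  -- f_3 f_6 = (f_1 f_6)(f_1 f_3), and the factor f_1 f_6 has constant term 1.
  C-product : ∀ N → C 6 N 5 1 ≈[ N ] E 1 N ⊛ E 3 N
  C-product N = ⊛-cancelˡ[] (E 1 N ⊛ E 6 N) (cong₂ _∧_ (E-constant-term 1 N (s≤s z≤n)) (E-constant-term 6 N (s≤s z≤n))) (begin
    (E 1 N ⊛ E 6 N) ⊛ c
      ≈⟨ ⊛-cong[] (⊛-cong[] (≈[]-sym (E-stable (s≤s z≤n) ℕP.≤-refl (ℕP.m≤m*n N 6))) ≈[]-refl) ≈[]-refl ⟩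
    (E 1 (N * 6) ⊛ E 6 N) ⊛ c
      ≈⟨ ≈⇒≈[] (⊛-cong (⊛-cong (≈-sym (A-M N)) ≈-refl) ≈-refl) ⟩
    ((A N ⊛ M N) ⊛ E 6 N) ⊛ c
      ≈⟨ ≈⇒≈[] (solve 4 (λ A M E c → ((A :* M) :* E) :* c := (M :* E) :* (A :* c)) ≈-refl (A N) (M N) (E 6 N) c) ⟩
    (M N ⊛ E 6 N) ⊛ (A N ⊛ c)
      ≈⟨ ⊛-cong[] (≈⇒≈[] (≈-trans (M-E N) (⊛-cong (E-2 (N * 3)) ≈-refl))) (≈[]-trans (C-telescope N N)
           (⊛-cong[] (≈⇒≈[] (B-E N)) (C-unit 6 N (s≤s (ℕP.≤-trans (ℕP.m≤m*n N 6) (ℕP.m≤n+m (N * 6) 4))) (s≤s (ℕP.m≤m*n N 6))))) ⟩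
    ((E 1 (N * 3) ⊛ E 1 (N * 3)) ⊛ E 3 (N * 2)) ⊛ (E 6 (N * 2) ⊛ 1ₛ)
      ≈⟨ ⊛-cong[] (⊛-cong[] (⊛-cong[] E₁ E₁) (E-stable (s≤s z≤n) ℕP.≤-refl (ℕP.m≤m*n N 2)))
                  (⊛-cong[] {g = 1ₛ} (E-stable (s≤s z≤n) ℕP.≤-refl (ℕP.m≤m*n N 2)) ≈[]-refl) ⟩
    ((E 1 N ⊛ E 1 N) ⊛ E 3 N) ⊛ (E 6 N ⊛ 1ₛ)
      ≈⟨ ≈⇒≈[] (solve 3 (λ a b c → ((a :* a) :* b) :* (c :* con true) := (a :* c) :* (a :* b)) ≈-refl (E 1 N) (E 3 N) (E 6 N)) ⟩
    (E 1 N ⊛ E 6 N) ⊛ (E 1 N ⊛ E 3 N) ∎)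
    where
    open SetoidReasoning ([]-setoid N)
    c = C 6 N 5 1
    E₁ : E 1 (N * 3) ≈[ N ] E 1 N
    E₁ = E-stable (s≤s z≤n) ℕP.≤-refl (ℕP.m≤m*n N 3)

-- The parity of `cp`, as enumerated, is a coefficient of the generating function.

module CopartitionParity where

  open import Defs
  open PowerSeries
  open PartitionSeries
  open CopartitionSeries
  open import Algebra.Solver.Ring.AlmostCommutativeRing using (fromCommutativeRing)
  open import Data.Nat as ℕ using (ℕ; zero; suc; _≤_; _<_; z≤n; s≤s; NonZero; _+_; _*_; _∸_; _⊓_; _≡ᵇ_)
  open import Data.Nat.ListAction using (sum)
  open import Data.Bool using (Bool; true; false; _∧_; _xor_; not)
  open import Data.Bool.Properties as BP using (xor-identityʳ; T-≡)
  open import Data.List using (List; []; _∷_; _++_; map; concatMap; upTo; length; replicate)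
  open import Data.List.Properties using (upTo-∷ʳ; length-replicate)
  open import Data.List.Relation.Unary.All as All using (All; []; _∷_)
  import Data.List.Relation.Unary.All.Properties as AllP
  import Data.Nat.Properties as ℕP
  open import Data.Nat.Tactic.RingSolver using (solve-∀)
  open import Data.Product using (_×_; _,_; proj₁; proj₂)
  open import Data.Empty using (⊥-elim)
  open import Function using (_∘_)
  open import Function.Bundles using (Equivalence)
  open import Relation.Nullary using (yes; no; ¬_)
  open import Relation.Binary.PropositionalEquality as ≡ using (_≡_; refl; sym; trans; cong; cong₂; module ≡-Reasoning)
  import Relation.Binary.Reasoning.Setoid as SetoidReasoning
  import Algebra.Solver.Ring.Simple (fromCommutativeRing 𝔽₂) BP._≟_ as 𝔽₂-Solver

  open 𝔽₂-Solver using () renaming (solve to solve₂; _:=_ to _:=₂_; _:+_ to _:+₂_; _:*_ to _:*₂_)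

  odd : ℕ → Bool
  odd zero    = false
  odd (suc n) = not (odd n)

  ⨁ : {X : Set} → (X → Bool) → List X → Bool
  ⨁ p []       = false
  ⨁ p (x ∷ xs) = p x xor ⨁ p xs

  odd-count : {X : Set} (p : X → Bool) (xs : List X) → odd (count p xs) ≡ ⨁ p xs
  odd-count p [] = refl
  odd-count p (x ∷ xs) with p x
  ... | true  = cong not (odd-count p xs)
  ... | false = odd-count p xs

  module _ {X : Set} where

    ⨁-++ : (p : X → Bool) (xs ys : List X) → ⨁ p (xs ++ ys) ≡ ⨁ p xs xor ⨁ p ys
    ⨁-++ p []       ys = refl
    ⨁-++ p (x ∷ xs) ys = trans (cong (p x xor_) (⨁-++ p xs ys)) (sym (BP.xor-assoc (p x) _ _))

    ⨁-map : {Y : Set} (p : X → Bool) (f : Y → X) (ys : List Y) → ⨁ p (map f ys) ≡ ⨁ (p ∘ f) ys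
    ⨁-map p f []       = refl
    ⨁-map p f (y ∷ ys) = cong (p (f y) xor_) (⨁-map p f ys)

    ⨁-concatMap : {Y : Set} (p : X → Bool) (f : Y → List X) (ys : List Y) →
      ⨁ p (concatMap f ys) ≡ ⨁ (λ y → ⨁ p (f y)) ys
    ⨁-concatMap p f []       = refl
    ⨁-concatMap p f (y ∷ ys) = trans (⨁-++ p (f y) (concatMap f ys)) (cong (⨁ p (f y) xor_) (⨁-concatMap p f ys))

    ⨁-congAll : {p q : X → Bool} {xs : List X} → All (λ x → p x ≡ q x) xs → ⨁ p xs ≡ ⨁ q xs
    ⨁-congAll []       = refl
    ⨁-congAll (h ∷ hs) = cong₂ _xor_ h (⨁-congAll hs)

    ⨁-cong : {p q : X → Bool} → (∀ x → p x ≡ q x) → ∀ xs → ⨁ p xs ≡ ⨁ q xs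
    ⨁-cong h []       = refl
    ⨁-cong h (x ∷ xs) = cong₂ _xor_ (h x) (⨁-cong h xs)

    ⨁-∧ʳ : (p : X → Bool) (c : Bool) (xs : List X) → ⨁ (λ x → p x ∧ c) xs ≡ ⨁ p xs ∧ c
    ⨁-∧ʳ p c []       = refl
    ⨁-∧ʳ p c (x ∷ xs) = trans (cong (p x ∧ c xor_) (⨁-∧ʳ p c xs)) (sym (BP.∧-distribʳ-xor c (p x) _))

    ⨁-∧ˡ : (p : X → Bool) (c : Bool) (xs : List X) → ⨁ (λ x → c ∧ p x) xs ≡ c ∧ ⨁ p xs
    ⨁-∧ˡ p c xs = trans (⨁-cong (λ x → BP.∧-comm c (p x)) xs) (trans (⨁-∧ʳ p c xs) (BP.∧-comm _ c))

    ⨁-false : {p : X → Bool} → (∀ x → p x ≡ false) → ∀ xs → ⨁ p xs ≡ false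
    ⨁-false h []       = refl
    ⨁-false h (x ∷ xs) = cong₂ _xor_ (h x) (⨁-false h xs)

    ⨁-xor : (p q : X → Bool) (xs : List X) → ⨁ (λ x → p x xor q x) xs ≡ ⨁ p xs xor ⨁ q xs
    ⨁-xor p q []       = refl
    ⨁-xor p q (x ∷ xs) = trans (cong ((p x xor q x) xor_) (⨁-xor p q xs))
      (solve₂ 4 (λ a b c d → (a :+₂ b) :+₂ (c :+₂ d) :=₂ (a :+₂ c) :+₂ (b :+₂ d)) refl (p x) (q x) _ _)

  ⨁-swap : {X Y : Set} (f : X → Y → Bool) (xs : List X) (ys : List Y) →
    ⨁ (λ x → ⨁ (f x) ys) xs ≡ ⨁ (λ y → ⨁ (λ x → f x y) xs) ys
  ⨁-swap f []       ys = sym (⨁-false (λ _ → refl) ys)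
  ⨁-swap f (x ∷ xs) ys = trans (cong (⨁ (f x) ys xor_) (⨁-swap f xs ys)) (sym (⨁-xor (f x) (λ y → ⨁ (λ x → f x y) xs) ys))

  ⨁-upTo-suc : (p : ℕ → Bool) (n : ℕ) → ⨁ p (upTo (suc n)) ≡ ⨁ p (upTo n) xor p n
  ⨁-upTo-suc p n = trans (cong (⨁ p) (sym (upTo-∷ʳ n))) (trans (⨁-++ p (upTo n) (n ∷ [])) (cong (⨁ p (upTo n) xor_) (xor-identityʳ (p n))))

  ≡ᵇ-refl : ∀ n → (n ≡ᵇ n) ≡ true
  ≡ᵇ-refl n = Equivalence.to T-≡ (ℕP.≡⇒≡ᵇ n n refl)

  ≡ᵇ-≢ : ∀ {m n} → ¬ (m ≡ n) → (m ≡ᵇ n) ≡ false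
  ≡ᵇ-≢ {m} {n} h with m ≡ᵇ n in e
  ... | false = refl
  ... | true  = ⊥-elim (h (ℕP.≡ᵇ⇒≡ m n (Equivalence.from T-≡ e)))

  ≡ᵇ-sym : ∀ m n → (m ≡ᵇ n) ≡ (n ≡ᵇ m)
  ≡ᵇ-sym zero    zero    = refl
  ≡ᵇ-sym zero    (suc n) = refl
  ≡ᵇ-sym (suc m) zero    = refl
  ≡ᵇ-sym (suc m) (suc n) = ≡ᵇ-sym m n

  ⨁-point : (g : ℕ → Bool) {x N : ℕ} → x < N → ⨁ (λ k → (x ≡ᵇ k) ∧ g k) (upTo N) ≡ g x
  ⨁-point g {x} {suc N} (s≤s x≤N) = trans (⨁-upTo-suc (λ k → (x ≡ᵇ k) ∧ g k) N) (split (x ℕ.≟ N))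
    where
    none : ∀ M → M ≤ x → ⨁ (λ k → (x ≡ᵇ k) ∧ g k) (upTo M) ≡ false
    none zero    _ = refl
    none (suc M) l = trans (⨁-upTo-suc (λ k → (x ≡ᵇ k) ∧ g k) M)
      (cong₂ (λ u v → u xor (v ∧ g M)) (none M (ℕP.<⇒≤ l)) (≡ᵇ-≢ (ℕP.<⇒≢ l ∘ sym)))
    split : _ → ⨁ (λ k → (x ≡ᵇ k) ∧ g k) (upTo N) xor ((x ≡ᵇ N) ∧ g N) ≡ g x
    split (yes refl) = cong₂ (λ u v → u xor (v ∧ g N)) (none N ℕP.≤-refl) (≡ᵇ-refl x)
    split (no x≢N)   = trans (cong₂ (λ u v → u xor (v ∧ g N)) (⨁-point g {x} {N} (ℕP.≤∧≢⇒< x≤N x≢N)) (≡ᵇ-≢ x≢N)) (xor-identityʳ (g x))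

  q^-≡ᵇ : ∀ k n → (q^ k) n ≡ (k ≡ᵇ n)
  q^-≡ᵇ zero    zero    = refl
  q^-≡ᵇ zero    (suc n) = refl
  q^-≡ᵇ (suc k) zero    = refl
  q^-≡ᵇ (suc k) (suc n) = q^-≡ᵇ k n

  Σₛ-at : ∀ f n i → Σₛ f n i ≡ ⨁ (λ k → f k i) (upTo n)
  Σₛ-at f zero    i = 0ₛ-at i
  Σₛ-at f (suc n) i = trans (⊕-at (Σₛ f n) (f n) i) (trans (cong (_xor f n i) (Σₛ-at f n i)) (sym (⨁-upTo-suc (λ k → f k i) n)))

  expansion : ∀ f n → f ≈[ n ] Σₛ (λ i → const (f i) ⊛ q^ i) (suc n)
  expansion f n = pointwise λ t t≤n → sym (trans (Σₛ-at (λ i → const (f i) ⊛ q^ i) (suc n) t)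
    (trans (⨁-cong (λ i → trans (const-⊛ (f i) (q^ i) t) (trans (BP.∧-comm (f i) _) (cong (_∧ f i) (trans (q^-≡ᵇ i t) (≡ᵇ-sym i t))))) (upTo (suc n)))
      (⨁-point f (s≤s t≤n))))

  -- The coefficient is written in the shape of the enumeration in `candidates`: all sizes i, j ≤ n,
  -- with a test on the total. Expanding f and g into monomials up to order n gives it.
  product-at : ∀ f g w n →
    (f ⊛ (g ⊛ q^ w)) n ≡ ⨁ (λ i → ⨁ (λ j → (f i ∧ g j) ∧ (i + j + w ≡ᵇ n)) (upTo (suc n))) (upTo (suc n))
  product-at f g w n = trans (at[] product n ℕP.≤-refl)
    (trans (Σₛ-at (λ i → Σₛ (term i) (suc n)) (suc n) n)
      (⨁-cong (λ i → trans (Σₛ-at (term i) (suc n) n) (⨁-cong (λ j → term-at i j) (upTo (suc n)))) (upTo (suc n))))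
    where
    term : ℕ → ℕ → Series
    term i j = const (f i) ⊛ (const (g j) ⊛ q^ (i + j + w))
    term-at : ∀ i j → term i j n ≡ (f i ∧ g j) ∧ (i + j + w ≡ᵇ n)
    term-at i j = trans (const-⊛ (f i) _ n) (trans (cong (f i ∧_) (const-⊛ (g j) _ n))
      (trans (sym (BP.∧-assoc (f i) (g j) _)) (cong ((f i ∧ g j) ∧_) (q^-≡ᵇ (i + j + w) n))))
    open SetoidReasoning ([]-setoid n)
    product : f ⊛ (g ⊛ q^ w) ≈[ n ] Σₛ (λ i → Σₛ (term i) (suc n)) (suc n)
    product = begin
      f ⊛ (g ⊛ q^ w)
        ≈⟨ ⊛-cong[] (expansion f n) (⊛-cong[] (expansion g n) ≈[]-refl) ⟩
      Σₛ F (suc n) ⊛ (Σₛ G (suc n) ⊛ q^ w)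
        ≈⟨ ≈⇒≈[] (≈-trans (⊛-comm (Σₛ F (suc n)) _) (Σₛ-⊛ (Σₛ G (suc n) ⊛ q^ w) F (suc n))) ⟩
      Σₛ (λ i → (Σₛ G (suc n) ⊛ q^ w) ⊛ F i) (suc n)
        ≈⟨ ≈⇒≈[] (Σₛ-cong (suc n) λ i → ≈-trans (solve 3 (λ a b c → (a :* b) :* c := (b :* c) :* a) ≈-refl (Σₛ G (suc n)) (q^ w) (F i))
             (≈-trans (Σₛ-⊛ (q^ w ⊛ F i) G (suc n)) (Σₛ-cong (suc n) (λ j → ≈-trans
               (solve 5 (λ w a x b y → (w :* (a :* x)) :* (b :* y) := a :* (b :* ((x :* y) :* w))) ≈-refl (q^ w) (const (f i)) (q^ i) (const (g j)) (q^ j))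
               (⊛-cong (≈-refl {const (f i)}) (⊛-cong (≈-refl {const (g j)}) (≈-sym (≈-trans (q^-+ (i + j) w) (⊛-cong (q^-+ i j) ≈-refl))))))))) ⟩
      Σₛ (λ i → Σₛ (term i) (suc n)) (suc n) ∎
      where
      F G : ℕ → Series
      F i = const (f i) ⊛ q^ i
      G j = const (g j) ⊛ q^ j

  -- The bound on the length ensures that k, l ≤ n exhausts the possible numbers of parts of γ and
  -- σ.
  partsLE-bounds : ∀ f n K → All (λ γ → sum γ ≡ n × length γ ≤ n) (partsLE f n K)
  partsLE-bounds zero    zero    K = (refl , z≤n) ∷ []
  partsLE-bounds (suc f) zero    K = (refl , z≤n) ∷ []
  partsLE-bounds zero    (suc n) K = []
  partsLE-bounds (suc f) (suc n) K = AllP.concat⁺ (AllP.map⁺ (All.map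
    (λ {i} i< → AllP.map⁺ (All.map (λ {γ} → extend {i} {γ} (ℕP.≤-pred (ℕP.≤-trans i< (ℕP.m⊓n≤m (suc n) K)))) (partsLE-bounds f (n ∸ i) (suc i))))
    (AllP.all-upTo (suc n ⊓ K))))
    where
    extend : ∀ {i γ} → i ≤ n → sum γ ≡ n ∸ i × length γ ≤ n ∸ i → suc i + sum γ ≡ suc n × suc (length γ) ≤ suc n
    extend {i} i≤n (s , l) = cong suc (trans (cong (i +_) s) (ℕP.m+[n∸m]≡n i≤n)) , s≤s (ℕP.≤-trans l (ℕP.m∸n≤m n i))

  module _ (m : ℕ) .{{_ : NonZero m}} where

    ofLength : ℕ → ℕ → List ℕ → Bool
    ofLength a k γ = allᵇ (admissible m a) γ ∧ (length γ ≡ᵇ k)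

    -- `Z` decides for one value after another, downwards from K, whether it is used as the largest
    -- part. Unrolled, this is the choice of the largest part in `partsLE`; values above the size
    -- drop out, whence the minimum.
    Z-largest-part : ∀ a K k n → Z m a K (suc k) (suc n) ≡
      ⨁ (λ i → admissible m a (suc i) ∧ Z m a (suc i) k (n ∸ i)) (upTo (suc n ⊓ K))
    Z-largest-part a zero    k n = refl
    Z-largest-part a (suc K) k n with K ℕ.≤? n
    ... | yes K≤n rewrite ℕP.m≥n⇒m⊓n≡n K≤n = trans
      (cong₂ _xor_ (trans (Z-largest-part a K k n) (cong (λ t → ⨁ h (upTo t)) (ℕP.m≥n⇒m⊓n≡n (ℕP.m≤n⇒m≤1+n K≤n))))
        (trans (const-⊛ (admissible m a (suc K)) _ (suc n)) (cong (admissible m a (suc K) ∧_) coefficient)))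
      (sym (⨁-upTo-suc h K))
      where
      h : ℕ → Bool
      h i = admissible m a (suc i) ∧ Z m a (suc i) k (n ∸ i)
      coefficient : (q^ K ⊛ Z m a (suc K) k) n ≡ Z m a (suc K) k (n ∸ K)
      coefficient = trans (cong (q^ K ⊛ Z m a (suc K) k) (sym (ℕP.m+[n∸m]≡n K≤n))) (q^-⊛-+ K (Z m a (suc K) k) (n ∸ K))
    ... | no  K≰n rewrite ℕP.m≤n⇒m⊓n≡m (ℕP.<⇒≤ (ℕP.≰⇒> K≰n)) = trans
      (cong₂ _xor_ (trans (Z-largest-part a K k n) (cong (λ t → ⨁ h (upTo t)) (ℕP.m≤n⇒m⊓n≡m (ℕP.≰⇒> K≰n))))
        (trans (const-⊛ (admissible m a (suc K)) _ (suc n))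
          (trans (cong (admissible m a (suc K) ∧_) (q^-⊛-low K (Z m a (suc K) k) n (ℕP.≰⇒> K≰n))) (BP.∧-zeroʳ _))))
      (xor-identityʳ _)
      where
      h : ℕ → Bool
      h i = admissible m a (suc i) ∧ Z m a (suc i) k (n ∸ i)

    partsLE-Z : ∀ f n a K k → n ≤ f → ⨁ (ofLength a k) (partsLE f n K) ≡ Z m a K k n
    partsLE-Z zero    zero    a K zero    _ = refl
    partsLE-Z (suc f) zero    a K zero    _ = refl
    partsLE-Z zero    zero    a K (suc k) _ = sym (Z-low m a K (suc k) 0 (s≤s z≤n))
    partsLE-Z (suc f) zero    a K (suc k) _ = sym (Z-low m a K (suc k) 0 (s≤s z≤n))
    partsLE-Z (suc f) (suc n) a K k (s≤s n≤f) = trans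
      (⨁-concatMap (ofLength a k) _ (upTo (suc n ⊓ K)))
      (trans (⨁-cong (λ i → ⨁-map (ofLength a k) (suc i ∷_) (partsLE f (n ∸ i) (suc i))) (upTo (suc n ⊓ K))) (first-part k))
      where
      first-part : ∀ k → ⨁ (λ i → ⨁ (λ γ → ofLength a k (suc i ∷ γ)) (partsLE f (n ∸ i) (suc i))) (upTo (suc n ⊓ K)) ≡ Z m a K k (suc n)
      first-part zero    = ⨁-false (λ i → ⨁-false (λ γ → BP.∧-zeroʳ _) (partsLE f (n ∸ i) (suc i))) (upTo (suc n ⊓ K))
      first-part (suc k) = trans
        (⨁-cong (λ i → trans (⨁-cong (λ γ → BP.∧-assoc (admissible m a (suc i)) _ _) (partsLE f (n ∸ i) (suc i)))
          (trans (⨁-∧ˡ (ofLength a k) (admissible m a (suc i)) (partsLE f (n ∸ i) (suc i)))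
            (cong (admissible m a (suc i) ∧_) (partsLE-Z f (n ∸ i) a (suc i) k (ℕP.≤-trans (ℕP.m∸n≤m n i) n≤f)))))
          (upTo (suc n ⊓ K)))
        (sym (Z-largest-part a K k n))

    copartition : List ℕ → List ℕ → Triple
    copartition γ σ = triple γ (replicate (length σ) (m * length γ)) σ

    candidates-γ : ℕ → List ℕ → List Triple
    candidates-γ j γ = map (copartition γ) (partitions j)

    candidates-sizes : ℕ → ℕ → List Triple
    candidates-sizes i j = concatMap (candidates-γ j) (partitions i)

    candidates-size : ℕ → ℕ → List Triple
    candidates-size n i = concatMap (candidates-sizes i) (upTo (suc n))

    slice : ℕ → ℕ → ℕ → ℕ → ℕ → Triple → Bool
    slice a b n k l (triple γ ρ σ) = (ofLength a k γ ∧ ofLength b l σ) ∧ (sum γ + sum σ + m * k * l ≡ᵇ n)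

    -- Exactly one pair (k, l), the actual numbers of parts, can satisfy `slice`, so the double sum
    -- picks out its value there. The conditions on ρ hold by construction of the candidates.
    isCopartition-slices : ∀ a b n γ σ → length γ ≤ n → length σ ≤ n →
      let t = copartition γ σ in
      isCopartition a b m t ∧ (sizeOf t ≡ᵇ n) ≡ ⨁ (λ k → ⨁ (λ l → slice a b n k l t) (upTo (suc n))) (upTo (suc n))
    isCopartition-slices a b n γ σ γ≤n σ≤n = sym (begin
      ⨁ (λ k → ⨁ (λ l → slice a b n k l (copartition γ σ)) (upTo (suc n))) (upTo (suc n))
        ≡⟨ ⨁-cong (λ k → trans (⨁-cong (λ l → solve₂ 5 (λ p q r s t → ((p :*₂ q) :*₂ (r :*₂ s)) :*₂ t :=₂ q :*₂ (s :*₂ ((p :*₂ r) :*₂ t))) refl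
             okγ (length γ ≡ᵇ k) okσ (length σ ≡ᵇ l) (size k l)) (upTo (suc n))) (⨁-∧ˡ _ (length γ ≡ᵇ k) (upTo (suc n)))) (upTo (suc n)) ⟩
      ⨁ (λ k → (length γ ≡ᵇ k) ∧ ⨁ (λ l → (length σ ≡ᵇ l) ∧ ((okγ ∧ okσ) ∧ size k l)) (upTo (suc n))) (upTo (suc n))
        ≡⟨ ⨁-point _ (s≤s γ≤n) ⟩
      ⨁ (λ l → (length σ ≡ᵇ l) ∧ ((okγ ∧ okσ) ∧ size (length γ) l)) (upTo (suc n))
        ≡⟨ ⨁-point _ (s≤s σ≤n) ⟩
      (okγ ∧ okσ) ∧ size (length γ) (length σ)
        ≡⟨ cong₂ _∧_ okρ (cong (_≡ᵇ n) total) ⟩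
      isCopartition a b m (copartition γ σ) ∧ (sizeOf (triple γ ρ σ) ≡ᵇ n) ∎)
      where
      open ≡-Reasoning
      ρ = replicate (length σ) (m * length γ)
      okγ = allᵇ (admissible m a) γ
      okσ = allᵇ (admissible m b) σ
      size : ℕ → ℕ → Bool
      size k l = sum γ + sum σ + m * k * l ≡ᵇ n
      sum-replicate : ∀ c x → sum (replicate c x) ≡ c * x
      sum-replicate zero    x = refl
      sum-replicate (suc c) x = cong (x +_) (sum-replicate c x)
      all-replicate : ∀ c x → allᵇ (_≡ᵇ x) (replicate c x) ≡ true
      all-replicate zero    x = refl
      all-replicate (suc c) x = cong₂ _∧_ (≡ᵇ-refl x) (all-replicate c x)
      rearrange : ∀ s t m g l → s + t + m * g * l ≡ s + l * (m * g) + t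
      rearrange = solve-∀
      total : sum γ + sum σ + m * length γ * length σ ≡ sizeOf (triple γ ρ σ)
      total = trans (rearrange (sum γ) (sum σ) m (length γ) (length σ)) (cong (λ t → sum γ + t + sum σ) (sym (sum-replicate (length σ) (m * length γ))))
      okρ : okγ ∧ okσ ≡ isCopartition a b m (triple γ ρ σ)
      okρ = cong (okγ ∧_) (trans (sym (BP.∧-identityʳ okσ))
        (cong (okσ ∧_) (sym (cong₂ _∧_ (trans (cong (_≡ᵇ length σ) (length-replicate (length σ))) (≡ᵇ-refl (length σ))) (all-replicate (length σ) (m * length γ))))))

    slice-sum : ∀ a b n k l → ⨁ (slice a b n k l) (candidates m n) ≡ (P m a k ⊛ (P m b l ⊛ q^ (m * k * l))) n
    slice-sum a b n k l = trans
      (trans (⨁-concatMap F (candidates-size n) (upTo (suc n))) (⨁-cong (λ i →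
        trans (⨁-concatMap F (candidates-sizes i) (upTo (suc n))) (⨁-cong (λ j →
          trans (⨁-concatMap F (candidates-γ j) (partitions i)) (trans (⨁-cong (λ γ →
            ⨁-map F (copartition γ) (partitions j)) (partitions i)) (pairs i j)))
          (upTo (suc n)))) (upTo (suc n))))
      (sym (product-at (P m a k) (P m b l) (m * k * l) n))
      where
      F = slice a b n k l
      pairs : ∀ i j → ⨁ (λ γ → ⨁ (λ σ → (ofLength a k γ ∧ ofLength b l σ) ∧ (sum γ + sum σ + m * k * l ≡ᵇ n)) (partitions j)) (partitions i)
        ≡ (P m a k i ∧ P m b l j) ∧ (i + j + m * k * l ≡ᵇ n)
      pairs i j = begin
        ⨁ (λ γ → ⨁ (λ σ → (ofLength a k γ ∧ ofLength b l σ) ∧ (sum γ + sum σ + m * k * l ≡ᵇ n)) (partitions j)) (partitions i)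
          ≡⟨ ⨁-congAll (All.map (λ {γ} γi → ⨁-congAll (All.map (λ {σ} σj →
               cong (λ s → (ofLength a k γ ∧ ofLength b l σ) ∧ (s + m * k * l ≡ᵇ n)) (cong₂ _+_ (proj₁ γi) (proj₁ σj)))
               (partsLE-bounds j j j))) (partsLE-bounds i i i)) ⟩
        ⨁ (λ γ → ⨁ (λ σ → (ofLength a k γ ∧ ofLength b l σ) ∧ size) (partitions j)) (partitions i)
          ≡⟨ ⨁-cong (λ γ → trans (⨁-∧ʳ (λ σ → ofLength a k γ ∧ ofLength b l σ) size (partitions j))
               (cong (_∧ size) (⨁-∧ˡ (ofLength b l) (ofLength a k γ) (partitions j)))) (partitions i) ⟩
        ⨁ (λ γ → (ofLength a k γ ∧ ⨁ (ofLength b l) (partitions j)) ∧ size) (partitions i)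
          ≡⟨ trans (⨁-∧ʳ (λ γ → ofLength a k γ ∧ ⨁ (ofLength b l) (partitions j)) size (partitions i))
               (cong (_∧ size) (⨁-∧ʳ (ofLength a k) (⨁ (ofLength b l) (partitions j)) (partitions i))) ⟩
        (⨁ (ofLength a k) (partitions i) ∧ ⨁ (ofLength b l) (partitions j)) ∧ size
          ≡⟨ cong₂ (λ u v → (u ∧ v) ∧ size) (partsLE-Z i i a i k ℕP.≤-refl) (partsLE-Z j j b j l ℕP.≤-refl) ⟩
        (P m a k i ∧ P m b l j) ∧ size ∎
        where
        open ≡-Reasoning
        size = i + j + m * k * l ≡ᵇ n

    odd-cp : ∀ a b n → odd (cp a b m n) ≡ C m n a b n
    odd-cp a b n = begin
      odd (cp a b m n)
        ≡⟨ odd-count (λ t → isCopartition a b m t ∧ (sizeOf t ≡ᵇ n)) (candidates m n) ⟩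
      ⨁ (λ t → isCopartition a b m t ∧ (sizeOf t ≡ᵇ n)) (candidates m n)
        ≡⟨ ⨁-congAll slices ⟩
      ⨁ (λ t → ⨁ (λ k → ⨁ (λ l → slice a b n k l t) (upTo (suc n))) (upTo (suc n))) (candidates m n)
        ≡⟨ ⨁-swap (λ t k → ⨁ (λ l → slice a b n k l t) (upTo (suc n))) (candidates m n) (upTo (suc n)) ⟩
      ⨁ (λ k → ⨁ (λ t → ⨁ (λ l → slice a b n k l t) (upTo (suc n))) (candidates m n)) (upTo (suc n))
        ≡⟨ ⨁-cong (λ k → trans (⨁-swap (λ t l → slice a b n k l t) (candidates m n) (upTo (suc n)))
             (⨁-cong (λ l → slice-sum a b n k l) (upTo (suc n)))) (upTo (suc n)) ⟩
      ⨁ (λ k → ⨁ (λ l → (P m a k ⊛ (P m b l ⊛ q^ (m * k * l))) n) (upTo (suc n))) (upTo (suc n))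
        ≡⟨ ⨁-cong (λ k → sym (trans (at (Σₛ-⊛ (P m a k) (λ l → P m b l ⊛ q^ (m * k * l)) (suc n)) n) (Σₛ-at _ (suc n) n))) (upTo (suc n)) ⟩
      ⨁ (λ k → (P m a k ⊛ Cσ m b k (suc n)) n) (upTo (suc n))
        ≡⟨ Σₛ-at (λ k → P m a k ⊛ Cσ m b k (suc n)) (suc n) n ⟨
      C m n a b n ∎
      where
      open ≡-Reasoning
      slices : All (λ t → isCopartition a b m t ∧ (sizeOf t ≡ᵇ n) ≡ ⨁ (λ k → ⨁ (λ l → slice a b n k l t) (upTo (suc n))) (upTo (suc n))) (candidates m n)
      slices = AllP.concat⁺ (AllP.map⁺ {f = candidates-size n} (All.map (λ {i} i<1+n →
        AllP.concat⁺ (AllP.map⁺ {f = candidates-sizes i} (All.map (λ {j} j<1+n →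
          AllP.concat⁺ (AllP.map⁺ {f = candidates-γ j} (All.map (λ {γ} γi →
            AllP.map⁺ {f = copartition γ} (All.map (λ {σ} σj →
              isCopartition-slices a b n γ σ (ℕP.≤-trans (proj₂ γi) (ℕP.≤-pred i<1+n)) (ℕP.≤-trans (proj₂ σj) (ℕP.≤-pred j<1+n)))
              (partsLE-bounds j j j)))
            (partsLE-bounds i i i))))
          (AllP.all-upTo (suc n)))))
        (AllP.all-upTo (suc n))))

-- Shanks' finite form of the pentagonal number theorem, and the representation by x² + 3y².

module PentagonalNumbers where

  open import Defs using (cp)
  open PowerSeries
  open PartitionSeries
  open CopartitionSeries
  open CopartitionParity
  open import Data.Nat as ℕ using (ℕ; zero; suc; _≤_; _<_; z≤n; s≤s; _+_; _*_)
  open import Data.Bool using (true; false)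
  import Data.Nat.Properties as ℕP
  open import Data.Nat.Tactic.RingSolver using (solve-∀)
  open import Data.Product using (_×_; _,_; ∃-syntax)
  open import Data.Sum using (_⊎_; inj₁; inj₂)
  open import Relation.Binary.PropositionalEquality as ≡ using (_≡_; refl; sym; trans; cong; cong₂; subst; module ≡-Reasoning)
  import Relation.Binary.Reasoning.Setoid as SetoidReasoning

  triangle : ℕ → ℕ
  triangle zero    = 0
  triangle (suc s) = suc s + triangle s

  triangle-double : ∀ s → 2 * triangle s ≡ s * suc s
  triangle-double zero    = refl
  triangle-double (suc s) = trans (ℕP.*-distribˡ-+ 2 (suc s) (triangle s)) (trans (cong (2 * suc s +_) (triangle-double s)) (lemma s))
    where
    lemma : ∀ s → 2 * suc s + s * suc s ≡ suc s * suc (suc s)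
    lemma = solve-∀

  module _ (r : ℕ) where

    -- With x = q^r, the quotient (x;x)_(s+d) / (x;x)_s, written as a product of d factors.
    D : ℕ → ℕ → Series
    D zero    s = 1ₛ
    D (suc d) s = D d s ⊛ e (r * (s + suc d))

    D-suc : ∀ d s → D (suc d) s ≈ e (r * suc s) ⊛ D d (suc s)
    D-suc zero    s = ≈-trans (⊛-comm 1ₛ (e (r * (s + 1)))) (⊛-cong (e-cong (cong (r *_) (ℕP.+-comm s 1))) ≈-refl)
    D-suc (suc d) s = begin
      D (suc d) s ⊛ e (r * (s + suc (suc d)))                     ≈⟨ ⊛-cong (D-suc d s) (e-cong (cong (r *_) (ℕP.+-suc s (suc d)))) ⟩
      (e (r * suc s) ⊛ D d (suc s)) ⊛ e (r * (suc s + suc d))     ≈⟨ solve 3 (λ x y z → (x :* y) :* z := x :* (y :* z)) ≈-refl (e (r * suc s)) (D d (suc s)) _ ⟩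
      e (r * suc s) ⊛ D (suc d) (suc s) ∎
      where open SetoidReasoning setoid

    D-E : ∀ d → D d 0 ≈ E r d
    D-E zero    = ≈-refl
    D-E (suc d) = ⊛-cong (D-E d) ≈-refl

    -- In terms of n = s + d, Shanks' exponent s n + s(s+1)/2.
    exponent : ℕ → ℕ → ℕ
    exponent d s = s * (s + d) + triangle s

    -- Shanks' term for n = d + s.
    shanks : ℕ → ℕ → Series
    shanks d s = D d s ⊛ q^ (r * exponent d s)

    -- Shanks' sum G d j is taken over s ≤ j, with n = d + j.
    G : ℕ → ℕ → Series
    G d zero    = shanks d 0
    G d (suc j) = G (suc d) j ⊕ shanks d (suc j)

    -- The change of Shanks' sum over the fixed range s ≤ j when n grows from d + j to d + j + 1.
    -- For d = 0 it is a single monomial, with exponent r (j+1)(3j+2)/2.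
    boundary : ℕ → ℕ → Series
    boundary d j = q^ (r * (d + suc j + j)) ⊛ shanks d j

    shanks-telescopes : ∀ d j →
      boundary (suc d) j ⊕ shanks (suc d) (suc j) ≈ shanks d (suc j) ⊕ boundary d (suc j)
    shanks-telescopes d j = begin
      q^ (r * (suc d + suc j + j)) ⊛ (D (suc d) j ⊛ q^ (r * exponent (suc d) j)) ⊕ (D d s ⊛ e (r * n)) ⊛ q^ (r * exponent (suc d) s)
        ≈⟨ ⊕-cong (solve 3 (λ x D y → x :* (D :* y) := D :* (x :* y)) ≈-refl (q^ (r * (suc d + suc j + j))) (D (suc d) j) (q^ (r * exponent (suc d) j))) ≈-refl ⟩
      D (suc d) j ⊛ (q^ (r * (suc d + suc j + j)) ⊛ q^ (r * exponent (suc d) j)) ⊕ (D d s ⊛ e (r * n)) ⊛ q^ (r * exponent (suc d) s)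
        ≈⟨ ⊕-cong (⊛-cong (D-suc d j) (≈-sym (power-split (i₁ d j (triangle j))))) (⊛-cong (≈-refl {D d s ⊛ e (r * n)}) (power-split (i₂ d s (triangle s)))) ⟩
      (e (r * s) ⊛ D d s) ⊛ y ⊕ (D d s ⊛ e (r * n)) ⊛ (q^ (r * s) ⊛ y)
        -- Both terms are now multiples of D y, and in characteristic 2 the two copies of u D y
        -- cancel.
        ≈⟨ solve 4 (λ u v D y → ((con true :+ u) :* D) :* y :+ (D :* (con true :+ v)) :* (u :* y) := D :* y :+ (u :* v) :* (D :* y)) ≈-refl
             (q^ (r * s)) (q^ (r * n)) (D d s) y ⟩
      D d s ⊛ y ⊕ (q^ (r * s) ⊛ q^ (r * n)) ⊛ (D d s ⊛ y)
        ≈⟨ ⊕-cong ≈-refl (⊛-cong (≈-sym (power-split (i₃ d j))) ≈-refl) ⟩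
      shanks d s ⊕ boundary d s ∎
      where
      open SetoidReasoning setoid
      s = suc j
      n = s + suc d
      y = q^ (r * exponent d s)
      power-split : ∀ {a b c} → c ≡ a + b → q^ (r * c) ≈ q^ (r * a) ⊛ q^ (r * b)
      power-split {a} {b} c≡ = ≈-trans (q^-cong (trans (cong (r *_) c≡) (ℕP.*-distribˡ-+ r a b))) (q^-+ (r * a) (r * b))
      i₁ : ∀ d j t → suc j * (suc j + d) + (suc j + t) ≡ (suc d + suc j + j) + (j * (j + suc d) + t)
      i₁ = solve-∀
      i₂ : ∀ d s t → s * (s + suc d) + t ≡ s + (s * (s + d) + t)
      i₂ = solve-∀
      i₃ : ∀ d j → d + suc (suc j) + suc j ≡ suc j + (suc j + suc d)
      i₃ = solve-∀

    -- Telescoping in j: adding the term s = j + 1 converts `boundary (suc d) j` into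
    -- `boundary d (suc j)`.
    G-suc : ∀ d j → G (suc d) j ≈ G d j ⊕ boundary d j
    G-suc d zero = begin
      (D d 0 ⊛ e (r * suc d)) ⊛ q^ (r * 0)              ≈⟨ solve 3 (λ D x y → (D :* (con true :+ x)) :* y := D :* y :+ x :* (D :* y)) ≈-refl (D d 0) (q^ (r * suc d)) (q^ (r * 0)) ⟩
      shanks d 0 ⊕ q^ (r * suc d) ⊛ shanks d 0          ≈⟨ ⊕-cong ≈-refl (⊛-cong (q^-cong (cong (r *_) (lemma d))) ≈-refl) ⟩
      shanks d 0 ⊕ boundary d 0                         ∎
      where
      open SetoidReasoning setoid
      lemma : ∀ d → suc d ≡ d + 1 + 0
      lemma = solve-∀
    G-suc d (suc j) = begin
      G (2 + d) j ⊕ shanks (suc d) (suc j)                              ≈⟨ ⊕-cong (G-suc (suc d) j) ≈-refl ⟩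
      (G (suc d) j ⊕ boundary (suc d) j) ⊕ shanks (suc d) (suc j)       ≈⟨ ⊕-assoc (G (suc d) j) _ _ ⟩
      G (suc d) j ⊕ (boundary (suc d) j ⊕ shanks (suc d) (suc j))       ≈⟨ ⊕-cong ≈-refl (shanks-telescopes d j) ⟩
      G (suc d) j ⊕ (shanks d (suc j) ⊕ boundary d (suc j))             ≈⟨ ⊕-assoc (G (suc d) j) _ _ ⟨
      G d (suc j) ⊕ boundary d (suc j) ∎
      where open SetoidReasoning setoid

    -- The exponents for s ≥ 1 exceed n = d + j ≥ N, so up to order N only the term s = 0 survives,
    -- and that is the Euler product itself.
    G-E : ∀ {N} → 0 < r → ∀ d j → N ≤ d + j → G d j ≈[ N ] E r (d + j)
    G-E {N} r>0 d zero N≤ = ≈⇒≈[] (begin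
      D d 0 ⊛ q^ (r * 0)   ≈⟨ ⊛-cong (D-E d) (q^-cong (ℕP.*-zeroʳ r)) ⟩
      E r d ⊛ 1ₛ           ≈⟨ solve 1 (λ x → x :* con true := x) ≈-refl (E r d) ⟩
      E r d                ≡⟨ cong (E r) (sym (ℕP.+-identityʳ d)) ⟩
      E r (d + 0)          ∎)
      where open SetoidReasoning setoid
    G-E {N} r>0 d (suc j) N≤ = begin
      G (suc d) j ⊕ shanks d (suc j)   ≈⟨ ⊕-cong[] (G-E r>0 (suc d) j (subst (N ≤_) (ℕP.+-suc d j) N≤)) high-order ⟩
      E r (suc d + j) ⊕ 0ₛ             ≈⟨ ≈⇒≈[] (solve 1 (λ x → x :+ con false := x) ≈-refl (E r (suc d + j))) ⟩
      E r (suc d + j)                  ≡⟨ cong (E r) (sym (ℕP.+-suc d j)) ⟩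
      E r (d + suc j)                  ∎
      where
      open SetoidReasoning ([]-setoid N)
      N< : N < r * exponent d (suc j)
      N< = ℕP.<-≤-trans (s≤s (ℕP.≤-trans N≤ (ℕP.≤-trans (ℕP.≤-reflexive (ℕP.+-comm d (suc j))) (ℕP.m≤m+n (suc j + d) _))))
        (ℕP.≤-trans (ℕP.≤-reflexive (lemma d j (triangle j))) (ℕP.m≤n*m (exponent d (suc j)) r {{ℕ.>-nonZero r>0}}))
        where
        lemma : ∀ d j t → suc (suc j + d + (j * (suc j + d) + (j + t))) ≡ suc j * (suc j + d) + (suc j + t)
        lemma = solve-∀
      high-order : shanks d (suc j) ≈[ N ] 0ₛ
      high-order = pointwise λ n n≤N → trans (at (⊛-comm (D d (suc j)) _) n)
        (trans (q^-⊛-low (r * exponent d (suc j)) (D d (suc j)) n (ℕP.≤-<-trans n≤N N<)) (sym (0ₛ-at n)))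

    -- A number k is a generalised pentagonal number j(3j ± 1)/2 exactly when 24k + 1 is a square,
    -- namely (6j ± 1)²; this square is what enters the quadratic form.
    Pentagonal : ℕ → Set
    Pentagonal i = ∃[ k ] i ≡ r * k × (∃[ x ] 24 * k + 1 ≡ x * x)

    shanks-top : ∀ s → shanks 0 s ≈ q^ (r * (s * s + triangle s))
    shanks-top s = ≈-trans (⊛-identityˡ _) (q^-cong (cong (λ t → r * (s * t + triangle s)) (ℕP.+-identityʳ s)))

    ⊕-true : ∀ f g i → (f ⊕ g) i ≡ true → f i ≡ true ⊎ g i ≡ true
    ⊕-true f g i h with f i | g i | trans (sym (⊕-at f g i)) h
    ... | true  | _    | _ = inj₁ refl
    ... | false | true | _ = inj₂ refl

    -- Passing from n to j = n + 1 adds two monomials: the last term of Shanks' sum, with 24k + 1 =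
    -- (6j + 1)², and the boundary term of `G-suc`, with 24k + 1 = (6j - 1)².
    G-support : ∀ n i → G 0 n i ≡ true → Pentagonal i
    G-support zero i h = 0 , sym (q^-at (r * 0) i (trans (sym (at (shanks-top 0) i)) h)) , 1 , refl
    G-support (suc n) i h with ⊕-true (G 1 n) (shanks 0 (suc n)) i h
    ... | inj₂ h₂ = suc n * suc n + triangle (suc n) , sym (q^-at _ i (trans (sym (at (shanks-top (suc n)) i)) h₂)) , 7 + 6 * n ,
      trans (expand (suc n) (triangle (suc n))) (trans (cong (λ t → 24 * (suc n * suc n) + 12 * t + 1) (triangle-double (suc n))) (square n))
      where
      expand : ∀ m t → 24 * (m * m + t) + 1 ≡ 24 * (m * m) + 12 * (2 * t) + 1
      expand = solve-∀
      square : ∀ n → 24 * (suc n * suc n) + 12 * (suc n * suc (suc n)) + 1 ≡ (7 + 6 * n) * (7 + 6 * n)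
      square = solve-∀
    ... | inj₁ h₁ with ⊕-true (G 0 n) (boundary 0 n) i (trans (sym (at (G-suc 0 n) i)) h₁)
    ... | inj₁ h₀ = G-support n i h₀
    ... | inj₂ h₀ = suc n + n + (n * n + triangle n) , sym (q^-at _ i (trans (at power i) h₀)) , 5 + 6 * n ,
      trans (expand n (triangle n)) (trans (cong (λ t → 24 * (suc n + n + n * n) + 12 * t + 1) (triangle-double n)) (square n))
      where
      power : q^ (r * (suc n + n + (n * n + triangle n))) ≈ boundary 0 n
      power = ≈-trans (q^-cong (ℕP.*-distribˡ-+ r (suc n + n) (n * n + triangle n))) (≈-trans (q^-+ (r * (suc n + n)) _)
        (⊛-cong (≈-refl {q^ (r * (suc n + n))}) (≈-sym (shanks-top n))))
      expand : ∀ n t → 24 * (suc n + n + (n * n + t)) + 1 ≡ 24 * (suc n + n + n * n) + 12 * (2 * t) + 1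
      expand = solve-∀
      square : ∀ n → 24 * (suc n + n + n * n) + 12 * (n * suc n) + 1 ≡ (5 + 6 * n) * (5 + 6 * n)
      square = solve-∀

    E-support : 0 < r → ∀ {N} i → i ≤ N → E r N i ≡ true → Pentagonal i
    E-support r>0 {N} i i≤N h = G-support N i (trans (at[] (G-E r>0 0 N ℕP.≤-refl) i i≤N) h)

  ⊛-true : ∀ f g n → (f ⊛ g) n ≡ true → ∃[ i ] ∃[ j ] i + j ≡ n × f i ≡ true × g j ≡ true
  ⊛-true f g zero    h with f 0 in f0 | g 0 in g0
  ... | true | true = 0 , 0 , refl , f0 , g0
  ⊛-true f g (suc n) h with f 0 in f0 | g (suc n) in gn
  ... | true  | true  = 0 , suc n , refl , f0 , gn
  ... | true  | false = let i , j , s , p , q = ⊛-true (∂ f) g n h in suc i , j , cong suc s , p , q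
  ... | false | _     = let i , j , s , p , q = ⊛-true (∂ f) g n h in suc i , j , cong suc s , p , q

  -- Here n = k + 3l, and (24k + 1) + 3(24l + 1) = 4(6n + 1).
  pentagonal-sum : ∀ {n i j} → i + j ≡ n → Pentagonal 1 i → Pentagonal 3 j → ∃[ x ] ∃[ y ] x * x + 3 * (y * y) ≡ 4 * (6 * n + 1)
  pentagonal-sum refl (k , refl , x , kx) (l , refl , y , ly) = x , y , trans (cong₂ (λ u v → u + 3 * v) (sym kx) (sym ly)) (lemma k l)
    where
    lemma : ∀ k l → 24 * k + 1 + 3 * (24 * l + 1) ≡ 4 * (6 * (1 * k + 3 * l) + 1)
    lemma = solve-∀

  odd-cp-represents : ∀ n → odd (cp 5 1 6 n) ≡ true → ∃[ x ] ∃[ y ] x * x + 3 * (y * y) ≡ 4 * (6 * n + 1)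
  odd-cp-represents n h =
    let i , j , i+j≡n , p , q = ⊛-true (E 1 n) (E 3 n) n (trans (sym (at[] (C-product n) n ℕP.≤-refl)) (trans (sym (odd-cp 6 5 1 n)) h))
    in pentagonal-sum i+j≡n
         (E-support 1 (s≤s z≤n) i (subst (i ≤_) i+j≡n (ℕP.m≤m+n i j)) p)
         (E-support 3 (s≤s z≤n) j (subst (j ≤_) i+j≡n (ℕP.m≤n+m j i)) q)

-- Finite sums of natural numbers.

module Sums where

  open import Data.Nat using (ℕ; zero; suc; _≤_; _<_; z≤n; s≤s; _+_; _*_)
  import Data.Nat.Properties as ℕP
  open import Data.Nat.Divisibility using (_∣_; ∣m∣n⇒∣m+n; _∣0)
  open import Data.Nat.Tactic.RingSolver using (solve-∀)
  open import Relation.Binary.PropositionalEquality using (_≡_; refl; sym; trans; cong; cong₂)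

  Σℕ : (ℕ → ℕ) → ℕ → ℕ
  Σℕ f zero    = 0
  Σℕ f (suc n) = Σℕ f n + f n

  Σℕ-cong : ∀ {f g} n → (∀ i → i < n → f i ≡ g i) → Σℕ f n ≡ Σℕ g n
  Σℕ-cong zero    h = refl
  Σℕ-cong (suc n) h = cong₂ _+_ (Σℕ-cong n (λ i l → h i (ℕP.m≤n⇒m≤1+n l))) (h n ℕP.≤-refl)

  Σℕ-mono : ∀ {f g} n → (∀ i → i < n → f i ≤ g i) → Σℕ f n ≤ Σℕ g n
  Σℕ-mono zero    h = z≤n
  Σℕ-mono (suc n) h = ℕP.+-mono-≤ (Σℕ-mono n (λ i l → h i (ℕP.m≤n⇒m≤1+n l))) (h n ℕP.≤-refl)

  Σℕ-+ : ∀ f g n → Σℕ (λ i → f i + g i) n ≡ Σℕ f n + Σℕ g n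
  Σℕ-+ f g zero    = refl
  Σℕ-+ f g (suc n) = trans (cong (_+ (f n + g n)) (Σℕ-+ f g n)) (lemma (Σℕ f n) (Σℕ g n) (f n) (g n))
    where
    lemma : ∀ a b c d → a + b + (c + d) ≡ a + c + (b + d)
    lemma = solve-∀

  Σℕ-* : ∀ c f n → Σℕ (λ i → c * f i) n ≡ c * Σℕ f n
  Σℕ-* c f zero    = sym (ℕP.*-zeroʳ c)
  Σℕ-* c f (suc n) = trans (cong (_+ c * f n) (Σℕ-* c f n)) (sym (ℕP.*-distribˡ-+ c (Σℕ f n) (f n)))

  Σℕ-head : ∀ f n → Σℕ f (suc n) ≡ f 0 + Σℕ (λ i → f (suc i)) n
  Σℕ-head f zero    = ℕP.+-comm 0 (f 0)
  Σℕ-head f (suc n) = trans (cong (_+ f (suc n)) (Σℕ-head f n)) (ℕP.+-assoc (f 0) _ _)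

  Σℕ-append : ∀ f m n → Σℕ f (m + n) ≡ Σℕ f m + Σℕ (λ i → f (m + i)) n
  Σℕ-append f m zero    = trans (cong (Σℕ f) (ℕP.+-identityʳ m)) (sym (ℕP.+-identityʳ _))
  Σℕ-append f m (suc n) = trans (cong (Σℕ f) (ℕP.+-suc m n))
    (trans (cong (_+ f (m + n)) (Σℕ-append f m n)) (ℕP.+-assoc (Σℕ f m) _ _))

  Σℕ-const : ∀ c n → Σℕ (λ _ → c) n ≡ n * c
  Σℕ-const c zero    = refl
  Σℕ-const c (suc n) = trans (cong (_+ c) (Σℕ-const c n)) (ℕP.+-comm (n * c) c)

  Σℕ-zero : ∀ {f} n → (∀ i → i < n → f i ≡ 0) → Σℕ f n ≡ 0
  Σℕ-zero n h = trans (Σℕ-cong n h) (trans (Σℕ-const 0 n) (ℕP.*-zeroʳ n))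

  Σℕ-monoʳ : ∀ f {m n} → m ≤ n → Σℕ f m ≤ Σℕ f n
  Σℕ-monoʳ f {zero}  {n}     _ = z≤n
  Σℕ-monoʳ f {suc m} {suc n} (s≤s l) = begin
    Σℕ f (suc m)                       ≡⟨ Σℕ-head f m ⟩
    f 0 + Σℕ (λ i → f (suc i)) m       ≤⟨ ℕP.+-monoʳ-≤ (f 0) (Σℕ-monoʳ (λ i → f (suc i)) l) ⟩
    f 0 + Σℕ (λ i → f (suc i)) n       ≡⟨ Σℕ-head f n ⟨
    Σℕ f (suc n)                       ∎
    where open ℕP.≤-Reasoning

  Σℕ-∣ : ∀ {d f} n → (∀ i → i < n → d ∣ f i) → d ∣ Σℕ f n
  Σℕ-∣ {d} zero    h = d ∣0
  Σℕ-∣ {d} (suc n) h = ∣m∣n⇒∣m+n (Σℕ-∣ n (λ i l → h i (ℕP.m≤n⇒m≤1+n l))) (h n ℕP.≤-refl)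

-- Primes p ≡ 2 (mod 3) and the quadratic form x² + 3y².

module QuadraticForm where

  open Sums
  open import Data.Nat as ℕ using (ℕ; zero; suc; _≤_; _<_; z≤n; s≤s; _+_; _*_; _^_; NonZero)
  import Data.Nat.Properties as ℕP
  open import Data.Nat.Divisibility using (_∣_; divides; ∣-trans; ∣m⇒∣m*n; ∣n⇒∣m*n; m∣m*n; ∣m∣n⇒∣m+n; ∣m+n∣m⇒∣n; *-cancelˡ-∣; *-monoʳ-∣; ∣⇒≤; ∣1⇒≡1; >⇒∤; 1∣_)
  open import Data.Nat.DivMod using (_%_; _/_; m≡m%n+[m/n]*n)
  open import Data.Nat.Primality using (Prime; euclidsLemma; prime⇒nonZero; prime⇒nonTrivial)
  open import Data.Nat.Combinatorics using (_C_; nCk+nC[k+1]≡[n+1]C[k+1]; nCn≡1; nC1≡n; k>n⇒nCk≡0)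
  open import Data.Nat.Tactic.RingSolver using (solve-∀)
  open import Data.Integer as ℤ using (ℤ; +_; ∣_∣)
  import Data.Integer.Properties as ℤP
  import Data.Integer.DivMod as ℤD
  import Data.Integer.Divisibility.Signed as S
  import Data.Integer.Tactic.RingSolver as ℤSolver
  open import Data.Product using (_×_; _,_; ∃-syntax)
  open import Data.Sum using (_⊎_; inj₁; inj₂; [_,_]′)
  open import Data.Empty using (⊥-elim)
  open import Relation.Nullary using (¬_)
  open import Relation.Binary.PropositionalEquality using (_≡_; _≢_; refl; sym; trans; cong; cong₂; subst; module ≡-Reasoning)

  prime>1 : ∀ {p} → Prime p → 1 < p
  prime>1 {p} pp = ℕ.nonTrivial⇒n>1 p {{prime⇒nonTrivial pp}}

  prime>0 : ∀ {p} → Prime p → 0 < p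
  prime>0 pp = ℕP.<-trans (s≤s z≤n) (prime>1 pp)

  prime∤1 : ∀ {p} → Prime p → ¬ (p ∣ 1)
  prime∤1 pp p∣1 = ℕP.<⇒≢ (prime>1 pp) (sym (∣1⇒≡1 p∣1))

  prime-power-cancel : ∀ {p} → Prime p → ∀ {a} → ¬ (p ∣ a) → ∀ j {b} → p ^ j ∣ a * b → p ^ j ∣ b
  prime-power-cancel pp p∤a zero    _ = 1∣ _
  prime-power-cancel {p} pp {a} p∤a (suc j) {b} h with euclidsLemma a b pp (∣-trans (m∣m*n (p ^ j)) h)
  ... | inj₁ p∣a = ⊥-elim (p∤a p∣a)
  ... | inj₂ (divides b′ refl) = subst (p ^ suc j ∣_) (ℕP.*-comm p b′)
    (*-monoʳ-∣ p (prime-power-cancel pp p∤a j (*-cancelˡ-∣ p {{prime⇒nonZero pp}} (subst (p * p ^ j ∣_) (swap a b′ p) h))))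
    where
    swap : ∀ a b p → a * (b * p) ≡ p * (a * b)
    swap = solve-∀

  -- Fermat's little theorem, by the binomial expansion.

  absorption : ∀ n k → suc k * (suc n C suc k) ≡ suc n * (n C k)
  absorption n       zero    = trans (ℕP.*-identityˡ _) (trans (nC1≡n (suc n)) (sym (ℕP.*-identityʳ (suc n))))
  absorption zero    (suc k) = trans (cong (suc (suc k) *_) (k>n⇒nCk≡0 {1} {suc (suc k)} (s≤s (s≤s z≤n)))) (ℕP.*-zeroʳ k)
  absorption (suc n) (suc k) = begin
    suc (suc k) * (suc (suc n) C suc (suc k))
      ≡⟨ cong (suc (suc k) *_) (nCk+nC[k+1]≡[n+1]C[k+1] (suc n) (suc k)) ⟨
    suc (suc k) * (suc n C suc k + suc n C suc (suc k))
      ≡⟨ expand (suc n C suc k) (suc n C suc (suc k)) k ⟩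
    (suc n C suc k) + suc k * (suc n C suc k) + suc (suc k) * (suc n C suc (suc k))
      ≡⟨ cong₂ (λ u v → (suc n C suc k) + u + v) (absorption n k) (absorption n (suc k)) ⟩
    (suc n C suc k) + suc n * (n C k) + suc n * (n C suc k)
      ≡⟨ collect (suc n C suc k) n (n C k) (n C suc k) ⟩
    (suc n C suc k) + suc n * (n C k + n C suc k)
      ≡⟨ cong (λ t → (suc n C suc k) + suc n * t) (nCk+nC[k+1]≡[n+1]C[k+1] n k) ⟩
    suc (suc n) * (suc n C suc k) ∎
    where
    open ≡-Reasoning
    expand : ∀ u v k → suc (suc k) * (u + v) ≡ u + suc k * u + suc (suc k) * v
    expand = solve-∀
    collect : ∀ c n u v → c + suc n * u + suc n * v ≡ c + suc n * (u + v)
    collect = solve-∀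

  binomial-expansion : ∀ x n → suc x ^ n ≡ 1 + Σℕ (λ k → (n C suc k) * x ^ suc k) n
  binomial-expansion x zero    = refl
  binomial-expansion x (suc n) = begin
    suc x * suc x ^ n                        ≡⟨ cong (suc x *_) (binomial-expansion x n) ⟩
    suc x * (1 + T)                          ≡⟨ expand x T ⟩
    1 + (x * (1 + T) + T)                    ≡⟨ cong suc (cong₂ _+_ lower upper) ⟨
    1 + (Σℕ (λ k → (n C k) * x ^ suc k) (suc n) + Σℕ (λ k → (n C suc k) * x ^ suc k) (suc n))
      ≡⟨ cong suc (Σℕ-+ _ _ (suc n)) ⟨
    1 + Σℕ (λ k → (n C k) * x ^ suc k + (n C suc k) * x ^ suc k) (suc n)
      ≡⟨ cong suc (Σℕ-cong (suc n) (λ k _ → trans (sym (ℕP.*-distribʳ-+ (x ^ suc k) (n C k) (n C suc k)))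
           (cong (_* x ^ suc k) (nCk+nC[k+1]≡[n+1]C[k+1] n k)))) ⟩
    1 + Σℕ (λ k → (suc n C suc k) * x ^ suc k) (suc n) ∎
    where
    open ≡-Reasoning
    T = Σℕ (λ k → (n C suc k) * x ^ suc k) n
    expand : ∀ x T → suc x * (1 + T) ≡ 1 + (x * (1 + T) + T)
    expand = solve-∀
    pull : ∀ c x y → c * (x * y) ≡ x * (c * y)
    pull = solve-∀
    lower : Σℕ (λ k → (n C k) * x ^ suc k) (suc n) ≡ x * (1 + T)
    lower = trans (Σℕ-cong (suc n) (λ k _ → pull (n C k) x (x ^ k)))
      (trans (Σℕ-* x (λ k → (n C k) * x ^ k) (suc n)) (cong (x *_) (Σℕ-head (λ k → (n C k) * x ^ k) n)))
    upper : Σℕ (λ k → (n C suc k) * x ^ suc k) (suc n) ≡ T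
    upper = trans (cong (λ t → T + t * x ^ suc n) (k>n⇒nCk≡0 {n} {suc n} ℕP.≤-refl)) (ℕP.+-identityʳ T)

  prime∣binomial : ∀ {p k} → Prime p → suc k < p → p ∣ p C suc k
  prime∣binomial {suc n} {k} pp k<p with euclidsLemma (suc k) (suc n C suc k) pp (subst (suc n ∣_) (sym (absorption n k)) (m∣m*n (n C k)))
  ... | inj₁ p∣k = ⊥-elim (>⇒∤ k<p p∣k)
  ... | inj₂ p∣c = p∣c

  pos-^ : ∀ x n → + (x ^ n) ≡ (+ x) ℤ.^ n
  pos-^ x zero    = refl
  pos-^ x (suc n) = trans (ℤP.pos-* x (x ^ n)) (cong (+ x ℤ.*_) (pos-^ x n))

  module _ {p : ℕ} (pp : Prime p) where

    private instance
      p≢0 : NonZero p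
      p≢0 = prime⇒nonZero pp

    ∣ₚ-resp : ∀ {a b} → a ≡ b → + p S.∣ a → + p S.∣ b
    ∣ₚ-resp refl h = h

    frobenius : ∀ x → ∃[ t ] suc x ^ p ≡ 1 + (p * t + x ^ p)
    frobenius x with Σℕ-∣ {p} (ℕ.pred p) (λ i i< → ∣m⇒∣m*n (x ^ suc i) (prime∣binomial pp (ℕP.≤-trans (s≤s i<) (ℕP.≤-reflexive (ℕP.suc-pred p)))))
    ... | divides t eq = t , (begin
      suc x ^ p                                          ≡⟨ binomial-expansion x p ⟩
      1 + Σℕ f p                                         ≡⟨ cong (λ j → 1 + Σℕ f j) (ℕP.suc-pred p) ⟨
      1 + (Σℕ f (ℕ.pred p) + f (ℕ.pred p))               ≡⟨ cong suc (cong₂ _+_ (trans eq (ℕP.*-comm t p)) (trans (cong (λ j → (p C j) * x ^ j) (ℕP.suc-pred p)) (trans (cong (_* x ^ p) (nCn≡1 p)) (ℕP.*-identityˡ _)))) ⟩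
      1 + (p * t + x ^ p)                                ∎)
      where
      open ≡-Reasoning
      f : ℕ → ℕ
      f k = (p C suc k) * x ^ suc k

    fermat-ℕ : ∀ x → + p S.∣ (+ x) ℤ.^ p ℤ.- + x
    fermat-ℕ zero    = ∣ₚ-resp (sym (cong (ℤ._- + 0) (zero-^ p))) (S.divides (+ 0) refl)
      where
      zero-^ : ∀ n → .{{NonZero n}} → (+ 0) ℤ.^ n ≡ + 0
      zero-^ (suc n) = refl
    fermat-ℕ (suc x) with frobenius x | fermat-ℕ x
    ... | t , eq | S.divides u eq′ = S.divides (+ t ℤ.+ u) (begin
      (+ suc x) ℤ.^ p ℤ.- + suc x                               ≡⟨ cong (ℤ._- + suc x) (trans (sym (pos-^ (suc x) p)) (cong +_ eq)) ⟩
      + (1 + (p * t + x ^ p)) ℤ.- + (1 + x)                     ≡⟨ cong₂ ℤ._-_ (trans (ℤP.pos-+ 1 _) (cong (ℤ._+_ (+ 1)) (trans (ℤP.pos-+ (p * t) _) (cong₂ ℤ._+_ (ℤP.pos-* p t) (pos-^ x p))))) (ℤP.pos-+ 1 x) ⟩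
      (+ 1 ℤ.+ (+ p ℤ.* + t ℤ.+ X)) ℤ.- (+ 1 ℤ.+ + x)           ≡⟨ rearrange (+ p) (+ t) X (+ x) ⟩
      + t ℤ.* + p ℤ.+ (X ℤ.- + x)                               ≡⟨ cong (λ s → + t ℤ.* + p ℤ.+ s) eq′ ⟩
      + t ℤ.* + p ℤ.+ u ℤ.* + p                                 ≡⟨ ℤP.*-distribʳ-+ (+ p) (+ t) u ⟨
      (+ t ℤ.+ u) ℤ.* + p                                       ∎)
      where
      open ≡-Reasoning
      X = (+ x) ℤ.^ p
      rearrange : ∀ p t X x → (+ 1 ℤ.+ (p ℤ.* t ℤ.+ X)) ℤ.- (+ 1 ℤ.+ x) ≡ t ℤ.* p ℤ.+ (X ℤ.- x)
      rearrange = ℤSolver.solve-∀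

    ^-congruent : ∀ {a b} n → + p S.∣ a ℤ.- b → + p S.∣ a ℤ.^ n ℤ.- b ℤ.^ n
    ^-congruent zero    h = S.divides (+ 0) refl
    ^-congruent {a} {b} (suc n) h = ∣ₚ-resp (telescope a b (a ℤ.^ n) (b ℤ.^ n))
      (S.∣m∣n⇒∣m+n (S.∣n⇒∣m*n a (^-congruent n h)) (S.∣m⇒∣m*n (b ℤ.^ n) h))
      where
      telescope : ∀ a b A B → a ℤ.* (A ℤ.- B) ℤ.+ (a ℤ.- b) ℤ.* B ≡ a ℤ.* A ℤ.- b ℤ.* B
      telescope = ℤSolver.solve-∀

    fermat : ∀ a → + p S.∣ a ℤ.^ p ℤ.- a
    fermat a = ∣ₚ-resp (combine (a ℤ.^ p) ((+ r) ℤ.^ p) (+ r) a)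
      (S.∣m∣n⇒∣m+n (S.∣m∣n⇒∣m+n (^-congruent p residue) (fermat-ℕ r)) (S.∣m⇒∣-m residue))
      where
      r = a ℤD.%ℕ p
      combine : ∀ A R r a → (A ℤ.- R) ℤ.+ (R ℤ.- r) ℤ.+ ℤ.- (a ℤ.- r) ≡ A ℤ.- a
      combine = ℤSolver.solve-∀
      cancel : ∀ r q → (r ℤ.+ q) ℤ.- r ≡ q
      cancel = ℤSolver.solve-∀
      residue : + p S.∣ a ℤ.- + r
      residue = S.divides (a ℤD./ℕ p) (trans (cong (ℤ._- + r) (ℤD.a≡a%ℕn+[a/ℕn]*n a p)) (cancel (+ r) _))

    euclid-ℤ : ∀ a b → + p S.∣ a ℤ.* b → + p S.∣ a ⊎ + p S.∣ b
    euclid-ℤ a b h with euclidsLemma ∣ a ∣ ∣ b ∣ pp (subst (p ∣_) (ℤP.abs-* a b) (S.∣⇒∣ᵤ h))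
    ... | inj₁ h₁ = inj₁ (S.∣ᵤ⇒∣ h₁)
    ... | inj₂ h₂ = inj₂ (S.∣ᵤ⇒∣ h₂)

    euclid-square : ∀ a → + p S.∣ a ℤ.* a → + p S.∣ a
    euclid-square a h = [ (λ z → z) , (λ z → z) ]′ (euclid-ℤ a a h)

    -- If α and β are units modulo p, then A and B are their inverses, and A ≡ B forces α ≡ β.
    -- Multiplied out, the conclusion also covers non-units.
    cross-product : ∀ α β A B → + p S.∣ A ℤ.* (α ℤ.* α) ℤ.- α → + p S.∣ B ℤ.* (β ℤ.* β) ℤ.- β → + p S.∣ A ℤ.- B →
      + p S.∣ α ℤ.* β ℤ.* (β ℤ.- α)
    cross-product α β A B hα hβ hAB = ∣ₚ-resp (combine A B α β)
      (S.∣m∣n⇒∣m+n (S.∣m∣n⇒∣m+n (S.∣n⇒∣m*n (ℤ.- (β ℤ.* β)) hα) (S.∣n⇒∣m*n (α ℤ.* α ℤ.* (β ℤ.* β)) hAB)) (S.∣n⇒∣m*n (α ℤ.* α) hβ))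
      where
      combine : ∀ A B α β → ℤ.- (β ℤ.* β) ℤ.* (A ℤ.* (α ℤ.* α) ℤ.- α) ℤ.+ α ℤ.* α ℤ.* (β ℤ.* β) ℤ.* (A ℤ.- B)
        ℤ.+ α ℤ.* α ℤ.* (B ℤ.* (β ℤ.* β) ℤ.- β) ≡ α ℤ.* β ℤ.* (β ℤ.- α)
      combine = ℤSolver.solve-∀

    cubes-congruent : ∀ α β → + p S.∣ α ℤ.* α ℤ.+ α ℤ.* β ℤ.+ β ℤ.* β → + p S.∣ α ℤ.^ 3 ℤ.- β ℤ.^ 3
    cubes-congruent α β h = ∣ₚ-resp (trans (cubes α β) (cong₂ ℤ._-_ (cube α) (cube β))) (S.∣n⇒∣m*n (α ℤ.- β) h)
      where
      cubes : ∀ α β → (α ℤ.- β) ℤ.* (α ℤ.* α ℤ.+ α ℤ.* β ℤ.+ β ℤ.* β) ≡ α ℤ.* (α ℤ.* α) ℤ.- β ℤ.* (β ℤ.* β)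
      cubes = ℤSolver.solve-∀
      cube : ∀ α → α ℤ.* (α ℤ.* α) ≡ α ℤ.^ 3
      cube α = cong (λ t → α ℤ.* (α ℤ.* t)) (sym (ℤP.*-identityʳ α))

    -- With a^p ≡ a, the cofactor of a² serves as an inverse of a modulo p that depends on a³ only.
    power-mod-3 : p % 3 ≡ 2 → ∀ a → a ℤ.^ p ≡ (a ℤ.^ 3) ℤ.^ (p / 3) ℤ.* (a ℤ.* a)
    power-mod-3 p%3 a = begin
      a ℤ.^ p                                    ≡⟨ cong (a ℤ.^_) p≡ ⟨
      a ℤ.^ (3 * (p / 3) + 2)                    ≡⟨ ℤP.^-distribˡ-+-* a (3 * (p / 3)) 2 ⟩
      a ℤ.^ (3 * (p / 3)) ℤ.* (a ℤ.^ 2)          ≡⟨ cong₂ ℤ._*_ (sym (ℤP.^-*-assoc a 3 (p / 3))) (cong (a ℤ.*_) (ℤP.*-identityʳ a)) ⟩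
      (a ℤ.^ 3) ℤ.^ (p / 3) ℤ.* (a ℤ.* a)        ∎
      where
      open ≡-Reasoning
      p≡ : 3 * (p / 3) + 2 ≡ p
      p≡ = trans (ℕP.+-comm (3 * (p / 3)) 2) (sym (trans (m≡m%n+[m/n]*n p 3) (cong₂ _+_ p%3 (ℕP.*-comm (p / 3) 3))))

    not-3 : p % 3 ≡ 2 → ¬ (p ∣ 3)
    not-3 p%3 h = go p p%3 (∣⇒≤ h) h
      where
      go : ∀ p → p % 3 ≡ 2 → p ≤ 3 → ¬ (p ∣ 3)
      go 0 ()
      go 1 ()
      go 2 _ _ (divides (suc (suc _)) ())
      go 3 ()
      go (suc (suc (suc (suc p)))) _ (s≤s (s≤s (s≤s ())))

    -- If p divides α, the form reduces to β²; if α ≡ β, it reduces to 3β², and p does not divide 3.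
    norm-divisible-product : p % 3 ≡ 2 → ∀ α β → + p S.∣ α ℤ.* α ℤ.+ α ℤ.* β ℤ.+ β ℤ.* β →
      + p S.∣ α ℤ.* β ⊎ + p S.∣ β ℤ.- α → + p S.∣ β
    norm-divisible-product p%3 α β h (inj₁ h₁) with euclid-ℤ α β h₁
    ... | inj₂ p∣β = p∣β
    ... | inj₁ p∣α = euclid-square β (S.∣m+n∣m⇒∣n {m = α ℤ.* (α ℤ.+ β)} (∣ₚ-resp (split α β) h) (S.∣m⇒∣m*n (α ℤ.+ β) p∣α))
      where
      split : ∀ α β → α ℤ.* α ℤ.+ α ℤ.* β ℤ.+ β ℤ.* β ≡ α ℤ.* (α ℤ.+ β) ℤ.+ β ℤ.* β
      split = ℤSolver.solve-∀
    norm-divisible-product p%3 α β h (inj₂ h₂) =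
      [ (λ h₃ → ⊥-elim (not-3 p%3 (S.∣⇒∣ᵤ h₃))) , euclid-square β ]′
        (euclid-ℤ (+ 3) (β ℤ.* β) (∣ₚ-resp (triple-square α β) (S.∣m∣n⇒∣m+n h (S.∣m⇒∣m*n (α ℤ.+ + 2 ℤ.* β) h₂))))
      where
      triple-square : ∀ α β → α ℤ.* α ℤ.+ α ℤ.* β ℤ.+ β ℤ.* β ℤ.+ (β ℤ.- α) ℤ.* (α ℤ.+ + 2 ℤ.* β) ≡ + 3 ℤ.* (β ℤ.* β)
      triple-square = ℤSolver.solve-∀

    -- A non-trivial zero of α² + αβ + β² modulo p would give a ratio α/β of order 3 in the multiplicative
    -- group modulo p, whose order p - 1 is not divisible by 3.
    norm-divisible : p % 3 ≡ 2 → ∀ α β → + p S.∣ α ℤ.* α ℤ.+ α ℤ.* β ℤ.+ β ℤ.* β → + p S.∣ β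
    norm-divisible p%3 α β h = norm-divisible-product p%3 α β h (euclid-ℤ (α ℤ.* β) (β ℤ.- α)
      (cross-product α β ((α ℤ.^ 3) ℤ.^ (p / 3)) ((β ℤ.^ 3) ℤ.^ (p / 3))
        (∣ₚ-resp (cong (ℤ._- α) (power-mod-3 p%3 α)) (fermat α))
        (∣ₚ-resp (cong (ℤ._- β) (power-mod-3 p%3 β)) (fermat β))
        (^-congruent (p / 3) (cubes-congruent α β h))))

    -- With α = x - y and β = 2y, the form becomes α² + αβ + β², so p divides 2y. The prime 2 must
    -- be excluded: 1 + 3 is even.
    form-divisible : p ≢ 2 → p % 3 ≡ 2 → ∀ x y → p ∣ x * x + 3 * (y * y) → (p ∣ x) × (p ∣ y)
    form-divisible p≢2 p%3 x y h = p∣x , p∣y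
      where
      pos-form : ∀ u c v → + (u + c * v) ≡ + u ℤ.+ + c ℤ.* + v
      pos-form u c v = trans (ℤP.pos-+ u (c * v)) (cong (ℤ._+_ (+ u)) (ℤP.pos-* c v))
      form : + (x * x + 3 * (y * y)) ≡ + x ℤ.* + x ℤ.+ + 3 ℤ.* (+ y ℤ.* + y)
      form = trans (pos-form (x * x) 3 (y * y)) (cong₂ (λ u v → u ℤ.+ + 3 ℤ.* v) (ℤP.pos-* x x) (ℤP.pos-* y y))
      substitution : ∀ x y → x ℤ.* x ℤ.+ + 3 ℤ.* (y ℤ.* y) ≡
        (x ℤ.- y) ℤ.* (x ℤ.- y) ℤ.+ (x ℤ.- y) ℤ.* (y ℤ.+ y) ℤ.+ (y ℤ.+ y) ℤ.* (y ℤ.+ y)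
      substitution = ℤSolver.solve-∀
      p∣y+y : + p S.∣ + y ℤ.+ + y
      p∣y+y = norm-divisible p%3 (+ x ℤ.- + y) (+ y ℤ.+ + y) (∣ₚ-resp (trans form (substitution (+ x) (+ y))) (S.∣ᵤ⇒∣ h))
      p∣2*y : p ∣ 2 * y
      p∣2*y = subst (p ∣_) (cong (y ℕ.+_) (sym (ℕP.+-identityʳ y))) (S.∣⇒∣ᵤ p∣y+y)
      p∣y : p ∣ y
      p∣y = [ (λ p∣2 → ⊥-elim (p≢2 (ℕP.≤-antisym (∣⇒≤ p∣2) (prime>1 pp)))) , (λ z → z) ]′ (euclidsLemma 2 y pp p∣2*y)
      p∣x : p ∣ x
      p∣x = [ (λ z → z) , (λ z → z) ]′ (euclidsLemma x x pp
        (∣m+n∣m⇒∣n (subst (p ∣_) (ℕP.+-comm (x * x) _) h) (∣n⇒∣m*n 3 (∣m⇒∣m*n y p∣y))))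

    scaled-form : ∀ x y → (x * p) * (x * p) + 3 * ((y * p) * (y * p)) ≡ p * (p * (x * x + 3 * (y * y)))
    scaled-form = lemma p
      where
      lemma : ∀ p x y → (x * p) * (x * p) + 3 * ((y * p) * (y * p)) ≡ p * (p * (x * x + 3 * (y * y)))
      lemma = solve-∀

    -- Descent: p divides both x and y, so p² splits off and the exponent drops by 2.
    form-even-valuation : p ≢ 2 → p % 3 ≡ 2 → ∀ k x y →
      p ^ suc (2 * k) ∣ x * x + 3 * (y * y) → p ^ suc (suc (2 * k)) ∣ x * x + 3 * (y * y)
    form-even-valuation p≢2 p%3 k x y h =
      let divides x′ x≡ , divides y′ y≡ = form-divisible p≢2 p%3 x y (∣-trans (m∣m*n (p ^ (2 * k))) h)
          eq = trans (cong₂ (λ u v → u * u + 3 * (v * v)) x≡ y≡) (scaled-form x′ y′)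
      in subst (p ^ suc (suc (2 * k)) ∣_) (sym eq) (descend x′ y′ k (subst (p ^ suc (2 * k) ∣_) eq h))
      where
      descend : ∀ x y k → p ^ suc (2 * k) ∣ p * (p * (x * x + 3 * (y * y))) → p ^ suc (suc (2 * k)) ∣ p * (p * (x * x + 3 * (y * y)))
      descend x y zero    h = *-monoʳ-∣ p (*-monoʳ-∣ p (1∣ _))
      descend x y (suc k) h = subst (λ e → p ^ suc (suc e) ∣ p * (p * (x * x + 3 * (y * y)))) (sym (exponent k))
        (*-monoʳ-∣ p (*-monoʳ-∣ p (form-even-valuation p≢2 p%3 k x y
          (*-cancelˡ-∣ p (*-cancelˡ-∣ p (subst (λ e → p ^ suc e ∣ p * (p * (x * x + 3 * (y * y)))) (exponent k) h))))))
        where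
        exponent : ∀ k → 2 * suc k ≡ suc (suc (2 * k))
        exponent = solve-∀

-- The divisor sum r of the character modulo 3.

module DivisorCharacterSum where

  open Sums
  open QuadraticForm
  open import Data.Nat as ℕ using (ℕ; zero; suc; _≤_; _<_; z≤n; s≤s; _+_; _*_; _^_; NonZero)
  import Data.Nat.Properties as ℕP
  open import Data.Nat.Divisibility using (_∣_; _∣?_; divides; ∣-trans; ∣n⇒∣m*n; m∣m*n; *-cancelˡ-∣; *-monoʳ-∣; >⇒∤; ∣m+n∣m⇒∣n)
  open import Data.Nat.DivMod using (_%_; [m+n]%n≡m%n)
  open import Data.Nat.Primality using (Prime; euclidsLemma; prime⇒nonZero; prime⇒irreducible; ¬prime[1])
  open import Data.Nat.Primality.Factorisation using (factorise; PrimeFactorisation)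
  open import Data.Nat.Induction using (<-rec)
  open import Data.Nat.ListAction using (product)
  open import Data.Nat.Tactic.RingSolver using (solve-∀)
  open import Data.Integer as ℤ using (ℤ; +_; -[1+_]; ∣_∣)
  import Data.Integer.Properties as ℤP
  import Data.Integer.Tactic.RingSolver as ℤSolver
  open import Data.List using ([]; _∷_)
  open import Data.List.Relation.Unary.All using ([]; _∷_)
  open import Data.Product using (_×_; _,_; ∃-syntax; proj₁; proj₂)
  open import Data.Sum using (_⊎_; inj₁; inj₂; [_,_]′)
  open import Data.Empty using (⊥-elim)
  open import Data.Bool using (if_then_else_)
  open import Relation.Nullary using (¬_; Dec; yes; no; does)
  open import Relation.Nullary.Decidable using (dec-true; dec-false)
  open import Relation.Binary.PropositionalEquality using (_≡_; _≢_; refl; sym; trans; cong; cong₂; subst; module ≡-Reasoning)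

  χ : ℕ → ℤ
  χ 0 = + 0
  χ 1 = + 1
  χ 2 = -[1+ 0 ]
  χ (suc (suc (suc n))) = χ n

  χ-periodic : ∀ b n → χ (b + (b + (b + n))) ≡ χ n
  χ-periodic zero    n = refl
  χ-periodic (suc b) n = trans (cong χ (lemma b n)) (χ-periodic b n)
    where
    lemma : ∀ b n → suc b + (suc b + (suc b + n)) ≡ suc (suc (suc (b + (b + (b + n)))))
    lemma = solve-∀

  χ-double : ∀ b → χ (b + b) ≡ ℤ.- χ b
  χ-double 0 = refl
  χ-double 1 = refl
  χ-double 2 = refl
  χ-double (suc (suc (suc b))) = trans (cong χ (lemma b)) (χ-double b)
    where
    lemma : ∀ b → suc (suc (suc b)) + suc (suc (suc b)) ≡ suc (suc (suc (suc (suc (suc (b + b))))))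
    lemma = solve-∀

  χ-* : ∀ a b → χ (a * b) ≡ χ a ℤ.* χ b
  χ-* 0 b = sym (ℤP.*-zeroˡ (χ b))
  χ-* 1 b = trans (cong χ (ℕP.+-identityʳ b)) (sym (ℤP.*-identityˡ (χ b)))
  χ-* 2 b = trans (cong (λ t → χ (b + t)) (ℕP.+-identityʳ b)) (trans (χ-double b) (sym (ℤP.-1*i≡-i (χ b))))
  χ-* (suc (suc (suc a))) b = trans (χ-periodic b (a * b)) (χ-* a b)

  χ-cases : ∀ n → χ n ≡ + 1 ⊎ χ n ≡ + 0 ⊎ χ n ≡ -[1+ 0 ]
  χ-cases 0 = inj₂ (inj₁ refl)
  χ-cases 1 = inj₁ refl
  χ-cases 2 = inj₂ (inj₂ refl)
  χ-cases (suc (suc (suc n))) = χ-cases n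

  χ≡-1⇒%3≡2 : ∀ n → χ n ≡ -[1+ 0 ] → n % 3 ≡ 2
  χ≡-1⇒%3≡2 2 _ = refl
  χ≡-1⇒%3≡2 (suc (suc (suc n))) h = trans (cong (_% 3) (ℕP.+-comm 3 n)) (trans ([m+n]%n≡m%n n 3) (χ≡-1⇒%3≡2 n h))

  δ : ℕ → ℕ → ℕ
  δ d n = if does (d ∣? n) then 1 else 0

  δ-yes : ∀ {d n} → d ∣ n → δ d n ≡ 1
  δ-yes {d} {n} h = cong (λ b → if b then 1 else 0) (dec-true (d ∣? n) h)

  δ-no : ∀ {d n} → ¬ (d ∣ n) → δ d n ≡ 0
  δ-no {d} {n} h = cong (λ b → if b then 1 else 0) (dec-false (d ∣? n) h)

  δ-cong : ∀ {d n d′ n′} → (d ∣ n → d′ ∣ n′) → (d′ ∣ n′ → d ∣ n) → δ d n ≡ δ d′ n′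
  δ-cong {d} {n} f g with d ∣? n
  ... | yes h = sym (δ-yes (f h))
  ... | no  h = sym (δ-no (λ h′ → h (g h′)))

  Σℤ : (ℕ → ℤ) → ℕ → ℤ
  Σℤ f zero    = + 0
  Σℤ f (suc n) = Σℤ f n ℤ.+ f n

  Σℤ-cong : ∀ {f g} n → (∀ i → i < n → f i ≡ g i) → Σℤ f n ≡ Σℤ g n
  Σℤ-cong zero    h = refl
  Σℤ-cong (suc n) h = cong₂ ℤ._+_ (Σℤ-cong n (λ i l → h i (ℕP.m≤n⇒m≤1+n l))) (h n ℕP.≤-refl)

  Σℤ-+ : ∀ f g n → Σℤ (λ i → f i ℤ.+ g i) n ≡ Σℤ f n ℤ.+ Σℤ g n
  Σℤ-+ f g zero    = refl
  Σℤ-+ f g (suc n) = trans (cong (ℤ._+ (f n ℤ.+ g n)) (Σℤ-+ f g n)) (lemma (Σℤ f n) (Σℤ g n) (f n) (g n))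
    where
    lemma : ∀ a b c d → a ℤ.+ b ℤ.+ (c ℤ.+ d) ≡ a ℤ.+ c ℤ.+ (b ℤ.+ d)
    lemma = ℤSolver.solve-∀

  Σℤ-* : ∀ c f n → Σℤ (λ i → c ℤ.* f i) n ≡ c ℤ.* Σℤ f n
  Σℤ-* c f zero    = sym (ℤP.*-zeroʳ c)
  Σℤ-* c f (suc n) = trans (cong (ℤ._+ c ℤ.* f n) (Σℤ-* c f n)) (sym (ℤP.*-distribˡ-+ c (Σℤ f n) (f n)))

  Σℤ-zero : ∀ n → Σℤ (λ _ → + 0) n ≡ + 0
  Σℤ-zero zero    = refl
  Σℤ-zero (suc n) = trans (ℤP.+-identityʳ _) (Σℤ-zero n)

  Σℤ-swap : ∀ (f : ℕ → ℕ → ℤ) n k → Σℤ (λ i → Σℤ (f i) k) n ≡ Σℤ (λ j → Σℤ (λ i → f i j) n) k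
  Σℤ-swap f zero    k = sym (Σℤ-zero k)
  Σℤ-swap f (suc n) k = trans (cong (ℤ._+ Σℤ (f n) k) (Σℤ-swap f n k)) (sym (Σℤ-+ (λ j → Σℤ (λ i → f i j) n) (f n) k))

  Σℤ-pos : ∀ f n → Σℤ (λ i → + f i) n ≡ + Σℕ f n
  Σℤ-pos f zero    = refl
  Σℤ-pos f (suc n) = trans (cong (ℤ._+ + f n) (Σℤ-pos f n)) (sym (ℤP.pos-+ (Σℕ f n) (f n)))

  Σℤ-extend : ∀ f {m n} → m ≤ n → (∀ i → m ≤ i → f i ≡ + 0) → Σℤ f n ≡ Σℤ f m
  Σℤ-extend f {m} {n} m≤n h = subst (λ t → Σℤ f t ≡ Σℤ f m) (ℕP.m∸n+n≡m m≤n) (go (n ℕ.∸ m))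
    where
    go : ∀ d → Σℤ f (d + m) ≡ Σℤ f m
    go zero    = refl
    go (suc d) = trans (cong₂ ℤ._+_ (go d) (h (d + m) (ℕP.m≤n+m m d))) (ℤP.+-identityʳ _)

  -- A sum over 1 ≤ d ≤ p N whose terms vanish unless p ∣ d is a sum over d = p d′ with 1 ≤ d′ ≤ N.
  sum-over-multiples : {A : Set} (_∙_ : A → A → A) (ε : A) → (∀ x → x ∙ ε ≡ x) →
    (S T f : ℕ → A) → (∀ n → S (suc n) ≡ S n ∙ f (suc n)) →
    (p : ℕ) → .{{NonZero p}} → (∀ d → ¬ (p ∣ d) → f d ≡ ε) →
    S 0 ≡ T 0 → (∀ n → T (suc n) ≡ T n ∙ f (p * suc n)) → ∀ N → S (p * N) ≡ T N
  sum-over-multiples _∙_ ε identityʳ S T f S-suc p@(suc p′) vanish S0 T-suc = go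
    where
    gap : ∀ N j → j ≤ p′ → S (p * N + j) ≡ S (p * N)
    gap N zero    _ = cong S (ℕP.+-identityʳ (p * N))
    gap N (suc j) l = trans (cong S (ℕP.+-suc (p * N) j)) (trans (S-suc (p * N + j))
      (trans (cong₂ _∙_ (gap N j (ℕP.<⇒≤ l)) (vanish _ p∤)) (identityʳ _)))
      where
      p∤ : ¬ (p ∣ suc (p * N + j))
      p∤ h = >⇒∤ (s≤s l) (∣m+n∣m⇒∣n (subst (p ∣_) (sym (ℕP.+-suc (p * N) j)) h) (m∣m*n N))
    go : ∀ N → S (p * N) ≡ T N
    go zero    = trans (cong S (ℕP.*-zeroʳ p)) S0
    go (suc N) = begin
      S (p * suc N)                        ≡⟨ cong S last ⟩
      S (suc (p * N + p′))                 ≡⟨ S-suc (p * N + p′) ⟩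
      S (p * N + p′) ∙ f (suc (p * N + p′)) ≡⟨ cong₂ _∙_ (trans (gap N p′ ℕP.≤-refl) (go N)) (cong f (sym last)) ⟩
      T N ∙ f (p * suc N)                  ≡⟨ T-suc N ⟨
      T (suc N)                            ∎
      where
      open ≡-Reasoning
      last : p * suc N ≡ suc (p * N + p′)
      last = trans (ℕP.*-suc p N) (trans (ℕP.+-comm p (p * N)) (ℕP.+-suc (p * N) p′))

  -- The range of d is a separate bound, because interchanging the sums over m and d requires a
  -- range independent of m.
  r-upTo : ℕ → ℕ → ℤ
  r-upTo B m = Σℤ (λ i → χ (suc i) ℤ.* + δ (suc i) m) B

  -- r m = Σ_{d ∣ m} χ(d)
  r : ℕ → ℤ
  r m = r-upTo m m

  r-upTo-≥ : ∀ {B m} → 0 < m → m ≤ B → r-upTo B m ≡ r m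
  r-upTo-≥ {B} {m} m>0 m≤B = Σℤ-extend _ m≤B λ i m≤i →
    trans (cong (λ t → χ (suc i) ℤ.* + t) (δ-no (>⇒∤ {{ℕ.>-nonZero m>0}} (s≤s m≤i)))) (ℤP.*-zeroʳ (χ (suc i)))

  remove-prime : ∀ {p d} → Prime p → ¬ (p ∣ d) → ∀ {x} → d ∣ p * x → d ∣ x
  remove-prime {p} {d} pp p∤d {x} (divides q eq) with euclidsLemma q d pp (subst (p ∣_) eq (m∣m*n x))
  ... | inj₂ p∣d = ⊥-elim (p∤d p∣d)
  ... | inj₁ (divides q′ refl) = divides q′ (ℕP.*-cancelˡ-≡ x (q′ * d) p {{prime⇒nonZero pp}} (trans eq (lemma q′ p d)))
    where
    lemma : ∀ q p d → q * p * d ≡ p * (q * d)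
    lemma = solve-∀

  remove-prime-power : ∀ {p d} → Prime p → ¬ (p ∣ d) → ∀ e {x} → d ∣ p ^ e * x → d ∣ x
  remove-prime-power {d = d} pp p∤d zero {x} h = subst (d ∣_) (ℕP.*-identityˡ x) h
  remove-prime-power {p} {d} pp p∤d (suc e) {x} h =
    remove-prime-power pp p∤d e (remove-prime pp p∤d (subst (d ∣_) (ℕP.*-assoc p (p ^ e) x) h))

  -- The divisors of p^(e+1) n that are multiples of p are p times the divisors of p^e n; the
  -- remaining ones are the divisors of n.
  r-prime-power-suc : ∀ {p n} → Prime p → 0 < n → ¬ (p ∣ n) → ∀ e →
    r (p ^ suc e * n) ≡ χ p ℤ.* r (p ^ e * n) ℤ.+ r n
  r-prime-power-suc {p} {n} pp n>0 p∤n e = begin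
    r (p ^ suc e * n)                                ≡⟨ cong r (ℕP.*-assoc p (p ^ e) n) ⟩
    r (p * N)                                        ≡⟨ Σℤ-cong (p * N) (λ i _ → split (suc i)) ⟩
    Σℤ (λ i → F (suc i) ℤ.+ χ (suc i) ℤ.* + δ (suc i) n) (p * N)
                                                     ≡⟨ Σℤ-+ (λ i → F (suc i)) (λ i → χ (suc i) ℤ.* + δ (suc i) n) (p * N) ⟩
    Σℤ (λ i → F (suc i)) (p * N) ℤ.+ r-upTo (p * N) n
      ≡⟨ cong₂ ℤ._+_ (sum-over-multiples ℤ._+_ (+ 0) ℤP.+-identityʳ (Σℤ (λ i → F (suc i))) (Σℤ (λ j → F (p * suc j))) F
           (λ _ → refl) p (λ d p∤d → F-no p∤d) refl (λ _ → refl) N) (r-upTo-≥ n>0 n≤) ⟩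
    Σℤ (λ j → F (p * suc j)) N ℤ.+ r n               ≡⟨ cong (ℤ._+ r n) (trans (Σℤ-cong N (λ j _ → F-multiple (suc j))) (Σℤ-* (χ p) _ N)) ⟩
    χ p ℤ.* r N ℤ.+ r n                              ∎
    where
    open ≡-Reasoning
    instance
      p≢0 : NonZero p
      p≢0 = prime⇒nonZero pp
    N = p ^ e * n
    n≤ : n ≤ p * N
    n≤ = ℕP.≤-trans (ℕP.m≤n*m n (p ^ e) {{ℕP.m^n≢0 p e}}) (ℕP.m≤n*m N p)
    F : ℕ → ℤ
    F d = + δ p d ℤ.* (χ d ℤ.* + δ d (p * N))
    F-no : ∀ {d} → ¬ (p ∣ d) → F d ≡ + 0
    F-no {d} p∤d = trans (cong (λ t → + t ℤ.* (χ d ℤ.* + δ d (p * N))) (δ-no p∤d)) (ℤP.*-zeroˡ (χ d ℤ.* + δ d (p * N)))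
    F-yes : ∀ {d} → p ∣ d → F d ≡ χ d ℤ.* + δ d (p * N)
    F-yes {d} p∣d = trans (cong (λ t → + t ℤ.* (χ d ℤ.* + δ d (p * N))) (δ-yes p∣d)) (ℤP.*-identityˡ _)
    F-multiple : ∀ d → F (p * d) ≡ χ p ℤ.* (χ d ℤ.* + δ d N)
    F-multiple d = trans (F-yes (m∣m*n d)) (trans (cong₂ (λ u v → u ℤ.* + v) (χ-* p d) (δ-cong (*-cancelˡ-∣ p) (*-monoʳ-∣ p)))
      (ℤP.*-assoc (χ p) (χ d) _))
    split : ∀ d → χ d ℤ.* + δ d (p * N) ≡ F d ℤ.+ χ d ℤ.* + δ d n
    split d = go (p ∣? d)
      where
      go : Dec (p ∣ d) → χ d ℤ.* + δ d (p * N) ≡ F d ℤ.+ χ d ℤ.* + δ d n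
      go (yes p∣d) = sym (trans (cong₂ ℤ._+_ (F-yes p∣d) (trans (cong (λ t → χ d ℤ.* + t) (δ-no (λ d∣n → p∤n (∣-trans p∣d d∣n)))) (ℤP.*-zeroʳ (χ d)))) (ℤP.+-identityʳ _))
      go (no  p∤d) = sym (trans (cong₂ ℤ._+_ (F-no p∤d) (cong (λ t → χ d ℤ.* + t) (δ-cong (λ d∣n → ∣n⇒∣m*n p (∣n⇒∣m*n (p ^ e) d∣n))
        (λ h → remove-prime-power pp p∤d e (remove-prime pp p∤d h))))) (ℤP.+-identityˡ _))

  -- The sum 1 + c + ... + c^e; for c = χ(p) it is the local factor of r at p^e.
  geometric : ℤ → ℕ → ℤ
  geometric c zero    = + 1
  geometric c (suc e) = c ℤ.* geometric c e ℤ.+ + 1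

  r-prime-power : ∀ {p n} → Prime p → 0 < n → ¬ (p ∣ n) → ∀ e → r (p ^ e * n) ≡ geometric (χ p) e ℤ.* r n
  r-prime-power {p} {n} pp n>0 p∤n zero    = trans (cong r (ℕP.*-identityˡ n)) (sym (ℤP.*-identityˡ (r n)))
  r-prime-power {p} {n} pp n>0 p∤n (suc e) = trans (r-prime-power-suc pp n>0 p∤n e)
    (trans (cong (λ t → χ p ℤ.* t ℤ.+ r n) (r-prime-power pp n>0 p∤n e)) (lemma (χ p) (geometric (χ p) e) (r n)))
    where
    lemma : ∀ c g r → c ℤ.* (g ℤ.* r) ℤ.+ r ≡ (c ℤ.* g ℤ.+ + 1) ℤ.* r
    lemma = ℤSolver.solve-∀

  geometric-1 : ∀ e → geometric (+ 1) e ≡ + suc e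
  geometric-1 zero    = refl
  geometric-1 (suc e) = trans (cong (λ t → + 1 ℤ.* t ℤ.+ + 1) (geometric-1 e)) (trans (cong (ℤ._+ + 1) (ℤP.*-identityˡ (+ suc e))) (cong +_ (ℕP.+-comm (suc e) 1)))

  geometric-0 : ∀ e → geometric (+ 0) e ≡ + 1
  geometric-0 zero    = refl
  geometric-0 (suc e) = cong (ℤ._+ + 1) (ℤP.*-zeroˡ (geometric (+ 0) e))

  geometric--1 : ∀ e → (∃[ k ] e ≡ 2 * k × geometric -[1+ 0 ] e ≡ + 1) ⊎ (∃[ k ] e ≡ suc (2 * k) × geometric -[1+ 0 ] e ≡ + 0)
  geometric--1 zero = inj₁ (0 , refl , refl)
  geometric--1 (suc e) with geometric--1 e
  ... | inj₁ (k , e≡ , g≡) = inj₂ (k , cong suc e≡ , cong (λ t → -[1+ 0 ] ℤ.* t ℤ.+ + 1) g≡)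
  ... | inj₂ (k , e≡ , g≡) = inj₁ (suc k , trans (cong suc e≡) (lemma k) , cong (λ t → -[1+ 0 ] ℤ.* t ℤ.+ + 1) g≡)
    where
    lemma : ∀ k → suc (suc (2 * k)) ≡ 2 * suc k
    lemma = solve-∀

  -- For m > 0: every prime p ≡ 2 (mod 3), which is inert in the field of cube roots of unity, has
  -- even exponent in m. Divisibility by powers takes the place of a valuation.
  EvenAtInertPrimes : ℕ → Set
  EvenAtInertPrimes m = ∀ p → Prime p → p % 3 ≡ 2 → ∀ k → p ^ suc (2 * k) ∣ m → p ^ suc (suc (2 * k)) ∣ m

  prime∣power : ∀ {p q} → Prime p → ∀ e → p ∣ q ^ e → p ∣ q
  prime∣power pp zero h = ⊥-elim (prime∤1 pp h)
  prime∣power {p} {q} pp (suc e) h = [ (λ z → z) , prime∣power pp e ]′ (euclidsLemma q (q ^ e) pp h)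

  prime∣prime : ∀ {p q} → Prime p → Prime q → p ∣ q → p ≡ q
  prime∣prime pp pq p∣q = [ (λ { refl → ⊥-elim (¬prime[1] pp) }) , (λ z → z) ]′ (prime⇒irreducible pq p∣q)

  power-∤ : ∀ {p n} → Prime p → ¬ (p ∣ n) → ∀ e → ¬ (p ^ suc e ∣ p ^ e * n)
  power-∤ {p} {n} pp p∤n e h = p∤n (*-cancelˡ-∣ (p ^ e) {{ℕP.m^n≢0 p e {{prime⇒nonZero pp}}}} (subst (_∣ p ^ e * n) (ℕP.*-comm p (p ^ e)) h))

  EvenAtInertPrimes-cofactor : ∀ {p n} → Prime p → ¬ (p ∣ n) → ∀ e → EvenAtInertPrimes (p ^ e * n) → EvenAtInertPrimes n
  EvenAtInertPrimes-cofactor {p} {n} pp p∤n e h q pq q%3 k q∣n with p ℕ.≟ q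
  ... | yes refl = ⊥-elim (p∤n (∣-trans (m∣m*n (p ^ (2 * k))) q∣n))
  ... | no  p≢q  = prime-power-cancel pq (λ q∣p^e → p≢q (sym (prime∣prime pq pp (prime∣power pq e q∣p^e)))) (suc (suc (2 * k)))
    (h q pq q%3 k (∣n⇒∣m*n (p ^ e) q∣n))

  p-part : ∀ {p} → Prime p → ∀ n → 0 < n → ∃[ e ] ∃[ n′ ] n ≡ p ^ e * n′ × ¬ (p ∣ n′)
  p-part {p} pp = <-rec _ step
    where
    step : ∀ n → (∀ {m} → m < n → 0 < m → ∃[ e ] ∃[ n′ ] m ≡ p ^ e * n′ × ¬ (p ∣ n′)) → 0 < n → ∃[ e ] ∃[ n′ ] n ≡ p ^ e * n′ × ¬ (p ∣ n′)
    step n rec n>0 with p ∣? n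
    ... | no p∤n = 0 , n , sym (ℕP.*-identityˡ n) , p∤n
    ... | yes (divides (suc q) refl) =
      let e , n′ , eq , p∤n′ = rec {suc q} (ℕP.m<m*n (suc q) p (prime>1 pp)) (s≤s z≤n)
      in suc e , n′ , trans (ℕP.*-comm (suc q) p) (trans (cong (p *_) eq) (sym (ℕP.*-assoc p (p ^ e) n′))) , p∤n′

  prime-divisor : ∀ n → 1 < n → ∃[ p ] Prime p × p ∣ n
  prime-divisor n n>1 = go (factorise n {{ℕ.>-nonZero (ℕP.<⇒≤ n>1)}})
    where
    go : PrimeFactorisation n → ∃[ p ] Prime p × p ∣ n
    go record { factors = [] ; isFactorisation = eq } = ⊥-elim (ℕP.<⇒≢ n>1 (sym eq))
    go record { factors = p ∷ ps ; isFactorisation = eq ; factorsPrime = pp ∷ _ } = p , pp , divides (product ps) (trans eq (ℕP.*-comm p _))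

  product-≥0 : ∀ {a b} → + 0 ℤ.≤ a → + 0 ℤ.≤ b → + 0 ℤ.≤ a ℤ.* b
  product-≥0 {+ a} {+ b} _ _ = subst (+ 0 ℤ.≤_) (ℤP.pos-* a b) (ℤ.+≤+ z≤n)

  product-≥1 : ∀ {a b} → + 1 ℤ.≤ a → + 1 ℤ.≤ b → + 1 ℤ.≤ a ℤ.* b
  product-≥1 {+ a} {+ b} (ℤ.+≤+ h) (ℤ.+≤+ k) = subst (+ 1 ℤ.≤_) (ℤP.pos-* a b) (ℤ.+≤+ (ℕP.*-mono-≤ h k))

  geometric-≥0 : ∀ p e → + 0 ℤ.≤ geometric (χ p) e
  geometric-≥0 p e = go (χ-cases p)
    where
    go : _ → + 0 ℤ.≤ geometric (χ p) e
    go (inj₁ χ≡)        = subst (λ c → + 0 ℤ.≤ geometric c e) (sym χ≡) (subst (+ 0 ℤ.≤_) (sym (geometric-1 e)) (ℤ.+≤+ z≤n))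
    go (inj₂ (inj₁ χ≡)) = subst (λ c → + 0 ℤ.≤ geometric c e) (sym χ≡) (subst (+ 0 ℤ.≤_) (sym (geometric-0 e)) (ℤ.+≤+ z≤n))
    go (inj₂ (inj₂ χ≡)) = subst (λ c → + 0 ℤ.≤ geometric c e) (sym χ≡)
      ([ (λ { (_ , _ , g≡) → subst (+ 0 ℤ.≤_) (sym g≡) (ℤ.+≤+ z≤n) }) , (λ { (_ , _ , g≡) → subst (+ 0 ℤ.≤_) (sym g≡) (ℤ.+≤+ z≤n) }) ]′ (geometric--1 e))

  geometric-≥1 : ∀ {p n} → Prime p → ¬ (p ∣ n) → ∀ e → EvenAtInertPrimes (p ^ e * n) → + 1 ℤ.≤ geometric (χ p) e
  geometric-≥1 {p} {n} pp p∤n e h = go (χ-cases p)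
    where
    go : _ → + 1 ℤ.≤ geometric (χ p) e
    go (inj₁ χ≡)        = subst (λ c → + 1 ℤ.≤ geometric c e) (sym χ≡) (subst (+ 1 ℤ.≤_) (sym (geometric-1 e)) (ℤ.+≤+ (s≤s z≤n)))
    go (inj₂ (inj₁ χ≡)) = subst (λ c → + 1 ℤ.≤ geometric c e) (sym χ≡) (subst (+ 1 ℤ.≤_) (sym (geometric-0 e)) (ℤ.+≤+ (s≤s z≤n)))
    go (inj₂ (inj₂ χ≡)) = subst (λ c → + 1 ℤ.≤ geometric c e) (sym χ≡)
      ([ (λ { (_ , _ , g≡) → subst (+ 1 ℤ.≤_) (sym g≡) (ℤ.+≤+ (s≤s z≤n)) })
       , (λ { (k , refl , _) → ⊥-elim (power-∤ pp p∤n (suc (2 * k)) (h p pp (χ≡-1⇒%3≡2 p χ≡) k (m∣m*n n))) }) ]′ (geometric--1 e))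

  -- Induction on m, splitting off the full power p^e of a prime divisor. The local factor is e + 1,
  -- 1, or, at inert primes, 1 or 0 according to the parity of e.
  r-positivity : ∀ m → 0 < m → (+ 0 ℤ.≤ r m) × (EvenAtInertPrimes m → + 1 ℤ.≤ r m)
  r-positivity = <-rec _ step
    where
    Claim : ℕ → Set
    Claim m = (+ 0 ℤ.≤ r m) × (EvenAtInertPrimes m → + 1 ℤ.≤ r m)
    split : ∀ {p} → Prime p → ∀ e n → 0 < n → ¬ (p ∣ n) → Claim n → Claim (p ^ e * n)
    split {p} pp e n n>0 p∤n (r≥0 , r≥1) =
      subst (+ 0 ℤ.≤_) (sym (r-prime-power pp n>0 p∤n e)) (product-≥0 (geometric-≥0 p e) r≥0) ,
      λ h → subst (+ 1 ℤ.≤_) (sym (r-prime-power pp n>0 p∤n e))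
        (product-≥1 (geometric-≥1 pp p∤n e h) (r≥1 (EvenAtInertPrimes-cofactor pp p∤n e h)))
    step : ∀ m → (∀ {n} → n < m → 0 < n → Claim n) → 0 < m → Claim m
    step m rec m>0 = go (1 ℕ.<? m)
      where
      go : Dec (1 < m) → Claim m
      go (no m≯1) = subst Claim (ℕP.≤-antisym m>0 (ℕP.≮⇒≥ m≯1)) (ℤ.+≤+ z≤n , λ _ → ℤ.+≤+ (s≤s z≤n))
      go (yes m>1) =
        let p , pp , p∣m = prime-divisor m m>1
            e , n , m≡ , p∤n = p-part pp m m>0
            n>0 = ℕP.n≢0⇒n>0 (λ n≡0 → ℕP.<⇒≢ m>0 (sym (trans m≡ (trans (cong (p ^ e *_) n≡0) (ℕP.*-zeroʳ (p ^ e))))))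
        in subst Claim (sym m≡) (split pp e n n>0 p∤n (rec (smaller pp p∣m e n>0 m≡ p∤n) n>0))
        where
        smaller : ∀ {p n} → Prime p → p ∣ m → ∀ e → 0 < n → m ≡ p ^ e * n → ¬ (p ∣ n) → n < m
        smaller {p} {n} pp p∣m zero    n>0 m≡ p∤n = ⊥-elim (p∤n (subst (p ∣_) (trans m≡ (ℕP.*-identityˡ n)) p∣m))
        smaller {p} {n} pp p∣m (suc e) n>0 m≡ p∤n = subst (n <_) (trans (ℕP.*-comm n (p ^ suc e)) (sym m≡))
          (ℕP.m<m*n n (p ^ suc e) {{ℕ.>-nonZero n>0}}
            (ℕP.<-≤-trans (prime>1 pp) (ℕP.m≤m*n p (p ^ e) {{ℕP.m^n≢0 p e {{prime⇒nonZero pp}}}})))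

  R : ℕ → ℕ
  R m = ∣ r m ∣

  r≡R : ∀ {m} → 0 < m → r m ≡ + R m
  r≡R {m} m>0 = sym (ℤP.0≤i⇒+∣i∣≡i (proj₁ (r-positivity m m>0)))

  R-positive : ∀ {m} → 0 < m → EvenAtInertPrimes m → 0 < R m
  R-positive {m} m>0 h = ℤP.drop‿+≤+ (subst (+ 1 ℤ.≤_) (r≡R m>0) (proj₂ (r-positivity m m>0) h))

  -- The local factor is 1 + χ(p), that is 2 or 0, and 0 contradicts positivity.
  R-double : ∀ {p n} → Prime p → χ p ≢ + 0 → 0 < n → ¬ (p ∣ n) → 0 < R (p * n) → R (p * n) ≡ 2 * R n
  R-double {p} {n} pp χ≢0 n>0 p∤n R>0 = go (χ-cases p)
    where
    r≡ : r (p * n) ≡ geometric (χ p) 1 ℤ.* r n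
    r≡ = trans (cong (λ t → r (t * n)) (sym (ℕP.*-identityʳ p))) (r-prime-power pp n>0 p∤n 1)
    go : _ → R (p * n) ≡ 2 * R n
    go (inj₁ χ≡)        = trans (cong ∣_∣ (trans r≡ (cong (λ c → geometric c 1 ℤ.* r n) χ≡))) (ℤP.abs-* (+ 2) (r n))
    go (inj₂ (inj₁ χ≡)) = ⊥-elim (χ≢0 χ≡)
    go (inj₂ (inj₂ χ≡)) = ⊥-elim (ℕP.<⇒≢ R>0 (sym (cong ∣_∣ (trans r≡ (trans (cong (λ c → geometric c 1 ℤ.* r n) χ≡) (ℤP.*-zeroˡ (r n)))))))

  -- The mean value of r.

  multiples-count : ℕ → ℕ → ℕ
  multiples-count x d = Σℕ (λ i → δ d (suc i)) x

  -- The two bounds together identify `multiples-count x d` with ⌊x/d⌋.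
  multiples-count-bounds : ∀ x d → 0 < d → d * multiples-count x d ≤ x × x < d * suc (multiples-count x d)
  multiples-count-bounds zero    d d>0 = ℕP.≤-reflexive (ℕP.*-zeroʳ d) , subst (0 <_) (sym (ℕP.*-identityʳ d)) d>0
  multiples-count-bounds (suc x) d d>0 = go (multiples-count-bounds x d d>0) (d ∣? suc x)
    where
    c = multiples-count x d
    go : d * c ≤ x × x < d * suc c → Dec (d ∣ suc x) → d * multiples-count (suc x) d ≤ suc x × suc x < d * suc (multiples-count (suc x) d)
    go (lo , hi) (yes (divides q eq)) =
      subst (λ t → d * (c + t) ≤ suc x) (sym (δ-yes (divides q eq))) (subst (d * (c + 1) ≤_) (trans (ℕP.*-comm d q) (sym eq))
        (ℕP.*-monoʳ-≤ d (subst (_≤ q) (ℕP.+-comm 1 c) (ℕP.*-cancelˡ-< d c q (subst (d * c <_) (trans eq (ℕP.*-comm q d)) (s≤s lo)))))) ,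
      subst (λ t → suc x < d * suc (c + t)) (sym (δ-yes (divides q eq))) (ℕP.<-≤-trans (s≤s hi)
        (subst (λ t → suc (d * suc c) ≤ d * suc t) (ℕP.+-comm 1 c) (subst (suc (d * suc c) ≤_) (sym (ℕP.*-suc d (suc c))) (ℕP.+-monoˡ-≤ (d * suc c) d>0))))
    go (lo , hi) (no d∤) =
      subst (λ t → d * t ≤ suc x) (sym (trans (cong (c ℕ.+_) (δ-no d∤)) (ℕP.+-identityʳ c))) (ℕP.m≤n⇒m≤1+n lo) ,
      subst (λ t → suc x < d * suc t) (sym (trans (cong (c ℕ.+_) (δ-no d∤)) (ℕP.+-identityʳ c)))
        (ℕP.≤∧≢⇒< hi (λ eq → d∤ (divides (suc c) (trans eq (ℕP.*-comm d (suc c))))))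

  multiples-count-antitone : ∀ x d → 0 < d → multiples-count x (suc d) ≤ multiples-count x d
  multiples-count-antitone x d d>0 = ℕP.≤-pred (ℕP.*-cancelˡ-< d (multiples-count x (suc d)) (suc (multiples-count x d))
    (ℕP.≤-<-trans (ℕP.*-monoˡ-≤ (multiples-count x (suc d)) (ℕP.n≤1+n d))
      (ℕP.≤-<-trans (proj₁ (multiples-count-bounds x (suc d) (s≤s z≤n))) (proj₂ (multiples-count-bounds x d d>0)))))

  -- An alternating sum of a decreasing sequence is at most its first term.
  χ-sum-≤ : ∀ (g : ℕ → ℕ) → (∀ d → 0 < d → g (suc d) ≤ g d) → ∀ j →
    Σℤ (λ i → χ (suc i) ℤ.* + g (suc i)) (suc (j * 3)) ℤ.≤ + g 1
  χ-sum-≤ g anti zero    = ℤP.≤-reflexive (trans (ℤP.+-identityˡ _) (ℤP.*-identityˡ _))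
  χ-sum-≤ g anti (suc j) = begin
    -- The block d = 3j + 2, 3j + 3, 3j + 4 carries the signs -1, 0, 1, so it contributes at most 0.
    T ℤ.+ t 1 ℤ.+ t 2 ℤ.+ t 3
      ≡⟨ cong₂ ℤ._+_ (cong₂ ℤ._+_ (cong (ℤ._+_ T) (value (χ-at j 2) 1)) (value (χ-at j 0) 2)) (value (χ-at j 1) 3) ⟩
    T ℤ.+ -[1+ 0 ] ℤ.* + u ℤ.+ + 0 ℤ.* + v ℤ.+ + 1 ℤ.* + w
      ≡⟨ rearrange T (+ u) (+ v) (+ w) ⟩
    T ℤ.+ + w ℤ.- + u
      ≤⟨ ℤP.+-monoˡ-≤ (ℤ.- + u) (ℤP.+-monoʳ-≤ T (ℤ.+≤+ (ℕP.≤-trans (anti (3 + j * 3) (s≤s z≤n)) (anti (2 + j * 3) (s≤s z≤n))))) ⟩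
    T ℤ.+ + u ℤ.- + u
      ≡⟨ cancel T (+ u) ⟩
    T
      ≤⟨ χ-sum-≤ g anti j ⟩
    + g 1 ∎
    where
    open ℤP.≤-Reasoning
    T = Σℤ (λ i → χ (suc i) ℤ.* + g (suc i)) (suc (j * 3))
    t : ℕ → ℤ
    t k = χ (suc (k + j * 3)) ℤ.* + g (suc (k + j * 3))
    u = g (2 + j * 3)
    v = g (3 + j * 3)
    w = g (4 + j * 3)
    χ-at : ∀ j k → χ (k + j * 3) ≡ χ k
    χ-at zero    k = cong χ (ℕP.+-identityʳ k)
    χ-at (suc j) k = trans (cong χ (shift k (j * 3))) (χ-at j k)
      where
      shift : ∀ k x → k + suc (suc (suc x)) ≡ suc (suc (suc (k + x)))
      shift = solve-∀
    value : ∀ {a b} → a ≡ b → ∀ k → a ℤ.* + g (suc (k + j * 3)) ≡ b ℤ.* + g (suc (k + j * 3))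
    value eq k = cong (ℤ._* + g (suc (k + j * 3))) eq
    rearrange : ∀ T u v w → T ℤ.+ -[1+ 0 ] ℤ.* u ℤ.+ + 0 ℤ.* v ℤ.+ + 1 ℤ.* w ≡ T ℤ.+ w ℤ.- u
    rearrange = ℤSolver.solve-∀
    cancel : ∀ T u → T ℤ.+ u ℤ.- u ≡ T
    cancel = ℤSolver.solve-∀

  R-sum : ∀ x → Σℕ (λ i → R (suc i)) x ≤ x
  R-sum x = ℤP.drop‿+≤+ (begin
    + Σℕ (λ i → R (suc i)) x                                  ≡⟨ Σℤ-pos _ x ⟨
    Σℤ (λ i → + R (suc i)) x                                  ≡⟨ Σℤ-cong x (λ i i<x → trans (sym (r≡R {suc i} (s≤s z≤n))) (sym (r-upTo-≥ {B} {suc i} (s≤s z≤n) (ℕP.≤-trans i<x (ℕP.m≤n⇒m≤1+n (ℕP.m≤m*n x 3)))))) ⟩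
    Σℤ (λ i → Σℤ (λ j → χ (suc j) ℤ.* + δ (suc j) (suc i)) B) x ≡⟨ Σℤ-swap (λ i j → χ (suc j) ℤ.* + δ (suc j) (suc i)) x B ⟩
    Σℤ (λ j → Σℤ (λ i → χ (suc j) ℤ.* + δ (suc j) (suc i)) x) B ≡⟨ Σℤ-cong B (λ j _ → trans (Σℤ-* (χ (suc j)) _ x) (cong (χ (suc j) ℤ.*_) (Σℤ-pos _ x))) ⟩
    Σℤ (λ j → χ (suc j) ℤ.* + multiples-count x (suc j)) B    ≤⟨ χ-sum-≤ (multiples-count x) (multiples-count-antitone x) x ⟩
    + multiples-count x 1                                     ≤⟨ ℤ.+≤+ (subst (_≤ x) (ℕP.*-identityˡ _) (proj₁ (multiples-count-bounds x 1 (s≤s z≤n)))) ⟩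
    + x                                                       ∎)
    where
    open ℤP.≤-Reasoning
    -- A range for d of the length that `χ-sum-≤` treats, and long enough to contain all divisors of
    -- every m ≤ x.
    B = suc (x * 3)

-- Euler's theorem that Σ 1/p diverges, without fractions.

module EulerProduct where

  open Sums
  open QuadraticForm
  open DivisorCharacterSum
  open import Data.Nat as ℕ using (ℕ; zero; suc; _≤_; _<_; z≤n; s≤s; _+_; _*_; _^_; _/_; NonZero; pred)
  import Data.Nat.Properties as ℕP
  open import Data.Nat.Divisibility using (_∣_; _∣?_; divides; ∣-refl; ∣⇒≤; m∣m*n; ∣n⇒∣m*n; ∣m∣n⇒∣m+n)
  open import Data.Nat.DivMod using (m/n*n≤m; m/n/o≡m/[n*o]; n/1≡n; m*n/n≡m; /-monoʳ-≤)
  open import Data.Nat.Primality using (Prime; prime?; prime⇒nonZero)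
  open import Data.Nat.Tactic.RingSolver using (solve-∀)
  open import Data.Integer using (0ℤ)
  open import Data.List using (List; []; _∷_)
  open import Data.List.Membership.Propositional using (_∈_)
  open import Data.List.Membership.DecPropositional ℕ._≟_ using (_∈?_)
  open import Data.List.Relation.Unary.Any using (here; there)
  open import Data.List.Relation.Unary.All as All using (All; []; _∷_)
  open import Data.List.Relation.Unary.AllPairs using ([]; _∷_)
  open import Data.List.Relation.Unary.Unique.Propositional using (Unique)
  open import Data.Product using (_×_; _,_; ∃-syntax; proj₁)
  open import Data.Empty using (⊥-elim)
  open import Data.Bool using (if_then_else_)
  open import Relation.Nullary using (¬_; Dec; yes; no; does)
  open import Relation.Nullary.Decidable using (map′; _→-dec_; dec-true; dec-false; toWitness)
  open import Relation.Binary.PropositionalEquality using (_≡_; _≢_; refl; sym; trans; cong; subst; module ≡-Reasoning)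

  Smooth : List ℕ → ℕ → Set
  Smooth T n = ∀ p → Prime p → p ∣ n → p ∈ T

  smooth? : ∀ T n → 0 < n → Dec (Smooth T n)
  smooth? T n n>0 = map′
    (λ h p pp p∣n → h {p} (s≤s (∣⇒≤ {{ℕ.>-nonZero n>0}} p∣n)) pp p∣n)
    (λ h {p} _ → h p)
    (ℕP.allUpTo? (λ p → prime? p →-dec (p ∣? n →-dec (p ∈? T))) (suc n))

  smooth : List ℕ → ℕ → ℕ
  smooth T zero    = 0
  smooth T (suc n) = if does (smooth? T (suc n) (s≤s z≤n)) then 1 else 0

  smooth-yes : ∀ {T n} → 0 < n → Smooth T n → smooth T n ≡ 1
  smooth-yes {T} {suc n} _ h = cong (λ b → if b then 1 else 0) (dec-true (smooth? T (suc n) (s≤s z≤n)) h)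

  smooth-no : ∀ {T n} → ¬ Smooth T n → smooth T n ≡ 0
  smooth-no {T} {zero}  _ = refl
  smooth-no {T} {suc n} h = cong (λ b → if b then 1 else 0) (dec-false (smooth? T (suc n) (s≤s z≤n)) h)

  smooth-mono : ∀ {T n T′ n′} → 0 < n′ → (Smooth T n → Smooth T′ n′) → smooth T n ≤ smooth T′ n′
  smooth-mono {T} {zero}  _ _ = z≤n
  smooth-mono {T} {suc n} {T′} {n′} n′>0 f = go (smooth? T (suc n) (s≤s z≤n))
    where
    go : Dec (Smooth T (suc n)) → smooth T (suc n) ≤ smooth T′ n′
    go (yes h) = ℕP.≤-reflexive (trans (smooth-yes {T} (s≤s z≤n) h) (sym (smooth-yes {T′} n′>0 (f h))))
    go (no h)  = subst (_≤ smooth T′ n′) (sym (smooth-no {T} h)) z≤n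

  smooth-cons : ∀ p T n → 0 < n → smooth (p ∷ T) n ≤ smooth T n + δ p n * smooth (p ∷ T) n
  smooth-cons p T n n>0 = go (p ∣? n)
    where
    go : Dec (p ∣ n) → smooth (p ∷ T) n ≤ smooth T n + δ p n * smooth (p ∷ T) n
    go (yes p∣n) = subst (λ t → smooth (p ∷ T) n ≤ smooth T n + t * smooth (p ∷ T) n) (sym (δ-yes p∣n))
      (subst (λ t → smooth (p ∷ T) n ≤ smooth T n + t) (sym (ℕP.*-identityˡ _)) (ℕP.m≤n+m _ (smooth T n)))
    go (no p∤n) = ℕP.≤-trans (smooth-mono {p ∷ T} {n} n>0 (λ h q pq q∣n → tail q q∣n (h q pq q∣n))) (ℕP.m≤m+n _ _)
      where
      tail : ∀ q → q ∣ n → q ∈ p ∷ T → q ∈ T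
      tail q q∣n (here refl) = ⊥-elim (p∤n q∣n)
      tail q q∣n (there q∈T) = q∈T

  ∏ : (ℕ → ℕ) → List ℕ → ℕ
  ∏ f []      = 1
  ∏ f (p ∷ T) = f p * ∏ f T

  ∏-positive : ∀ f {T} → All (λ p → 0 < f p) T → 0 < ∏ f T
  ∏-positive f []       = s≤s z≤n
  ∏-positive f (h ∷ hs) = ℕP.*-mono-≤ h (∏-positive f hs)

  -- The function w stands for a multiple L/n of 1/n rounded down, and `w-scale` is what survives of
  -- L/(pn) = (L/n)/p. The aim is Euler's bound of Σ 1/n over smooth n by ∏ 1/(1 - 1/p).
  module _ (w : ℕ → ℕ) (w-scale : ∀ p n → p * w (p * n) ≤ w n) (N : ℕ) where

    smoothSum : List ℕ → ℕ
    smoothSum T = Σℕ (λ i → smooth T (suc i) * w (suc i)) N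

    -- A smooth n for p ∷ T is smooth for T or is p times a smooth number. So the new sum S′
    -- satisfies S′ ≤ S + S′/p, that is (1 - 1/p) S′ ≤ S.
    smoothSum-cons : ∀ p T → .{{NonZero p}} → pred p * smoothSum (p ∷ T) ≤ p * smoothSum T
    smoothSum-cons p@(suc p′) T = ℕP.+-cancelʳ-≤ (smoothSum (p ∷ T)) _ _ (begin
      p′ * smoothSum (p ∷ T) + smoothSum (p ∷ T)   ≡⟨ ℕP.+-comm (p′ * smoothSum (p ∷ T)) _ ⟩
      p * smoothSum (p ∷ T)                        ≤⟨ ℕP.*-monoʳ-≤ p separate ⟩
      p * (smoothSum T + Σℕ (λ i → g (suc i)) N)   ≡⟨ ℕP.*-distribˡ-+ p (smoothSum T) (Σℕ (λ i → g (suc i)) N) ⟩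
      p * smoothSum T + p * Σℕ (λ i → g (suc i)) N ≤⟨ ℕP.+-monoʳ-≤ (p * smoothSum T) multiples ⟩
      p * smoothSum T + smoothSum (p ∷ T)          ∎)
      where
      open ℕP.≤-Reasoning
      h g : ℕ → ℕ
      h n = smooth (p ∷ T) n * w n
      g n = δ p n * h n
      separate : smoothSum (p ∷ T) ≤ smoothSum T + Σℕ (λ i → g (suc i)) N
      separate = ℕP.≤-trans (Σℕ-mono N (λ i _ → ℕP.≤-trans (ℕP.*-monoˡ-≤ (w (suc i)) (smooth-cons p T (suc i) (s≤s z≤n)))
        (ℕP.≤-reflexive (lemma (smooth T (suc i)) (δ p (suc i)) (smooth (p ∷ T) (suc i)) (w (suc i))))))
        (ℕP.≤-reflexive (Σℕ-+ (λ i → smooth T (suc i) * w (suc i)) (λ i → g (suc i)) N))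
        where
        lemma : ∀ a b c d → (a + b * c) * d ≡ a * d + b * (c * d)
        lemma = solve-∀
      multiples : p * Σℕ (λ i → g (suc i)) N ≤ smoothSum (p ∷ T)
      multiples = begin
        p * Σℕ (λ i → g (suc i)) N              ≤⟨ ℕP.*-monoʳ-≤ p (Σℕ-monoʳ (λ i → g (suc i)) (ℕP.m≤n*m N p)) ⟩
        p * Σℕ (λ i → g (suc i)) (p * N)        ≡⟨ cong (p *_) (sum-over-multiples _+_ 0 ℕP.+-identityʳ (Σℕ (λ i → g (suc i))) (Σℕ (λ j → g (p * suc j))) g
                                                     (λ _ → refl) p (λ d p∤d → cong (_* h d) (δ-no p∤d)) refl (λ _ → refl) N) ⟩
        p * Σℕ (λ j → g (p * suc j)) N          ≡⟨ Σℕ-* p (λ j → g (p * suc j)) N ⟨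
        Σℕ (λ j → p * g (p * suc j)) N          ≤⟨ Σℕ-mono N (λ j _ → term (suc j) (s≤s z≤n)) ⟩
        smoothSum (p ∷ T)                       ∎
        where
        rearrange : ∀ p s w → p * (1 * (s * w)) ≡ s * (p * w)
        rearrange = solve-∀
        term : ∀ n → 0 < n → p * g (p * n) ≤ h n
        term n n>0 = begin
          p * (δ p (p * n) * h (p * n))         ≡⟨ cong (λ t → p * (t * h (p * n))) (δ-yes {p} {p * n} (m∣m*n n)) ⟩
          p * (1 * h (p * n))                   ≡⟨ rearrange p (smooth (p ∷ T) (p * n)) (w (p * n)) ⟩
          smooth (p ∷ T) (p * n) * (p * w (p * n)) ≤⟨ ℕP.*-mono-≤ (smooth-mono {p ∷ T} {p * n} n>0 (λ s q pq q∣n → s q pq (∣n⇒∣m*n p q∣n))) (w-scale p n) ⟩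
          h n                                   ∎

    smoothSum-∏ : ∀ {T} → All Prime T → ∏ pred T * smoothSum T ≤ ∏ (λ p → p) T * smoothSum []
    smoothSum-∏ []       = ℕP.≤-refl
    smoothSum-∏ {p ∷ T} (pp ∷ ps) = begin
      pred p * ∏ pred T * smoothSum (p ∷ T)   ≡⟨ swap (pred p) (∏ pred T) (smoothSum (p ∷ T)) ⟩
      ∏ pred T * (pred p * smoothSum (p ∷ T)) ≤⟨ ℕP.*-monoʳ-≤ (∏ pred T) (smoothSum-cons p T {{prime⇒nonZero pp}}) ⟩
      ∏ pred T * (p * smoothSum T)            ≡⟨ swap′ (∏ pred T) p (smoothSum T) ⟩
      p * (∏ pred T * smoothSum T)            ≤⟨ ℕP.*-monoʳ-≤ p (smoothSum-∏ ps) ⟩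
      p * (∏ (λ p → p) T * smoothSum [])      ≡⟨ ℕP.*-assoc p _ _ ⟨
      p * ∏ (λ p → p) T * smoothSum []        ∎
      where
      open ℕP.≤-Reasoning
      swap : ∀ a b c → a * b * c ≡ b * (a * c)
      swap = solve-∀
      swap′ : ∀ a b c → a * (b * c) ≡ b * (a * c)
      swap′ = solve-∀

    smoothSum-all : ∀ {T} → (∀ n → 0 < n → n ≤ N → Smooth T n) → smoothSum T ≡ Σℕ (λ i → w (suc i)) N
    smoothSum-all {T} h = Σℕ-cong N λ i i<N →
      trans (cong (_* w (suc i)) (smooth-yes {T} {suc i} (s≤s z≤n) (h (suc i) (s≤s z≤n) i<N))) (ℕP.*-identityˡ _)

    smoothSum-[] : smoothSum [] ≤ w 1
    smoothSum-[] = go N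
      where
      only-1 : ∀ i → smooth [] (suc (suc i)) ≡ 0
      only-1 i = smooth-no {[]} (λ h → let p , pp , p∣n = prime-divisor (suc (suc i)) (s≤s (s≤s z≤n)) in absurd (h p pp p∣n))
        where
        absurd : ∀ {p : ℕ} {A : Set} → p ∈ [] → A
        absurd ()
      smooth-1 : smooth [] 1 ≤ 1
      smooth-1 = ℕP.≤-reflexive (smooth-yes {[]} {1} (s≤s z≤n) (λ p pp p∣1 → ⊥-elim (prime∤1 pp p∣1)))
      go : ∀ N → Σℕ (λ i → smooth [] (suc i) * w (suc i)) N ≤ w 1
      go zero    = z≤n
      go (suc N) = begin
        Σℕ (λ i → smooth [] (suc i) * w (suc i)) (suc N)  ≡⟨ Σℕ-head _ N ⟩
        smooth [] 1 * w 1 + Σℕ (λ i → smooth [] (2 + i) * w (2 + i)) N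
          ≡⟨ cong (smooth [] 1 * w 1 +_) (Σℕ-zero N (λ i _ → cong (_* w (2 + i)) (only-1 i))) ⟩
        smooth [] 1 * w 1 + 0                             ≡⟨ ℕP.+-identityʳ _ ⟩
        smooth [] 1 * w 1                                 ≤⟨ ℕP.*-monoˡ-≤ (w 1) smooth-1 ⟩
        1 * w 1                                           ≡⟨ ℕP.*-identityˡ (w 1) ⟩
        w 1                                               ∎
        where open ℕP.≤-Reasoning

  quotient : ℕ → ℕ → ℕ
  -- The default 0 makes `quotient-scale` true at n = 0, where it reads p w(0) ≤ w(0).
  quotient L zero    = 0
  quotient L (suc n) = L / suc n

  quotient-scale : ∀ L p n → p * quotient L (p * n) ≤ quotient L n
  quotient-scale L zero    n       = z≤n
  quotient-scale L p@(suc _) zero  = ℕP.≤-reflexive (trans (cong (λ t → p * quotient L t) (ℕP.*-zeroʳ p)) (ℕP.*-zeroʳ p))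
  quotient-scale L p@(suc _) n@(suc _) = begin
    p * (L / (p * n))   ≡⟨ ℕP.*-comm p (L / (p * n)) ⟩
    L / (p * n) * p     ≡⟨ cong (_* p) (trans (cong (quotient L) (ℕP.*-comm p n)) (sym (m/n/o≡m/[n*o] L n p))) ⟩
    L / n / p * p       ≤⟨ m/n*n≤m (L / n) p ⟩
    L / n               ∎
    where open ℕP.≤-Reasoning

  -- The classical bound 1 + 1/2 + ... + 1/2^j ≥ j/2, scaled by L = 2^(d+j): doubling the range from
  -- 2^j adds 2^j terms, each at least 1/2^(j+1). The free d keeps L fixed along the induction.
  harmonic-dyadic : ∀ d j → j * 2 ^ (d + j) ≤ 2 * Σℕ (λ i → quotient (2 ^ (d + j)) (suc i)) (2 ^ j)
  harmonic-dyadic d zero    = z≤n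
  harmonic-dyadic d (suc j) = begin
    L + j * L                                        ≡⟨ ℕP.+-comm L (j * L) ⟩
    j * L + L                                        ≤⟨ ℕP.+-mono-≤ (subst (λ t → j * 2 ^ t ≤ 2 * Σℕ (λ i → quotient (2 ^ t) (suc i)) (2 ^ j)) (sym (ℕP.+-suc d j)) (harmonic-dyadic (suc d) j))
                                                          (ℕP.≤-reflexive L≡) ⟩
    2 * Σℕ q (2 ^ j) + 2 * (2 ^ j * 2 ^ d)           ≡⟨ ℕP.*-distribˡ-+ 2 (Σℕ q (2 ^ j)) _ ⟨
    2 * (Σℕ q (2 ^ j) + 2 ^ j * 2 ^ d)               ≡⟨ cong (λ t → 2 * (Σℕ q (2 ^ j) + t)) (Σℕ-const (2 ^ d) (2 ^ j)) ⟨
    2 * (Σℕ q (2 ^ j) + Σℕ (λ _ → 2 ^ d) (2 ^ j))    ≤⟨ ℕP.*-monoʳ-≤ 2 (ℕP.+-monoʳ-≤ (Σℕ q (2 ^ j)) (Σℕ-mono (2 ^ j) (λ i i< → block i i<))) ⟩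
    2 * (Σℕ q (2 ^ j) + Σℕ (λ i → q (2 ^ j + i)) (2 ^ j)) ≡⟨ cong (2 *_) (Σℕ-append q (2 ^ j) (2 ^ j)) ⟨
    2 * Σℕ q (2 ^ j + 2 ^ j)                         ≡⟨ cong (λ t → 2 * Σℕ q (2 ^ j + t)) (ℕP.+-identityʳ (2 ^ j)) ⟨
    2 * Σℕ q (2 ^ suc j)                             ∎
    where
    open ℕP.≤-Reasoning
    L = 2 ^ (d + suc j)
    q : ℕ → ℕ
    q i = quotient L (suc i)
    L≡ : L ≡ 2 * (2 ^ j * 2 ^ d)
    L≡ = trans (ℕP.^-distribˡ-+-* 2 d (suc j)) (trans (ℕP.*-comm (2 ^ d) (2 ^ suc j)) (ℕP.*-assoc 2 (2 ^ j) (2 ^ d)))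
    block : ∀ i → i < 2 ^ j → 2 ^ d ≤ q (2 ^ j + i)
    block i i< = ℕP.≤-trans (ℕP.≤-reflexive (sym (trans (cong (λ t → (t / 2 ^ suc j) {{ne}}) (ℕP.^-distribˡ-+-* 2 d (suc j))) (m*n/n≡m (2 ^ d) (2 ^ suc j) {{ne}}))))
      (/-monoʳ-≤ L {{ne}} (subst (suc (2 ^ j + i) ≤_) (cong (2 ^ j +_) (sym (ℕP.+-identityʳ (2 ^ j)))) (ℕP.+-monoʳ-< (2 ^ j) i<)))
      where
      ne : NonZero (2 ^ suc j)
      ne = ℕP.m^n≢0 2 (suc j)

  χ≡0⇒3∣ : ∀ n → χ n ≡ 0ℤ → 3 ∣ n
  χ≡0⇒3∣ 0 _ = divides 0 refl
  χ≡0⇒3∣ (suc (suc (suc n))) h = ∣m∣n⇒∣m+n ∣-refl (χ≡0⇒3∣ n h)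

  prime-3 : Prime 3
  prime-3 = toWitness {a? = prime? 3} _

  χ-nonzero : ∀ {p} → Prime p → p ≢ 3 → χ p ≢ 0ℤ
  χ-nonzero pp p≢3 h = p≢3 (sym (prime∣prime prime-3 pp (χ≡0⇒3∣ _ h)))

  -- The prime 3 is left out because χ 3 = 0.
  primesBelow : ℕ → List ℕ
  primesBelow zero    = []
  primesBelow (suc n) with prime? n | n ℕ.≟ 3
  ... | yes _ | no _  = n ∷ primesBelow n
  ... | yes _ | yes _ = primesBelow n
  ... | no  _ | _     = primesBelow n

  primesBelow-spec : ∀ n → All (λ p → Prime p × p ≢ 3 × p < n) (primesBelow n)
  primesBelow-spec zero    = []
  primesBelow-spec (suc n) with prime? n | n ℕ.≟ 3
  ... | yes pn | no n≢3 = (pn , n≢3 , ℕP.≤-refl) ∷ All.map (λ { (a , b , c) → a , b , ℕP.m≤n⇒m≤1+n c }) (primesBelow-spec n)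
  ... | yes _  | yes _  = All.map (λ { (a , b , c) → a , b , ℕP.m≤n⇒m≤1+n c }) (primesBelow-spec n)
  ... | no  _  | _      = All.map (λ { (a , b , c) → a , b , ℕP.m≤n⇒m≤1+n c }) (primesBelow-spec n)

  primesBelow-unique : ∀ n → Unique (primesBelow n)
  primesBelow-unique zero    = []
  primesBelow-unique (suc n) with prime? n | n ℕ.≟ 3
  ... | yes _ | no _  = All.map (λ { (_ , _ , p<n) refl → ℕP.<-irrefl refl p<n }) (primesBelow-spec n) ∷ primesBelow-unique n
  ... | yes _ | yes _ = primesBelow-unique n
  ... | no  _ | _     = primesBelow-unique n

  primesBelow-complete : ∀ n {p} → Prime p → p ≢ 3 → p < n → p ∈ primesBelow n
  primesBelow-complete (suc n) {p} pp p≢3 (s≤s p≤n) with prime? n | n ℕ.≟ 3 | p ℕ.≟ n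
  ... | yes _  | no _     | yes p≡n  = here p≡n
  ... | yes _  | no _     | no p≢n   = there (primesBelow-complete n pp p≢3 (ℕP.≤∧≢⇒< p≤n p≢n))
  ... | yes _  | yes refl | yes refl = ⊥-elim (p≢3 refl)
  ... | yes _  | yes _    | no p≢n   = primesBelow-complete n pp p≢3 (ℕP.≤∧≢⇒< p≤n p≢n)
  ... | no ¬pn | _        | yes refl = ⊥-elim (¬pn pp)
  ... | no _   | _        | no p≢n   = primesBelow-complete n pp p≢3 (ℕP.≤∧≢⇒< p≤n p≢n)

  -- Σ 1/p diverges, in the form ∏ (1 - 1/p) → 0.
  euler-product : ∀ k → ∃[ T ] All (λ p → Prime p × χ p ≢ 0ℤ) T × Unique T × k * ∏ pred T ≤ 3 * ∏ (λ p → p) T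
  euler-product k = T , All.map (λ { (pp , p≢3 , _) → pp , χ-nonzero pp p≢3 }) (primesBelow-spec (suc N)) , primesBelow-unique (suc N) ,
    -- The prime 3 is put back so that every n ≤ N is smooth. Its factor 3/2, together with the 2
    -- from `harmonic-dyadic`, makes up the constant 3 in the statement.
    ℕP.*-cancelˡ-≤ 2 (ℕP.*-cancelʳ-≤ _ _ L (begin
      2 * (k * ∏ pred T) * L              ≡⟨ rearrange₁ k (∏ pred T) L ⟩
      2 * ∏ pred T * (k * L)              ≤⟨ ℕP.*-monoʳ-≤ (2 * ∏ pred T) (harmonic-dyadic 0 k) ⟩
      2 * ∏ pred T * (2 * Σℕ (λ i → quotient L (suc i)) N)
        ≡⟨ cong (λ t → 2 * ∏ pred T * (2 * t)) (smoothSum-all (quotient L) (quotient-scale L) N {3 ∷ T} all-smooth) ⟨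
      2 * ∏ pred T * (2 * G (3 ∷ T))      ≡⟨ rearrange₂ (2 * ∏ pred T) (G (3 ∷ T)) ⟩
      2 * (∏ pred (3 ∷ T) * G (3 ∷ T))    ≤⟨ ℕP.*-monoʳ-≤ 2 (smoothSum-∏ (quotient L) (quotient-scale L) N (prime-3 ∷ All.map proj₁ (primesBelow-spec (suc N)))) ⟩
      2 * (∏ (λ p → p) (3 ∷ T) * G [])    ≤⟨ ℕP.*-monoʳ-≤ 2 (ℕP.*-monoʳ-≤ (∏ (λ p → p) (3 ∷ T)) (smoothSum-[] (quotient L) (quotient-scale L) N)) ⟩
      2 * (∏ (λ p → p) (3 ∷ T) * (L / 1)) ≡⟨ cong (λ t → 2 * (∏ (λ p → p) (3 ∷ T) * t)) (n/1≡n L) ⟩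
      2 * (3 * ∏ (λ p → p) T * L)         ≡⟨ ℕP.*-assoc 2 (3 * ∏ (λ p → p) T) L ⟨
      2 * (3 * ∏ (λ p → p) T) * L         ∎))
    where
    open ℕP.≤-Reasoning
    N = 2 ^ k
    L = 2 ^ k
    instance
      L≢0 : NonZero L
      L≢0 = ℕP.m^n≢0 2 k
    T = primesBelow (suc N)
    G : List ℕ → ℕ
    G = smoothSum (quotient L) (quotient-scale L) N
    rearrange₁ : ∀ k a L → 2 * (k * a) * L ≡ 2 * a * (k * L)
    rearrange₁ = solve-∀
    rearrange₂ : ∀ a g → a * (2 * g) ≡ 2 * (a * g)
    rearrange₂ = solve-∀
    all-smooth : ∀ n → 0 < n → n ≤ N → Smooth (3 ∷ T) n
    all-smooth n n>0 n≤N p pp p∣n with p ℕ.≟ 3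
    ... | yes p≡3 = here p≡3
    ... | no  p≢3 = there (primesBelow-complete (suc N) pp p≢3 (s≤s (ℕP.≤-trans (∣⇒≤ {{ℕ.>-nonZero n>0}} p∣n) n≤N)))

-- The numbers m with r(m) ≥ 1 have density zero.

module SupportDensity where

  open Sums
  open QuadraticForm
  open DivisorCharacterSum
  open EulerProduct
  open import Data.Nat as ℕ using (ℕ; zero; suc; _≤_; _<_; z≤n; s≤s; _+_; _*_; _^_; _∸_; _⊓_; _/_; _%_; NonZero; pred)
  import Data.Nat.Properties as ℕP
  open import Data.Nat.Divisibility using (_∣_; _∣?_; divides; ∣-trans; ∣n⇒∣m*n; m∣m*n; *-monoʳ-∣)
  open import Data.Nat.DivMod using (m≡m%n+[m/n]*n; m%n<n)
  open import Data.Nat.Primality using (Prime; prime⇒nonZero; euclidsLemma)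
  open import Data.Nat.Tactic.RingSolver using (solve-∀)
  open import Data.Integer using (0ℤ)
  open import Data.List using (List; []; _∷_; length)
  open import Data.List.Relation.Unary.All as All using (All; []; _∷_)
  open import Data.List.Relation.Unary.AllPairs using ([]; _∷_)
  open import Data.List.Relation.Unary.Unique.Propositional using (Unique)
  open import Data.Product using (_×_; _,_; ∃-syntax; proj₁)
  open import Data.Sum using ([_,_]′)
  open import Data.Empty using (⊥-elim)
  open import Relation.Nullary using (¬_; Dec; yes; no)
  open import Relation.Binary.PropositionalEquality using (_≡_; _≢_; refl; sym; trans; cong; cong₂; subst)

  δ≤1 : ∀ d n → δ d n ≤ 1
  δ≤1 d n = go (d ∣? n)
    where
    go : Dec (d ∣ n) → δ d n ≤ 1
    go (yes h) = ℕP.≤-reflexive (δ-yes h)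
    go (no h)  = subst (_≤ 1) (sym (δ-no h)) z≤n

  -- 1 if p divides m exactly once, and 2 otherwise.
  weight : ℕ → ℕ → ℕ
  weight p m = 2 + δ (p * p) m ∸ δ p m

  weight-balance : ∀ p m → weight p m + δ p m ≡ 2 + δ (p * p) m
  weight-balance p m = ℕP.m∸n+n≡m (ℕP.≤-trans (δ≤1 p m) (s≤s z≤n))

  -- The product ∏ (1 - [p ∥ m]/2) over T, multiplied by 2^(length T).
  W : List ℕ → ℕ → ℕ
  W T m = ∏ (λ p → weight p m) T

  weight-coprime : ∀ {p q} → Prime p → Prime q → p ≢ q → ∀ m → weight q (p * m) ≡ weight q m
  weight-coprime {p} {q} pp pq p≢q m = cong₂ (λ u v → 2 + u ∸ v)
    (δ-cong (remove-prime pp p∤qq) (∣n⇒∣m*n p)) (δ-cong (remove-prime pp p∤q) (∣n⇒∣m*n p))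
    where
    p∤q : ¬ (p ∣ q)
    p∤q h = p≢q (prime∣prime pp pq h)
    p∤qq : ¬ (p ∣ q * q)
    p∤qq h = [ p∤q , p∤q ]′ (euclidsLemma q q pp h)

  W-coprime : ∀ {p T} → Prime p → All Prime T → All (p ≢_) T → ∀ m → W T (p * m) ≡ W T m
  W-coprime pp []       []       m = refl
  W-coprime pp (h ∷ hs) (k ∷ ks) m = cong₂ _*_ (weight-coprime pp h k m) (W-coprime pp hs ks m)

  -- Each p in T doubles one factor on the right. Either its weight is 2, or p divides m exactly
  -- once; then m = pn with R(m) = 2 R(n), and the other weights are the same at m and n.
  2^length≤R*W : ∀ {T} → All (λ p → Prime p × χ p ≢ 0ℤ) T → Unique T → ∀ m → 0 < m → 0 < R m → 2 ^ length T ≤ R m * W T m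
  2^length≤R*W [] [] m m>0 R>0 = subst (1 ≤_) (sym (ℕP.*-identityʳ (R m))) R>0
  2^length≤R*W {p ∷ T} ((pp , χ≢0) ∷ hs) (p∉T ∷ us) m m>0 R>0 = go (p ∣? m) (p * p ∣? m)
    where
    double : weight p m ≡ 2 → 2 * 2 ^ length T ≤ R m * (weight p m * W T m)
    double w≡2 = begin
      2 * 2 ^ length T             ≤⟨ ℕP.*-monoʳ-≤ 2 (2^length≤R*W hs us m m>0 R>0) ⟩
      2 * (R m * W T m)            ≡⟨ lemma 2 (R m) (W T m) ⟩
      R m * (2 * W T m)            ≡⟨ cong (λ t → R m * (t * W T m)) w≡2 ⟨
      R m * (weight p m * W T m)   ∎
      where
      open ℕP.≤-Reasoning
      lemma : ∀ a b c → a * (b * c) ≡ b * (a * c)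
      lemma = solve-∀
    go : Dec (p ∣ m) → Dec (p * p ∣ m) → 2 * 2 ^ length T ≤ R m * (weight p m * W T m)
    go (no p∤m) _ = double (cong₂ (λ u v → 2 + u ∸ v) (δ-no (λ h → p∤m (∣-trans (m∣m*n p) h))) (δ-no p∤m))
    go (yes p∣m) (no p²∤m) = exactly-once p∣m
      where
      exactly-once : p ∣ m → 2 * 2 ^ length T ≤ R m * (weight p m * W T m)
      exactly-once (divides n m≡) = begin
        2 * 2 ^ length T             ≤⟨ ℕP.*-monoʳ-≤ 2 (2^length≤R*W hs us n n>0 Rn>0) ⟩
        2 * (R n * W T n)            ≡⟨ ℕP.*-assoc 2 (R n) (W T n) ⟨
        2 * R n * W T n              ≡⟨ cong₂ _*_ (trans (cong R m≡pn) R≡) (trans (cong (W T) m≡pn) (W-coprime pp (All.map proj₁ hs) p∉T n)) ⟨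
        R m * W T m                  ≡⟨ cong (R m *_) (ℕP.*-identityˡ (W T m)) ⟨
        R m * (1 * W T m)            ≡⟨ cong (λ t → R m * (t * W T m)) (cong₂ (λ u v → 2 + u ∸ v) (δ-no p²∤m) (δ-yes p∣m)) ⟨
        R m * (weight p m * W T m)   ∎
        where
        open ℕP.≤-Reasoning
        m≡pn : m ≡ p * n
        m≡pn = trans m≡ (ℕP.*-comm n p)
        n>0 : 0 < n
        n>0 = ℕP.n≢0⇒n>0 (λ n≡0 → ℕP.<⇒≢ m>0 (sym (trans m≡ (cong (_* p) n≡0))))
        p∤n : ¬ (p ∣ n)
        p∤n h = p²∤m (subst (p * p ∣_) (sym m≡pn) (*-monoʳ-∣ p h))
        R≡ : R (p * n) ≡ 2 * R n
        R≡ = R-double pp χ≢0 n>0 p∤n (subst (λ t → 0 < R t) m≡pn R>0)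
        Rn>0 : 0 < R n
        Rn>0 = ℕP.n≢0⇒n>0 (λ Rn≡0 → ℕP.<⇒≢ R>0 (sym (trans (cong R m≡pn) (trans R≡ (cong (2 *_) Rn≡0)))))
    go (yes p∣m) (yes p²∣m) = double (cong₂ (λ u v → 2 + u ∸ v) (δ-yes p²∣m) (δ-yes p∣m))

  -- The mean of the product of weights.

  WSum : List ℕ → ℕ → ℕ
  WSum T x = Σℕ (λ i → W T (suc i)) x

  -- The sum of weight p over a period p².
  meanWeight : ℕ → ℕ
  meanWeight p = p * p + p * pred p + 1

  WSum-multiples : ∀ T d → .{{NonZero d}} → (∀ m → W T (d * m) ≡ W T m) → ∀ N →
    Σℕ (λ i → δ d (suc i) * W T (suc i)) (d * N) ≡ WSum T N
  WSum-multiples T d inv N = trans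
    (sum-over-multiples _+_ 0 ℕP.+-identityʳ (Σℕ (λ i → g (suc i))) (Σℕ (λ j → g (d * suc j))) g (λ _ → refl) d
      (λ e d∤e → cong (_* W T e) (δ-no d∤e)) refl (λ _ → refl) N)
    (Σℕ-cong N λ j _ → trans (cong (_* W T (d * suc j)) (δ-yes {d} {d * suc j} (m∣m*n (suc j)))) (trans (ℕP.*-identityˡ _) (inv (suc j))))
    where
    g : ℕ → ℕ
    g e = δ d e * W T e

  -- Independence of distinct primes. The weight of p is 2 - [p ∣ m] + [p² ∣ m], and since `W T` is
  -- invariant under m ↦ pm, the two indicator terms give sums of `W T` over shorter ranges. The
  -- free y lets the induction hypothesis apply to all of these ranges.
  WSum-period : ∀ {T} → All Prime T → Unique T → ∀ y → WSum T (∏ (λ p → p * p) T * y) ≡ ∏ meanWeight T * y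
  WSum-period [] [] y = trans (cong (WSum []) (ℕP.*-identityˡ y)) (trans (Σℕ-const 1 y) (ℕP.*-comm y 1))
  WSum-period {p ∷ T} (pp ∷ ps) (p∉T ∷ us) y = ℕP.+-cancelʳ-≡ (c * (p * y)) _ _ (begin
    WSum (p ∷ T) X + c * (p * y)                  ≡⟨ cong (WSum (p ∷ T) X +_) (trans (once) (WSum-period ps us (p * y))) ⟨
    WSum (p ∷ T) X + Σℕ (λ i → δ p (suc i) * W T (suc i)) X
      ≡⟨ Σℕ-+ _ _ X ⟨
    Σℕ (λ i → weight p (suc i) * W T (suc i) + δ p (suc i) * W T (suc i)) X
      ≡⟨ Σℕ-cong X (λ i _ → balance (suc i)) ⟩
    Σℕ (λ i → 2 * W T (suc i) + δ (p * p) (suc i) * W T (suc i)) X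
      ≡⟨ trans (Σℕ-+ _ _ X) (cong (_+ Σℕ (λ i → δ (p * p) (suc i) * W T (suc i)) X) (Σℕ-* 2 (λ i → W T (suc i)) X)) ⟩
    2 * WSum T X + Σℕ (λ i → δ (p * p) (suc i) * W T (suc i)) X
      ≡⟨ cong₂ (λ u v → 2 * u + v) (trans (cong (WSum T) X≡₀) (WSum-period ps us (p * p * y))) (trans twice (WSum-period ps us y)) ⟩
    2 * (c * (p * p * y)) + c * y                 ≡⟨ total p pp c y ⟩
    meanWeight p * c * y + c * (p * y)            ∎)
    where
    open Relation.Binary.PropositionalEquality.≡-Reasoning
    instance
      p≢0 : NonZero p
      p≢0 = prime⇒nonZero pp
      pp≢0 : NonZero (p * p)
      pp≢0 = ℕP.m*n≢0 p p
    c = ∏ meanWeight T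
    D = ∏ (λ p → p * p) T
    X = p * p * D * y
    X≡₀ : X ≡ D * (p * p * y)
    X≡₀ = lemma (p * p) D y
      where
      lemma : ∀ a D y → a * D * y ≡ D * (a * y)
      lemma = solve-∀
    inv : ∀ m → W T (p * m) ≡ W T m
    inv = W-coprime pp ps p∉T
    once : Σℕ (λ i → δ p (suc i) * W T (suc i)) X ≡ WSum T (D * (p * y))
    once = trans (cong (Σℕ (λ i → δ p (suc i) * W T (suc i))) (lemma p D y)) (WSum-multiples T p inv (D * (p * y)))
      where
      lemma : ∀ p D y → p * p * D * y ≡ p * (D * (p * y))
      lemma = solve-∀
    twice : Σℕ (λ i → δ (p * p) (suc i) * W T (suc i)) X ≡ WSum T (D * y)
    twice = trans (cong (Σℕ (λ i → δ (p * p) (suc i) * W T (suc i))) (ℕP.*-assoc (p * p) D y))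
      (WSum-multiples T (p * p) (λ m → trans (cong (W T) (ℕP.*-assoc p p m)) (trans (inv (p * m)) (inv m))) (D * y))
    balance : ∀ m → weight p m * W T m + δ p m * W T m ≡ 2 * W T m + δ (p * p) m * W T m
    balance m = trans (sym (ℕP.*-distribʳ-+ (W T m) (weight p m) (δ p m)))
      (trans (cong (_* W T m) (weight-balance p m)) (ℕP.*-distribʳ-+ (W T m) 2 (δ (p * p) m)))
    total : ∀ p → Prime p → ∀ c y → 2 * (c * (p * p * y)) + c * y ≡ meanWeight p * c * y + c * (p * y)
    total zero    ()
    total (suc q) _ = lemma q
      where
      lemma : ∀ q c y → 2 * (c * (suc q * suc q * y)) + c * y ≡ (suc q * suc q + suc q * q + 1) * c * y + c * (suc q * y)
      lemma = solve-∀

  -- With v = u + s this is (1 - s/v)^k ≤ 1/(1 + k s/v), a form of Bernoulli's inequality.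
  bernoulli : ∀ u s k → u ^ k * (u + s + k * s) ≤ (u + s) ^ suc k
  bernoulli u s zero    = ℕP.≤-reflexive (lemma u s)
    where
    lemma : ∀ u s → 1 * (u + s + 0) ≡ (u + s) * 1
    lemma = solve-∀
  bernoulli u s (suc k) = begin
    u * u ^ k * (u + s + suc k * s)                              ≤⟨ ℕP.m≤m+n _ (u ^ k * (s * (s + k * s))) ⟩
    u * u ^ k * (u + s + suc k * s) + u ^ k * (s * (s + k * s))  ≡⟨ lemma u s k (u ^ k) ⟩
    (u + s) * (u ^ k * (u + s + k * s))                          ≤⟨ ℕP.*-monoʳ-≤ (u + s) (bernoulli u s k) ⟩
    (u + s) * (u + s) ^ suc k                                    ∎
    where
    open ℕP.≤-Reasoning
    lemma : ∀ u s k P → u * P * (u + s + suc k * s) + P * (s * (s + k * s)) ≡ (u + s) * (P * (u + s + k * s))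
    lemma = solve-∀

  -- The factor meanWeight p / 2p² = 1 - (p - 1)/2p² is at most (1 - 1/p)^(1/k) as soon as k ≥ 8.
  meanWeight-bound : ∀ k → 8 ≤ k → ∀ q → let p = suc (suc q) in
    meanWeight p ^ k * p ≤ (2 * (p * p)) ^ k * pred p
  meanWeight-bound k k≥8 q = ℕP.*-cancelʳ-≤ _ _ v {{ℕ.>-nonZero v>0}} (begin
    u ^ k * p * v                 ≡⟨ ℕP.*-assoc (u ^ k) p v ⟩
    u ^ k * (p * v)               ≤⟨ ℕP.*-monoʳ-≤ (u ^ k) enough ⟩
    u ^ k * ((v + k * s) * s)     ≡⟨ ℕP.*-assoc (u ^ k) (v + k * s) s ⟨
    u ^ k * (v + k * s) * s       ≡⟨ cong (λ t → u ^ k * (t + k * s) * s) u+s≡v ⟨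
    u ^ k * (u + s + k * s) * s   ≤⟨ ℕP.*-monoˡ-≤ s (bernoulli u s k) ⟩
    (u + s) ^ suc k * s           ≡⟨ cong (λ t → t ^ suc k * s) u+s≡v ⟩
    v * v ^ k * s                 ≡⟨ rotate v (v ^ k) s ⟩
    v ^ k * s * v                 ∎)
    where
    open ℕP.≤-Reasoning
    p = suc (suc q)
    s = suc q
    u = meanWeight p
    v = 2 * (p * p)
    v>0 : 0 < v
    v>0 = s≤s z≤n
    rotate : ∀ v V s → v * V * s ≡ V * s * v
    rotate = solve-∀
    u+s≡v : u + s ≡ v
    u+s≡v = lemma q
      where
      lemma : ∀ q → suc (suc q) * suc (suc q) + suc (suc q) * suc q + 1 + suc q ≡ 2 * (suc (suc q) * suc (suc q))
      lemma = solve-∀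
    -- As p = s + 1, this amounts to v ≤ k s². Since s ≥ 1, v = 2(s + 1)² ≤ 8s², which is the origin
    -- of the constant 8.
    enough : p * v ≤ (v + k * s) * s
    enough = begin
      p * v                   ≡⟨⟩
      v + s * v               ≤⟨ ℕP.+-monoˡ-≤ (s * v) v≤ ⟩
      8 * s * s + s * v       ≤⟨ ℕP.+-monoˡ-≤ (s * v) (ℕP.*-monoˡ-≤ s (ℕP.*-monoˡ-≤ s k≥8)) ⟩
      k * s * s + s * v       ≡⟨ lemma k s v ⟩
      (v + k * s) * s         ∎
      where
      lemma : ∀ k s v → k * s * s + s * v ≡ (v + k * s) * s
      lemma = solve-∀
      square : ∀ q → 8 * suc q * suc q ≡ 2 * (suc (suc q) * suc (suc q)) + (8 * q + 6 * (q * q))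
      square = solve-∀
      v≤ : v ≤ 8 * s * s
      v≤ = subst (v ≤_) (sym (square q)) (ℕP.m≤m+n v (8 * q + 6 * (q * q)))

  ^-distrib-* : ∀ a b k → (a * b) ^ k ≡ a ^ k * b ^ k
  ^-distrib-* a b zero    = refl
  ^-distrib-* a b (suc k) = trans (cong (a * b *_) (^-distrib-* a b k)) (lemma a b (a ^ k) (b ^ k))
    where
    lemma : ∀ a b A B → a * b * (A * B) ≡ a * A * (b * B)
    lemma = solve-∀

  ∏-meanWeight-bound : ∀ k → 8 ≤ k → ∀ {T} → All Prime T →
    ∏ meanWeight T ^ k * ∏ (λ p → p) T ≤ ∏ (λ p → 2 * (p * p)) T ^ k * ∏ pred T
  ∏-meanWeight-bound k k≥8 [] = ℕP.≤-refl
  ∏-meanWeight-bound k k≥8 {p ∷ T} (pp ∷ ps) = begin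
    (meanWeight p * ∏ meanWeight T) ^ k * (p * ∏ (λ p → p) T)
      ≡⟨ trans (cong (_* (p * ∏ (λ p → p) T)) (^-distrib-* (meanWeight p) _ k)) (interchange (meanWeight p ^ k) _ p _) ⟩
    (meanWeight p ^ k * p) * (∏ meanWeight T ^ k * ∏ (λ p → p) T)
      ≤⟨ ℕP.*-mono-≤ (factor p pp) (∏-meanWeight-bound k k≥8 ps) ⟩
    ((2 * (p * p)) ^ k * pred p) * (∏ (λ p → 2 * (p * p)) T ^ k * ∏ pred T)
      ≡⟨ trans (cong (_* (pred p * ∏ pred T)) (^-distrib-* (2 * (p * p)) _ k)) (interchange ((2 * (p * p)) ^ k) _ (pred p) _) ⟨
    (2 * (p * p) * ∏ (λ p → 2 * (p * p)) T) ^ k * (pred p * ∏ pred T) ∎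
    where
    open ℕP.≤-Reasoning
    interchange : ∀ a b c d → a * b * (c * d) ≡ (a * c) * (b * d)
    interchange = solve-∀
    factor : ∀ p → Prime p → meanWeight p ^ k * p ≤ (2 * (p * p)) ^ k * pred p
    factor 0 ()
    factor 1 ()
    factor (suc (suc q)) _ = meanWeight-bound k k≥8 q

  ∏-2pp : ∀ T → ∏ (λ p → 2 * (p * p)) T ≡ 2 ^ length T * ∏ (λ p → p * p) T
  ∏-2pp []      = refl
  ∏-2pp (p ∷ T) = trans (cong (2 * (p * p) *_) (∏-2pp T)) (lemma (p * p) (2 ^ length T) (∏ (λ p → p * p) T))
    where
    lemma : ∀ a t D → 2 * a * (t * D) ≡ 2 * t * (a * D)
    lemma = solve-∀

  -- The eighth power of ∏ (1 - (p-1)/2p²) is at most ∏ (1 - 1/p), so it suffices to push the latter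
  -- below 1/M^8. The 3 in the argument of `euler-product` cancels the 3 in its conclusion.
  small-mean : ∀ M → ∃[ T ] All (λ p → Prime p × χ p ≢ 0ℤ) T × Unique T × ∏ meanWeight T * M ≤ 2 ^ length T * ∏ (λ p → p * p) T
  small-mean M = go 8 ℕP.≤-refl
    where
    go : ∀ k → 8 ≤ k → ∃[ T ] All (λ p → Prime p × χ p ≢ 0ℤ) T × Unique T × ∏ meanWeight T * M ≤ 2 ^ length T * ∏ (λ p → p * p) T
    go k k≥8 =
      let T , hs , us , sparse = euler-product (3 * M ^ k)
      in T , hs , us , subst (∏ meanWeight T * M ≤_) (∏-2pp T) (bound T (All.map proj₁ hs) sparse)
      where
      bound : ∀ T → All Prime T → 3 * M ^ k * ∏ pred T ≤ 3 * ∏ (λ p → p) T → ∏ meanWeight T * M ≤ ∏ (λ p → 2 * (p * p)) T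
      bound T ps sparse = ℕP.≮⇒≥ λ v<aM → ℕP.<⇒≱ (ℕP.^-monoˡ-< k {{ℕ.>-nonZero (ℕP.≤-trans (s≤s z≤n) k≥8)}} v<aM)
        (ℕP.*-cancelʳ-≤ _ _ (∏ pred T) {{ℕ.>-nonZero (∏-positive pred (All.map (λ pp → ℕP.≤-pred (subst (2 ≤_) (sym (ℕP.suc-pred _ {{prime⇒nonZero pp}})) (prime>1 pp))) ps))}} (begin
          (a * M) ^ k * ∏ pred T        ≡⟨ trans (cong (_* ∏ pred T) (^-distrib-* a M k)) (ℕP.*-assoc (a ^ k) (M ^ k) _) ⟩
          a ^ k * (M ^ k * ∏ pred T)    ≤⟨ ℕP.*-monoʳ-≤ (a ^ k) (ℕP.*-cancelˡ-≤ 3 (subst (_≤ 3 * ∏ (λ p → p) T) (ℕP.*-assoc 3 (M ^ k) (∏ pred T)) sparse)) ⟩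
          a ^ k * ∏ (λ p → p) T         ≤⟨ ∏-meanWeight-bound k k≥8 ps ⟩
          v ^ k * ∏ pred T              ∎))
        where
        open ℕP.≤-Reasoning
        a = ∏ meanWeight T
        v = ∏ (λ p → 2 * (p * p)) T

  support : ℕ → ℕ
  support m = 1 ⊓ R m

  -- Where R m ≥ K the first summand suffices, and elsewhere 2^length T ≤ R m * W T m ≤ K * W T m does.
  support-bound : ∀ K {T} → All (λ p → Prime p × χ p ≢ 0ℤ) T → Unique T → ∀ m → 0 < m →
    K * 2 ^ length T * support m ≤ 2 ^ length T * R m + K * K * W T m
  support-bound K {T} hs us m m>0 = go (R m) refl
    where
    t = 2 ^ length T
    open ℕP.≤-Reasoning
    split : 0 < R m → Dec (K ≤ R m) → K * t ≤ t * R m + K * K * W T m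
    split R>0 (yes K≤R) = begin
      K * t                       ≡⟨ ℕP.*-comm K t ⟩
      t * K                       ≤⟨ ℕP.*-monoʳ-≤ t K≤R ⟩
      t * R m                     ≤⟨ ℕP.m≤m+n (t * R m) _ ⟩
      t * R m + K * K * W T m     ∎
    split R>0 (no K≰R) = begin
      K * t                       ≤⟨ ℕP.*-monoʳ-≤ K (2^length≤R*W hs us m m>0 R>0) ⟩
      K * (R m * W T m)           ≤⟨ ℕP.*-monoʳ-≤ K (ℕP.*-monoˡ-≤ (W T m) (ℕP.<⇒≤ (ℕP.≰⇒> K≰R))) ⟩
      K * (K * W T m)             ≡⟨ ℕP.*-assoc K K (W T m) ⟨
      K * K * W T m               ≤⟨ ℕP.m≤n+m (K * K * W T m) _ ⟩
      t * R m + K * K * W T m     ∎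
    go : ∀ ρ → ρ ≡ R m → K * t * support m ≤ t * R m + K * K * W T m
    go zero    eq = subst (λ z → K * t * (1 ⊓ z) ≤ t * R m + K * K * W T m) eq (subst (_≤ t * R m + K * K * W T m) (sym (ℕP.*-zeroʳ (K * t))) z≤n)
    go (suc ρ) eq = subst (λ z → K * t * (1 ⊓ z) ≤ t * R m + K * K * W T m) eq
      (subst (_≤ t * R m + K * K * W T m) (sym (ℕP.*-identityʳ (K * t))) (split (subst (0 <_) eq (s≤s z≤n)) (K ℕ.≤? R m)))

  support-sum-bound : ∀ K {T} → All (λ p → Prime p × χ p ≢ 0ℤ) T → Unique T →
    ∏ meanWeight T * (K * K) ≤ 2 ^ length T * ∏ (λ p → p * p) T →
    ∀ x → K * Σℕ (λ i → support (suc i)) x ≤ x + (x + ∏ (λ p → p * p) T)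
  support-sum-bound K {T} hs us small x = ℕP.*-cancelˡ-≤ t {{ℕP.m^n≢0 2 (length T)}} (begin
    t * (K * S)                               ≡⟨ rearrange₀ t K S ⟩
    K * t * S                                 ≡⟨ Σℕ-* (K * t) (λ i → support (suc i)) x ⟨
    Σℕ (λ i → K * t * support (suc i)) x      ≤⟨ Σℕ-mono x (λ i _ → support-bound K hs us (suc i) (s≤s z≤n)) ⟩
    Σℕ (λ i → t * R (suc i) + K * K * W T (suc i)) x
      ≡⟨ trans (Σℕ-+ _ _ x) (cong₂ _+_ (Σℕ-* t (λ i → R (suc i)) x) (Σℕ-* (K * K) (λ i → W T (suc i)) x)) ⟩
    t * Σℕ (λ i → R (suc i)) x + K * K * WSum T x
      ≤⟨ ℕP.+-mono-≤ (ℕP.*-monoʳ-≤ t (R-sum x)) (ℕP.*-monoʳ-≤ (K * K) (Σℕ-monoʳ (λ i → W T (suc i)) x≤Dy)) ⟩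
    t * x + K * K * WSum T (D * y)            ≡⟨ cong (λ z → t * x + K * K * z) (WSum-period (All.map proj₁ hs) us y) ⟩
    t * x + K * K * (∏ meanWeight T * y)      ≡⟨ cong (t * x +_) (rearrange₁ (K * K) (∏ meanWeight T) y) ⟩
    t * x + ∏ meanWeight T * (K * K) * y      ≤⟨ ℕP.+-monoʳ-≤ (t * x) (ℕP.*-monoˡ-≤ y small) ⟩
    t * x + t * D * y                         ≡⟨ rearrange₂ t x D y ⟩
    t * (x + D * y)                           ≤⟨ ℕP.*-monoʳ-≤ t (ℕP.+-monoʳ-≤ x Dy≤) ⟩
    t * (x + (x + D))                         ∎)
    where
    open ℕP.≤-Reasoning
    t = 2 ^ length T
    D = ∏ (λ p → p * p) T
    S = Σℕ (λ i → support (suc i)) x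
    instance
      D≢0 : NonZero D
      D≢0 = ℕ.>-nonZero (∏-positive (λ p → p * p) (All.map (λ h → ℕP.*-mono-≤ (prime>0 (proj₁ h)) (prime>0 (proj₁ h))) hs))
    -- The range x is extended to a multiple D y of the period, at a cost of at most D.
    y = suc (x / D)
    x≤Dy : x ≤ D * y
    x≤Dy = begin
      x                       ≡⟨ m≡m%n+[m/n]*n x D ⟩
      x % D + x / D * D       ≤⟨ ℕP.+-monoˡ-≤ (x / D * D) (ℕP.<⇒≤ (m%n<n x D)) ⟩
      D + x / D * D           ≡⟨ ℕP.*-comm y D ⟩
      D * y                   ∎
    Dy≤ : D * y ≤ x + D
    Dy≤ = begin
      D * y                   ≡⟨ ℕP.*-comm D y ⟩
      D + x / D * D           ≤⟨ ℕP.+-monoʳ-≤ D (ℕP.m≤n+m (x / D * D) (x % D)) ⟩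
      D + (x % D + x / D * D) ≡⟨ cong (D +_) (m≡m%n+[m/n]*n x D) ⟨
      D + x                   ≡⟨ ℕP.+-comm D x ⟩
      x + D                   ∎
    rearrange₀ : ∀ t K S → t * (K * S) ≡ K * t * S
    rearrange₀ = solve-∀
    rearrange₁ : ∀ k a y → k * (a * y) ≡ a * k * y
    rearrange₁ = solve-∀
    rearrange₂ : ∀ t x D y → t * x + t * D * y ≡ t * (x + D * y)
    rearrange₂ = solve-∀

  -- One x comes from the mean of r, one from the mean of `W`, and the third covers the period D ≤
  -- x. The mean of `W` is needed below 2^(length T)/K² because `support-bound` multiplies `W` by
  -- K².
  support-density-zero : ∀ K → ∃[ N ] ∀ x → N ≤ x → K * Σℕ (λ i → support (suc i)) x ≤ 3 * x
  support-density-zero K =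
    let T , hs , us , small = small-mean (K * K)
    in ∏ (λ p → p * p) T , λ x D≤x → ℕP.≤-trans (support-sum-bound K hs us small x)
         (ℕP.+-monoʳ-≤ x (ℕP.+-monoʳ-≤ x (ℕP.≤-trans D≤x (ℕP.m≤m+n x 0))))

-- Transfer to the parity of cp(n), and the limit.

open import Defs
open CopartitionParity using (odd)
open PentagonalNumbers using (odd-cp-represents)
open Sums
open QuadraticForm using (prime-power-cancel; prime>1; form-even-valuation)
open DivisorCharacterSum using (EvenAtInertPrimes; R-positive)
open SupportDensity using (support; support-density-zero)
open import Data.Nat as ℕ using (ℕ; zero; suc; _+_; _*_; _^_; _≤_; _⊓_; NonZero; z≤n; s≤s)
import Data.Nat.Properties as ℕP
open import Data.Nat.Divisibility using (_∣_; divides; ∣-trans; ∣n⇒∣m*n; m∣m*n; ∣⇒≤; ∣m+n∣m⇒∣n; ∣1⇒≡1)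
open import Data.Nat.DivMod using (_%_; [m+n]%n≡m%n)
open import Data.Nat.Primality using (Prime; euclidsLemma)
open import Data.Nat.Tactic.RingSolver using (solve-∀)
open import Data.Integer as ℤ using (+_; -[1+_])
import Data.Integer.Properties as ℤP
open import Data.Rational using (ℚ; mkℚ; _/_; _-_; ∣_∣; _<_; 0ℚ; 1ℚ; toℚᵘ; *<*)
import Data.Rational.Properties as ℚP
import Data.Rational.Unnormalised as ℚᵘ
import Data.Rational.Unnormalised.Properties as ℚᵘP
open import Data.Bool using (Bool; true; false; not; if_then_else_)
open import Data.Bool.Properties using (not-involutive)
open import Data.List using (List; []; _∷_; [_]; _++_; map; upTo)
open import Data.List.Properties using (upTo-∷ʳ; map-++)
open import Data.Product using (_×_; _,_; ∃-syntax)
open import Data.Sum using ([_,_]′)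
open import Data.Empty using (⊥-elim)
open import Relation.Nullary using (¬_)
open import Relation.Binary.PropositionalEquality using (_≡_; _≢_; refl; sym; trans; cong; cong₂; subst)

odd-false⇒2∣ : ∀ n → odd n ≡ false → 2 ∣ n
odd-false⇒2∣ zero          _ = divides 0 refl
odd-false⇒2∣ (suc (suc n)) h =
  let divides q eq = odd-false⇒2∣ n (trans (sym (not-involutive (odd n))) h) in divides (suc q) (cong (2 ℕ.+_) eq)

isEvenᵇ-odd : ∀ n → isEvenᵇ n ≡ not (odd n)
isEvenᵇ-odd zero          = refl
isEvenᵇ-odd (suc zero)    = refl
isEvenᵇ-odd (suc (suc n)) = trans (cong (λ t → t ℕ.≡ᵇ 0) (trans (cong (_% 2) (ℕP.+-comm 2 n)) ([m+n]%n≡m%n n 2)))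
  (trans (isEvenᵇ-odd n) (cong not (sym (not-involutive (odd n)))))

p≢2 : ∀ {p n} → p ∣ 6 * n + 1 → Prime p → p ≢ 2
p≢2 {n = n} h pp refl = ℕP.<⇒≢ (s≤s (s≤s z≤n)) (sym (∣1⇒≡1 (∣m+n∣m⇒∣n h (subst (2 ∣_) (sym (ℕP.*-assoc 2 3 n)) (m∣m*n (3 * n))))))

-- The form represents 4(6n + 1). As 6n + 1 is odd, p is odd and does not divide 4, so the exponent
-- of p is the same in 6n + 1.
odd-cp⇒EvenAtInertPrimes : ∀ n → odd (cp 5 1 6 n) ≡ true → EvenAtInertPrimes (6 * n + 1)
odd-cp⇒EvenAtInertPrimes n h p pp p%3 k p^∣ =
  let x , y , form = odd-cp-represents n h
  in prime-power-cancel pp p∤4 (suc (suc (2 * k))) (subst (p ^ suc (suc (2 * k)) ∣_) form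
       (form-even-valuation pp p≢ p%3 k x y (subst (p ^ suc (2 * k) ∣_) (sym form) (∣n⇒∣m*n 4 p^∣))))
  where
  p≢ : p ≢ 2
  p≢ = p≢2 {n = n} (∣-trans (m∣m*n (p ^ (2 * k))) p^∣) pp
  p∤2 : ¬ (p ∣ 2)
  p∤2 p∣2 = p≢ (ℕP.≤-antisym (∣⇒≤ p∣2) (prime>1 pp))
  p∤4 : ¬ (p ∣ 4)
  p∤4 p∣4 = [ p∤2 , p∤2 ]′ (euclidsLemma 2 2 pp p∣4)

even-at-inert-prime : (n p : ℕ) → Prime p → p % 3 ≡ 2 →
  (∃[ e ] ((∃[ k ] e ≡ 2 * k + 1) × (p ^ e ∣ 6 * n + 1) × ¬ (p ^ suc e ∣ 6 * n + 1))) → 2 ∣ cp 5 1 6 n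
even-at-inert-prime n p pp p%3 (e , (k , e≡) , p^e∣ , p^e+1∤) = odd-false⇒2∣ (cp 5 1 6 n) (not-odd (odd (cp 5 1 6 n)) refl)
  where
  e≡′ : e ≡ suc (2 * k)
  e≡′ = trans e≡ (ℕP.+-comm (2 * k) 1)
  not-odd : ∀ b → odd (cp 5 1 6 n) ≡ b → odd (cp 5 1 6 n) ≡ false
  not-odd false h = h
  not-odd true  h = ⊥-elim (p^e+1∤ (subst (λ t → p ^ suc t ∣ 6 * n + 1) (sym e≡′)
    (odd-cp⇒EvenAtInertPrimes n h p pp p%3 k (subst (λ t → p ^ t ∣ 6 * n + 1) e≡′ p^e∣))))

oddIndicator : ℕ → ℕ
oddIndicator k = if odd k then 1 else 0

count-++ : {A : Set} (p : A → Bool) (xs ys : List A) → count p (xs ++ ys) ≡ count p xs + count p ys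
count-++ p []       ys = refl
count-++ p (x ∷ xs) ys with p x
... | true  = cong suc (count-++ p xs ys)
... | false = count-++ p xs ys

even+odd : ∀ (f : ℕ → ℕ) n → count (λ k → isEvenᵇ (f k)) (map suc (upTo n)) + Σℕ (λ i → oddIndicator (f (suc i))) n ≡ n
even+odd f zero    = refl
even+odd f (suc n) = trans (cong (ℕ._+ (O + o)) split) (trans (rearrange E _ O o) (trans (cong₂ _+_ (last (f (suc n))) (even+odd f n)) refl))
  where
  P : ℕ → Bool
  P k = isEvenᵇ (f k)
  E = count P (map suc (upTo n))
  O = Σℕ (λ i → oddIndicator (f (suc i))) n
  o = oddIndicator (f (suc n))
  split : count P (map suc (upTo (suc n))) ≡ E + count P [ suc n ]
  split = trans (cong (λ l → count P (map suc l)) (sym (upTo-∷ʳ n)))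
    (trans (cong (count P) (map-++ suc (upTo n) [ n ])) (count-++ P (map suc (upTo n)) [ suc n ]))
  rearrange : ∀ E c O o → E + c + (O + o) ≡ (c + o) + (E + O)
  rearrange = solve-∀
  last : ∀ k → (if isEvenᵇ k then 1 else 0) + oddIndicator k ≡ 1
  last k = trans (cong (λ b → (if b then 1 else 0) + oddIndicator k) (isEvenᵇ-odd k)) (cases (odd k))
    where
    cases : ∀ b → (if not b then 1 else 0) + (if b then 1 else 0) ≡ 1
    cases true  = refl
    cases false = refl

oddIndicator≤support : ∀ n → oddIndicator (cp 5 1 6 n) ≤ support (6 * n + 1)
oddIndicator≤support n = go (odd (cp 5 1 6 n)) refl
  where
  go : ∀ b → odd (cp 5 1 6 n) ≡ b → (if odd (cp 5 1 6 n) then 1 else 0) ≤ support (6 * n + 1)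
  go false h = subst (λ b → (if b then 1 else 0) ≤ support (6 * n + 1)) (sym h) z≤n
  go true  h = subst (λ b → (if b then 1 else 0) ≤ support (6 * n + 1)) (sym h)
    (ℕP.⊓-glb ℕP.≤-refl (R-positive (subst (0 ℕ.<_) (ℕP.+-comm 1 (6 * n)) (s≤s z≤n)) (odd-cp⇒EvenAtInertPrimes n h)))

-- The numbers 6i + 1 with 1 ≤ i ≤ n are among the numbers up to 6n + 1, so density zero passes to
-- the progression at the cost of a constant factor.
progression-sum : ∀ (f : ℕ → ℕ) n → Σℕ (λ i → f (6 * suc i + 1)) n ≤ Σℕ (λ i → f (suc i)) (n * 6 + 1)
progression-sum f zero    = z≤n
progression-sum f (suc n) = ℕP.≤-trans (ℕP.+-mono-≤ (progression-sum f n) (ℕP.≤-reflexive (cong f (index n))))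
  (ℕP.≤-trans (ℕP.+-monoˡ-≤ (f (suc (n * 6 + 6))) (Σℕ-monoʳ (λ i → f (suc i)) (ℕP.+-monoʳ-≤ (n * 6) (s≤s z≤n))))
    (ℕP.≤-reflexive (cong (Σℕ (λ i → f (suc i))) (end n))))
  where
  index : ∀ n → 6 * suc n + 1 ≡ suc (n * 6 + 6)
  index = solve-∀
  end : ∀ n → suc (n * 6 + 6) ≡ suc n * 6 + 1
  end = solve-∀

oddCount : ℕ → ℕ
oddCount n = Σℕ (λ i → oddIndicator (cp 5 1 6 (suc i))) n

evenCount+oddCount : ∀ n → evenCount n + oddCount n ≡ n
evenCount+oddCount = even+odd (cp 5 1 6)

oddCount-sparse : ∀ K → ∃[ N ] ∀ n → N ≤ n → K * oddCount n ≤ 3 * (n * 6 + 1)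
oddCount-sparse K =
  let N , bound = support-density-zero K
  in N , λ n N≤n → ℕP.≤-trans
       (ℕP.*-monoʳ-≤ K (ℕP.≤-trans (Σℕ-mono n (λ i _ → oddIndicator≤support (suc i))) (progression-sum support n)))
       (bound (n * 6 + 1) (ℕP.≤-trans N≤n (ℕP.≤-trans (ℕP.m≤m*n n 6) (ℕP.m≤m+n (n * 6) 1))))

-- With n + 1 = E + O, the difference E/(n + 1) - 1 is -O/(n + 1).
∣ratio-1∣ : ∀ E O n → E + O ≡ suc n →
  toℚᵘ ∣ + E / suc n - 1ℚ ∣ ℚᵘ.≃ ℚᵘ.mkℚᵘ (+ O) n
∣ratio-1∣ E O n E+O = ℚᵘP.≃-trans (ℚP.toℚᵘ-homo-∣-∣ (+ E / suc n - 1ℚ)) (ℚᵘP.≃-trans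
  (ℚᵘP.∣-∣-cong (ℚᵘP.≃-trans (ℚP.toℚᵘ-homo-+ (+ E / suc n) _) (ℚᵘP.+-cong (ℚP.toℚᵘ-fromℚᵘ (ℚᵘ.mkℚᵘ (+ E) n)) ℚᵘP.≃-refl)))
  (ℚᵘ.*≡* (cong₂ ℤ._*_ (cong +_ numerator) (cong (λ d → + suc d) (sym (ℕP.*-identityʳ n))))))
  where
  numerator : ℤ.∣ + E ℤ.* + 1 ℤ.+ -[1+ 0 ] ℤ.* + suc n ∣ ≡ O
  numerator = trans (cong ℤ.∣_∣ (trans (cong₂ ℤ._+_ (ℤP.*-identityʳ (+ E)) (trans (ℤP.-1*i≡-i (+ suc n)) (cong (λ t → ℤ.- + t) (sym E+O))))
    (trans (cong (ℤ._+_ (+ E)) (trans (cong ℤ.-_ (ℤP.pos-+ E O)) (ℤP.neg-distrib-+ (+ E) (+ O)))) (cancel (+ E) (ℤ.- + O))))) (ℤP.∣-i∣≡∣i∣ (+ O))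
    where
    cancel : ∀ a b → a ℤ.+ (ℤ.- a ℤ.+ b) ≡ b
    cancel a b = trans (sym (ℤP.+-assoc a (ℤ.- a) b)) (trans (cong (ℤ._+ b) (ℤP.+-inverseʳ a)) (ℤP.+-identityˡ b))

-- A positive ε has numerator at least 1, hence ε ≥ 1/d for its denominator d, and d O < n gives O/n
-- < 1/d.
ratio-close : ∀ E O n → .{{_ : NonZero n}} → E + O ≡ n → ∀ ε → 0ℚ < ε → ℚ.denominatorℕ ε * O ℕ.< n → ∣ + E / n - 1ℚ ∣ < ε
ratio-close E O (suc n) E+O ε@(mkℚ (+ 0)     d _) (*<* (ℤ.+<+ ())) _
ratio-close E O (suc n) E+O ε@(mkℚ -[1+ _ ]  d _) (*<* ()) _
ratio-close E O (suc n) E+O ε@(mkℚ (+ suc a) d _) _ h = ℚP.toℚᵘ-cancel-< (ℚᵘP.<-respˡ-≃ (ℚᵘP.≃-sym (∣ratio-1∣ E O n E+O))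
  (ℚᵘ.*<* (ℤP.≤-<-trans (ℤP.≤-reflexive (sym (ℤP.pos-* O (suc d)))) (ℤP.<-≤-trans (ℤ.+<+ (ℕP.<-≤-trans (subst (ℕ._< suc n) (ℕP.*-comm (suc d) O) h) (ℕP.m≤n*m (suc n) (suc a)))) (ℤP.≤-reflexive (ℤP.pos-* (suc a) (suc n)))))))

theorem4p11 : ((ε : ℚ) → 0ℚ < ε → ∃[ N ] ((n : ℕ) → .{{_ : NonZero n}} → N ≤ n →
    ∣ ((+ evenCount n) / n) - 1ℚ ∣ < ε))
    ×
    ((n p : ℕ) → Prime p → p % 3 ≡ 2 →
    (∃[ e ] ((∃[ k ] e ≡ 2 * k + 1) × (p ^ e ∣ 6 * n + 1) × ¬ (p ^ suc e ∣ 6 * n + 1))) →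
    2 ∣ cp 5 1 6 n)
theorem4p11 = density , even-at-inert-prime
  where
  density : (ε : ℚ) → 0ℚ < ε → ∃[ N ] ((n : ℕ) → .{{_ : NonZero n}} → N ≤ n → ∣ ((+ evenCount n) / n) - 1ℚ ∣ < ε)
  density ε ε>0 =
    let d = ℚ.denominatorℕ ε
        -- The bound 3(6n + 1) = 18n + 3 is below 22n for every n ≥ 1, so 22 cancels and leaves d O
        -- < n.
        N , sparse = oddCount-sparse (22 * d)
    in N , λ n N≤n → ratio-close (evenCount n) (oddCount n) n (evenCount+oddCount n) ε ε>0 (conclude n d (oddCount n) (sparse n N≤n))
    where
    conclude : ∀ n d O → .{{NonZero n}} → 22 * d * O ≤ 3 * (n * 6 + 1) → d * O ℕ.< n
    conclude n d O h = ℕP.*-cancelˡ-< 22 (d * O) n (ℕP.≤-<-trans (subst (_≤ 3 * (n * 6 + 1)) (ℕP.*-assoc 22 d O) h) (strict n))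
      where
      strict : ∀ n → .{{NonZero n}} → 3 * (n * 6 + 1) ℕ.< 22 * n
      strict (suc n) = subst (3 * (suc n * 6 + 1) ℕ.<_) (sym (lemma n)) (ℕP.m<m+n _ (s≤s z≤n))
        where
        lemma : ∀ n → 22 * suc n ≡ 3 * (suc n * 6 + 1) + suc (4 * n)
        lemma = solve-∀
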